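{- Let $\mu,k,r,p$ be positive integers. There exist positive constants $C''$ and $L''$ depending on $\mu,k,p,r$ such that the following holds. Let $G$ be a $\mu$-almost-biregular $K_p^{(2k)}(r)$-free bipartite graph with an ordered bipartition $(M,N)$ where $|M|\leq|N|$. Then \[e(G)\leq C''|M|^{\frac{1}{2}+\frac{1}{2k}}|N|^{\frac{1}{2}}+L''|N|.\]
   Context: A bipartite graph with bipartition $(A,B)$ is $\mu$-almost-biregular if $\Delta_A\leq \mu\delta_A$ and $\Delta_B\leq\mu\delta_B$, where $\Delta_A,\delta_A$ (resp. $\Delta_B,\delta_B$) are the maximum and minimum degrees of vertices in $A$ (resp. $B$). For a graph $H$ and positive integers $k,r$, $H^{(k)}(r)$ is obtained from $H$ by replacing each edge $uv$ by $r$ paths of length $k$ from $u$ to $v$, all $r\,e(H)$ paths pairwise internally vertex-disjoint. $K_p$ is the complete graph on $p$ vertices. -}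

module Defs where

open import Data.Nat using (ℕ; zero; suc; _+_; _*_; _∸_; _<_; _≤_)
open import Data.Nat.Properties using (_<?_)
open import Data.Bool using (Bool; true; false; T)
open import Data.Fin using (Fin; fromℕ<) renaming (zero to fz; suc to fs; _<_ to _<ᶠ_)
open import Data.Sum using (_⊎_; inj₁; inj₂)
open import Data.Product using (Σ; _×_; _,_)
open import Data.Empty using (⊥)
open import Relation.Nullary using (yes; no)
open import Relation.Binary.PropositionalEquality using (_≡_)
open import Function.Definitions using (Injective)

count : (n : ℕ) → (Fin n → Bool) → ℕ
count zero    f = 0
count (suc n) f with f fz
... | true  = suc (count n (λ i → f (fs i)))
... | false = count n (λ i → f (fs i))

sumFin : (n : ℕ) → (Fin n → ℕ) → ℕ
sumFin zero    f = 0
sumFin (suc n) f = f fz + sumFin n (λ i → f (fs i))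

BipGraph : ℕ → ℕ → Set
BipGraph m n = Fin m → Fin n → Bool

degM : ∀ {m n} → BipGraph m n → Fin m → ℕ
degM {m} {n} G a = count n (λ b → G a b)

degN : ∀ {m n} → BipGraph m n → Fin n → ℕ
degN {m} {n} G b = count m (λ a → G a b)

edges : ∀ {m n} → BipGraph m n → ℕ
edges {m} {n} G = sumFin m (degM G)

-- μ-almost-biregular: Δ_M ≤ μ δ_M and Δ_N ≤ μ δ_N, i.e. every degree in a part
-- is at most μ times every degree in the same part.
AlmostBiregular : ∀ {m n} → ℕ → BipGraph m n → Set
AlmostBiregular μ G =
  (∀ a a' → degM G a ≤ μ * degM G a') × (∀ b b' → degN G b ≤ μ * degN G b')

Vert : ℕ → ℕ → Set
Vert m n = Fin m ⊎ Fin n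

Adj : ∀ {m n} → BipGraph m n → Vert m n → Vert m n → Set
Adj G (inj₁ a) (inj₂ b) = T (G a b)
Adj G (inj₂ b) (inj₁ a) = T (G a b)
Adj G _ _ = ⊥

-- The graph K_p^{(2k)}(r): branch vertices Fin p; for every pair i < j of
-- branch vertices and every copy c : Fin r a path of length 2k from i to j,
-- with 2k-1 private internal vertices.
PathIx : ℕ → ℕ → Set
PathIx p r = Σ (Fin p × Fin p) (λ { (i , j) → i <ᶠ j }) × Fin r

HVert : ℕ → ℕ → ℕ → Set
HVert p k r = Fin p ⊎ (PathIx p r × Fin (2 * k ∸ 1))

-- t-th vertex (t = 0 .. 2k) of the path indexed by e
pathVtx : ∀ {p r} (k : ℕ) → PathIx p r → ℕ → HVert p k r
pathVtx k (((i , j) , _) , c) zero = inj₁ i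
pathVtx k e@(((i , j) , _) , c) (suc t) with t <? (2 * k ∸ 1)
... | yes t< = inj₂ (e , fromℕ< t<)
... | no  _  = inj₁ j

ContainsSubdivK : ∀ {m n} → (p k r : ℕ) → BipGraph m n → Set
ContainsSubdivK {m} {n} p k r G =
  Σ (HVert p k r → Vert m n) λ φ →
    Injective _≡_ _≡_ φ ×
    (∀ (e : PathIx p r) (t : ℕ) → t < 2 * k →
       Adj G (φ (pathVtx k e t)) (φ (pathVtx k e (suc t))))

{-# OPTIONS --safe #-}
module Submission where

-- Suppose e(G) is large, so that all degrees exceed a large constant and the number of walks of
-- length 2k from a vertex of M exceeds a large multiple of |M|.  Call a pair of vertices linked
-- by paths of length ℓ if no set of h(ℓ) vertices blocks all of them, where the thresholds h(ℓ)
-- increase fast.  Cutting at blocking sets shows that at most g(ℓ) paths of length ℓ between two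
-- given vertices contain no linked subpath, so almost every walk of length 2k is a path
-- containing a linked subpath; take a shortest one, of length ℓ.
--
-- If some length ℓ ≤ k occurs with positive frequency, almost all of these links can be stretched
-- two steps at a time up to length 2k - ℓ: a link from x to another neighbour y of z extends by
-- y z y₀.  A Kővári–Sós–Turán argument among the walks through one vertex gives p vertices
-- linked in both lengths to many common vertices b, and a pair a, a′ is joined through b.
--
-- Otherwise almost all pairs of walks of length k from some centre w contain a link of length
-- k + g with g ≥ 1 across w.  Colour such a pair by g if, in addition, many continuations of the
-- two initial segments of length g have such a link.  Ramsey's theorem gives p walks of one colour
-- g; their vertices at distance g from w are joined by following continuations outwards, then a
-- link, and then continuations inwards, which has total length 2k.
--
-- In both cases the joining paths can avoid any bounded set, so they are chosen greedily.

-- The power of |M| comes from the walks without links. Both their ends lie in M, so there are at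
-- most a constant times |M|^2 of them, against about |M| (d_M d_N)^k walks of length 2k in all:
-- they are negligible once (d_M d_N)^k is a large multiple of |M|. As e(G) is at most μ |M| d_M and
-- at most μ |N| d_N, this condition is the first term of the bound. The second term provides large
-- degrees on both sides, so that few continuations of a walk meet a given bounded set.
--
-- The split at length k arises because links can be stretched but not shortened. A link of length ℓ
-- ≤ k and its stretched copy of length 2k - ℓ add up to 2k. A longer link has no such partner; but
-- inside a walk of length 2k it passes over the middle vertex wherever it starts, and pieces of the
-- two legs complete it to length 2k, independently of its position.
--
-- The constants follow the dependences: the frequency 1/K of short links comes first, then the loss
-- 1/E allowed in stretching, then the thresholds, and last D and C.

open import Defs
open import Data.Bool using (Bool; true; false; not)
open import Data.Bool.Properties using (T?; not-involutive)
open import Data.Empty using (⊥-elim)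
open import Data.Fin as Fin using (Fin; toℕ; fromℕ<; cast) renaming (zero to fz; suc to fs; _<_ to _<ᶠ_)
import Data.Fin.Properties as Finₚ
open import Data.List using (List; []; _∷_; _++_; _ʳ++_; map; concatMap; length; filter; take; drop; upTo; tabulate; allFin; lookup; cartesianProduct)
open import Data.List.Properties using (length-++; length-map; length-upTo; length-tabulate; length-ʳ++; length-take; length-drop; take-all; take++drop≡id; ++-ʳ++; ∷-injectiveˡ; ∷-injectiveʳ)
open import Data.List.Membership.Propositional using (_∈_; _∉_; find; lose)
open import Data.List.Membership.Propositional.Properties using (∈-++⁺ˡ; ∈-++⁺ʳ; ∈-++⁻; ∈-map⁺; ∈-map⁻; ∈-concatMap⁺; ∈-concatMap⁻; ∈-filter⁺; ∈-filter⁻; ∈-map∘filter⁺; ∈-map∘filter⁻; ∈-upTo⁺; ∈-upTo⁻; ∈-allFin; ∈-lookup; ∈-cartesianProduct⁺)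
open import Data.List.Relation.Unary.All as All using (All; []; _∷_; all?)
import Data.List.Relation.Unary.All.Properties as Allₚ
open import Data.List.Relation.Unary.AllPairs as AllPairs using (AllPairs; []; _∷_)
import Data.List.Relation.Unary.AllPairs.Properties as AllPairsₚ
open import Data.List.Relation.Unary.Any as Any using (Any; here; there; any?)
open import Data.List.Relation.Unary.Unique.Propositional using (Unique)
import Data.List.Relation.Unary.Unique.Propositional.Properties as Uniqueₚ
open import Data.Nat hiding (_≟_)
open import Data.Nat.Induction using (<-rec)
open import Data.Nat.Properties hiding (_≟_)
import Data.Nat.Properties as ℕₚ
open import Data.Nat.Tactic.RingSolver using (solve-∀)
open import Data.Product using (Σ; ∃; _×_; _,_; proj₁; proj₂)
import Data.Product.Properties as Productₚ
open import Data.Sum as Sum using (_⊎_; inj₁; inj₂)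
import Data.Sum.Properties as Sumₚ
open import Data.Unit using (⊤; tt)
open import Function using (_∘_; id; case_of_)
open import Function.Definitions using (Injective)
open import Relation.Binary.Definitions using (DecidableEquality; tri<; tri≈; tri>)
open import Relation.Binary.PropositionalEquality
open import Relation.Nullary using (¬_; Dec; yes; no; ¬?; _×-dec_; _⊎-dec_)
open import Relation.Nullary.Decidable using (map′; decidable-stable)
open import Relation.Unary using (Decidable)

-- Finite sums and indicators

private
  variable
    I I′ : Set
    Φ Ψ : Set

χ : Dec Φ → ℕ
χ (yes _) = 1
χ (no _)  = 0

χ≤1 : (d : Dec Φ) → χ d ≤ 1
χ≤1 (yes _) = ≤-refl
χ≤1 (no _)  = z≤n

χ-≤ : (d : Dec Φ) {n : ℕ} → (Φ → 1 ≤ n) → χ d ≤ n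
χ-≤ (yes p) h = h p
χ-≤ (no _)  h = z≤n

χ-true : (d : Dec Φ) → Φ → χ d ≡ 1
χ-true (yes _) _ = refl
χ-true (no ¬p) p = ⊥-elim (¬p p)

1≤χ : (d : Dec Φ) → Φ → 1 ≤ χ d
1≤χ d p = ≤-reflexive (sym (χ-true d p))

χ-mono : (d : Dec Φ) (e : Dec Ψ) → (Φ → Ψ) → χ d ≤ χ e
χ-mono d e f = χ-≤ d (1≤χ e ∘ f)

χ*-≤ : (d : Dec Φ) {x y : ℕ} → (Φ → x ≤ y) → χ d * x ≤ y
χ*-≤ (yes p) {x} h = ≤-trans (≤-reflexive (*-identityˡ x)) (h p)
χ*-≤ (no _)      h = z≤n

χ-cover : (d : Dec Φ) (e : Dec Ψ) → Φ ⊎ Ψ → 1 ≤ χ d + χ e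
χ-cover d e (inj₁ p) = ≤-trans (1≤χ d p) (m≤m+n _ _)
χ-cover d e (inj₂ q) = ≤-trans (1≤χ e q) (m≤n+m _ _)

χ-cases : {R S : Set} (d : Dec Φ) (q : Dec Ψ) (e : Dec R) (f : Dec S) →
  (Φ → Ψ → R) → (Φ → ¬ Ψ → S) → χ d ≤ χ e + χ f
χ-cases d (yes q) e f r s = χ-≤ d (λ p → χ-cover e f (inj₁ (r p q)))
χ-cases d (no ¬q) e f r s = χ-≤ d (λ p → χ-cover e f (inj₂ (s p ¬q)))

∑ : List I → (I → ℕ) → ℕ
∑ []       f = 0
∑ (x ∷ xs) f = f x + ∑ xs f

∑-mono : (xs : List I) {f g : I → ℕ} → (∀ x → x ∈ xs → f x ≤ g x) → ∑ xs f ≤ ∑ xs g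
∑-mono []       h = z≤n
∑-mono (x ∷ xs) h = +-mono-≤ (h x (here refl)) (∑-mono xs (λ y → h y ∘ there))

∑-cong : (xs : List I) {f g : I → ℕ} → (∀ x → x ∈ xs → f x ≡ g x) → ∑ xs f ≡ ∑ xs g
∑-cong []       h = refl
∑-cong (x ∷ xs) h = cong₂ _+_ (h x (here refl)) (∑-cong xs (λ y → h y ∘ there))

∑-+ : (xs : List I) (f g : I → ℕ) → ∑ xs (λ x → f x + g x) ≡ ∑ xs f + ∑ xs g
∑-+ []       f g = refl
∑-+ (x ∷ xs) f g = begin
  (f x + g x) + ∑ xs (λ y → f y + g y)   ≡⟨ cong (f x + g x +_) (∑-+ xs f g) ⟩
  (f x + g x) + (∑ xs f + ∑ xs g)        ≡⟨ +-assoc (f x) (g x) _ ⟩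
  f x + (g x + (∑ xs f + ∑ xs g))        ≡⟨ cong (f x +_) (sym (+-assoc (g x) _ _)) ⟩
  f x + (g x + ∑ xs f + ∑ xs g)          ≡⟨ cong (λ t → f x + (t + ∑ xs g)) (+-comm (g x) _) ⟩
  f x + (∑ xs f + g x + ∑ xs g)          ≡⟨ cong (f x +_) (+-assoc (∑ xs f) _ _) ⟩
  f x + (∑ xs f + (g x + ∑ xs g))        ≡⟨ sym (+-assoc (f x) _ _) ⟩
  f x + ∑ xs f + (g x + ∑ xs g)          ∎
  where open ≡-Reasoning

∑-*ˡ : (xs : List I) (c : ℕ) (f : I → ℕ) → ∑ xs (λ x → c * f x) ≡ c * ∑ xs f
∑-*ˡ []       c f = sym (*-zeroʳ c)
∑-*ˡ (x ∷ xs) c f = trans (cong (c * f x +_) (∑-*ˡ xs c f)) (sym (*-distribˡ-+ c (f x) _))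

∑-*ʳ : (xs : List I) (c : ℕ) (f : I → ℕ) → ∑ xs (λ x → f x * c) ≡ ∑ xs f * c
∑-*ʳ []       c f = refl
∑-*ʳ (x ∷ xs) c f = trans (cong (f x * c +_) (∑-*ʳ xs c f)) (sym (*-distribʳ-+ c (f x) _))

∑-const : (xs : List I) (c : ℕ) → ∑ xs (λ _ → c) ≡ length xs * c
∑-const []       c = refl
∑-const (x ∷ xs) c = cong (c +_) (∑-const xs c)

∑-1 : (xs : List I) → ∑ xs (λ _ → 1) ≡ length xs
∑-1 xs = trans (∑-const xs 1) (*-identityʳ _)

∑-0 : (xs : List I) → ∑ xs (λ _ → 0) ≡ 0
∑-0 xs = trans (∑-const xs 0) (*-zeroʳ (length xs))

∑-bound : (xs : List I) {f : I → ℕ} {c : ℕ} → (∀ x → x ∈ xs → f x ≤ c) → ∑ xs f ≤ length xs * c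
∑-bound xs {c = c} h = ≤-trans (∑-mono xs h) (≤-reflexive (∑-const xs c))

∑-χ≤length : (xs : List I) {R : I → Set} (R? : Decidable R) → ∑ xs (χ ∘ R?) ≤ length xs
∑-χ≤length xs R? = ≤-trans (∑-bound xs (λ x _ → χ≤1 (R? x))) (≤-reflexive (*-identityʳ _))

∑-++ : (xs ys : List I) (f : I → ℕ) → ∑ (xs ++ ys) f ≡ ∑ xs f + ∑ ys f
∑-++ []       ys f = refl
∑-++ (x ∷ xs) ys f = trans (cong (f x +_) (∑-++ xs ys f)) (sym (+-assoc (f x) _ _))

∑-map : (h : I → I′) (xs : List I) (f : I′ → ℕ) → ∑ (map h xs) f ≡ ∑ xs (f ∘ h)
∑-map h []       f = refl
∑-map h (x ∷ xs) f = cong (f (h x) +_) (∑-map h xs f)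

∑-concatMap : (h : I → List I′) (xs : List I) (f : I′ → ℕ) →
  ∑ (concatMap h xs) f ≡ ∑ xs (λ x → ∑ (h x) f)
∑-concatMap h []       f = refl
∑-concatMap h (x ∷ xs) f =
  trans (∑-++ (h x) (concatMap h xs) f) (cong (∑ (h x) f +_) (∑-concatMap h xs f))

∑-swap : (xs : List I) (ys : List I′) (f : I → I′ → ℕ) →
  ∑ xs (λ x → ∑ ys (f x)) ≡ ∑ ys (λ y → ∑ xs (λ x → f x y))
∑-swap []       ys f = sym (∑-0 ys)
∑-swap (x ∷ xs) ys f =
  trans (cong (∑ ys (f x) +_) (∑-swap xs ys f)) (sym (∑-+ ys (f x) _))

∑-∈ : {xs : List I} {x : I} (f : I → ℕ) → x ∈ xs → f x ≤ ∑ xs f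
∑-∈ f (here refl) = m≤m+n _ _
∑-∈ f (there i)   = ≤-trans (∑-∈ f i) (m≤n+m _ _)

∑-filter : {R : I → Set} (R? : Decidable R) (xs : List I) (f : I → ℕ) →
  ∑ (filter R? xs) f ≡ ∑ xs (λ x → χ (R? x) * f x)
∑-filter R? []       f = refl
∑-filter R? (x ∷ xs) f with R? x
... | yes _ = cong₂ _+_ (sym (+-identityʳ (f x))) (∑-filter R? xs f)
... | no  _ = ∑-filter R? xs f

length-filter-χ : {R : I → Set} (R? : Decidable R) (xs : List I) →
  length (filter R? xs) ≡ ∑ xs (χ ∘ R?)
length-filter-χ R? xs = begin
  length (filter R? xs)            ≡⟨ sym (∑-1 (filter R? xs)) ⟩
  ∑ (filter R? xs) (λ _ → 1)       ≡⟨ ∑-filter R? xs _ ⟩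
  ∑ xs (λ x → χ (R? x) * 1)        ≡⟨ ∑-cong xs (λ x _ → *-identityʳ _) ⟩
  ∑ xs (χ ∘ R?)                    ∎
  where open ≡-Reasoning

∑-<-∃ : (xs : List I) {f g : I → ℕ} → ∑ xs f < ∑ xs g → ∃ λ x → x ∈ xs × f x < g x
∑-<-∃ (x ∷ xs) {f} {g} lt with f x <? g x
... | yes p = x , here refl , p
... | no ¬p = let (y , i , q) = ∑-<-∃ xs (+-cancelˡ-< (g x) _ _
                    (<-≤-trans (≤-<-trans (+-monoˡ-≤ _ (≮⇒≥ ¬p)) lt) ≤-refl))
              in y , there i , q

∑-≤-∃ : (xs : List I) {f g : I → ℕ} → 0 < length xs → ∑ xs f ≤ ∑ xs g →
  ∃ λ x → x ∈ xs × f x ≤ g x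
∑-≤-∃ (x ∷ xs) {f} {g} _ le with f x ≤? g x
... | yes p = x , here refl , p
... | no ¬p = let (y , i , q) = ∑-<-∃ xs {f} {g} (+-cancelˡ-< (g x) _ _
                    (<-≤-trans (+-monoˡ-< _ (≰⇒> ¬p)) le))
              in y , there i , <⇒≤ q

module _ (_≟_ : DecidableEquality I) where
  open import Data.List.Membership.DecPropositional _≟_ using (_∈?_)

  ∑-unique-≟ : {xs : List I} → Unique xs → (z : I) → ∑ xs (λ x → χ (x ≟ z)) ≤ 1
  ∑-unique-≟ [] z = z≤n
  ∑-unique-≟ {xs = x ∷ xs} (x∉ ∷ u) z with x ≟ z
  ... | no  _    = ∑-unique-≟ u z
  ... | yes refl = ≤-reflexive (cong suc (trans (∑-cong xs λ y i → zeroAt y i) (∑-0 xs)))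
    where
    zeroAt : ∀ y → y ∈ xs → χ (y ≟ x) ≡ 0
    zeroAt y i with y ≟ x
    ... | yes refl = ⊥-elim (All.lookup x∉ i refl)
    ... | no _     = refl

  χ∈≤∑ : (x : I) (F : List I) → χ (x ∈? F) ≤ ∑ F (λ z → χ (x ≟ z))
  χ∈≤∑ x F = χ-≤ (x ∈? F) (λ i → ≤-trans (1≤χ (x ≟ x) refl) (∑-∈ (λ z → χ (x ≟ z)) i))

  ∑-unique-∈ : {xs : List I} → Unique xs → (F : List I) → ∑ xs (λ x → χ (x ∈? F)) ≤ length F
  ∑-unique-∈ {xs = xs} u F = begin
    ∑ xs (λ x → χ (x ∈? F))              ≤⟨ ∑-mono xs (λ x _ → χ∈≤∑ x F) ⟩
    ∑ xs (λ x → ∑ F (λ z → χ (x ≟ z)))   ≡⟨ ∑-swap xs F _ ⟩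
    ∑ F (λ z → ∑ xs (λ x → χ (x ≟ z)))   ≤⟨ ∑-bound F (λ z _ → ∑-unique-≟ u z) ⟩
    length F * 1                         ≡⟨ *-identityʳ _ ⟩
    length F                             ∎
    where open ≤-Reasoning

-- Walks in bipartite graphs

record BipartiteGraph : Set₁ where
  field
    V          : Set
    _≟_        : DecidableEquality V
    side       : V → Bool
    verts      : Bool → List V
    verts-∈    : ∀ x → x ∈ verts (side x)
    verts-side : ∀ {s x} → x ∈ verts s → side x ≡ s
    verts-!    : ∀ s → Unique (verts s)
    nbrs       : V → List V
    nbrs-!     : ∀ x → Unique (nbrs x)
    nbrs-side  : ∀ {x y} → y ∈ nbrs x → side y ≡ not (side x)
    nbrs-sym   : ∀ {x y} → y ∈ nbrs x → x ∈ nbrs y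
    -- Double counting of the edges. Through this identity walks are recounted from another of their
    -- vertices.
    nbrs-swap  : ∀ s (f : V → V → ℕ) →
      ∑ (verts s) (λ x → ∑ (nbrs x) (f x)) ≡ ∑ (verts (not s)) (λ y → ∑ (nbrs y) (λ x → f x y))

  infix 4 _≟_
  open import Data.List.Membership.DecPropositional _≟_ public using (_∈?_)
  open import Data.List.Relation.Unary.Unique.DecPropositional _≟_ public using (unique?)

flips : ℕ → Bool → Bool
flips zero    s = s
flips (suc i) s = flips i (not s)

flips-not : ∀ i s → flips i (not s) ≡ not (flips i s)
flips-not zero    s = refl
flips-not (suc i) s = flips-not i (not s)

flips-+ : ∀ i j s → flips (i + j) s ≡ flips j (flips i s)
flips-+ zero    j s = refl
flips-+ (suc i) j s = flips-+ i j (not s)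

module Walks (Γ : BipartiteGraph) where
  open BipartiteGraph Γ

  -- A walk is a start vertex together with the list of the vertices it visits afterwards.
  IsWalk : V → List V → Set
  IsWalk x []      = ⊤
  IsWalk x (y ∷ a) = y ∈ nbrs x × IsWalk y a

  end : V → List V → V
  end x []      = x
  end x (y ∷ a) = end y a

  legs : ℕ → V → List (List V)
  legs zero    x = [] ∷ []
  legs (suc j) x = concatMap (λ y → map (y ∷_) (legs j y)) (nbrs x)

  ∈-legs⁻ : ∀ j {x a} → a ∈ legs j x → length a ≡ j × IsWalk x a
  ∈-legs⁻ zero    (here refl) = refl , tt
  ∈-legs⁻ (suc j) {x} i = go (nbrs x) (λ z → z) (∈-concatMap⁻ (λ y → map (y ∷_) (legs j y)) {xs = nbrs x} i)
    where
    go : ∀ {a} ys → (∀ {y} → y ∈ ys → y ∈ nbrs x) → Any (λ y → a ∈ map (y ∷_) (legs j y)) ys →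
         length a ≡ suc j × IsWalk x a
    go (y ∷ ys) sub (here h) with ∈-map⁻ (y ∷_) h
    ... | b , b∈ , refl = let (l , w) = ∈-legs⁻ j b∈ in cong suc l , sub (here refl) , w
    go (y ∷ ys) sub (there h) = go ys (sub ∘ there) h

  ∈-legs⁺ : ∀ {x} a → IsWalk x a → a ∈ legs (length a) x
  ∈-legs⁺ []      _       = here refl
  ∈-legs⁺ {x} (y ∷ a) (i , w) =
    ∈-concatMap⁺ (λ y → map (y ∷_) (legs (length a) y)) {xs = nbrs x}
      (Any.map (λ { refl → ∈-map⁺ (y ∷_) (∈-legs⁺ a w) }) i)

  ∈-legs⁺′ : ∀ {x j} a → length a ≡ j → IsWalk x a → a ∈ legs j x
  ∈-legs⁺′ a refl w = ∈-legs⁺ a w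

  ∑-legs-suc : ∀ j x (f : List V → ℕ) →
    ∑ (legs (suc j) x) f ≡ ∑ (nbrs x) (λ y → ∑ (legs j y) (λ a → f (y ∷ a)))
  ∑-legs-suc j x f = trans (∑-concatMap _ (nbrs x) f) (∑-cong (nbrs x) λ y _ → ∑-map (y ∷_) (legs j y) f)

  ∑-legs-+ : ∀ i j x (f : List V → ℕ) →
    ∑ (legs (i + j) x) f ≡ ∑ (legs i x) (λ a → ∑ (legs j (end x a)) (λ b → f (a ++ b)))
  ∑-legs-+ zero    j x f = sym (+-identityʳ _)
  ∑-legs-+ (suc i) j x f = begin
    ∑ (legs (suc i + j) x) f                                                       ≡⟨ ∑-legs-suc (i + j) x f ⟩
    ∑ (nbrs x) (λ y → ∑ (legs (i + j) y) (λ a → f (y ∷ a)))                        ≡⟨ ∑-cong (nbrs x) (λ y _ → ∑-legs-+ i j y _) ⟩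
    ∑ (nbrs x) (λ y → ∑ (legs i y) (λ a → ∑ (legs j (end y a)) (λ b → f (y ∷ a ++ b)))) ≡⟨ sym (∑-legs-suc i x _) ⟩
    ∑ (legs (suc i) x) (λ a → ∑ (legs j (end x a)) (λ b → f (a ++ b)))             ∎
    where open ≡-Reasoning

  IsWalk-++ : ∀ {x} a {b} → IsWalk x a → IsWalk (end x a) b → IsWalk x (a ++ b)
  IsWalk-++ []      _       v = v
  IsWalk-++ (y ∷ a) (i , w) v = i , IsWalk-++ a w v

  IsWalk-++⁻ : ∀ {x} a {b} → IsWalk x (a ++ b) → IsWalk x a × IsWalk (end x a) b
  IsWalk-++⁻ []      w       = tt , w
  IsWalk-++⁻ (y ∷ a) (i , w) = let (u , v) = IsWalk-++⁻ a w in (i , u) , v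

  end-++ : ∀ x a b → end x (a ++ b) ≡ end (end x a) b
  end-++ x []      b = refl
  end-++ x (y ∷ a) b = end-++ y a b

  end-∈ : ∀ x y a → end x (y ∷ a) ∈ y ∷ a
  end-∈ x y []      = here refl
  end-∈ x y (z ∷ a) = there (end-∈ y z a)

  end-∈∷ : ∀ x a → end x a ∈ x ∷ a
  end-∈∷ x []      = here refl
  end-∈∷ x (y ∷ a) = there (end-∈ x y a)

  end-side : ∀ {x} a → IsWalk x a → side (end x a) ≡ flips (length a) (side x)
  end-side []      _       = refl
  end-side (y ∷ a) (i , w) = trans (end-side a w) (cong (flips (length a)) (nbrs-side i))

  -- Reversal with an accumulator: `end x a ∷ back x a acc` runs along `a` backwards to `x` and then
  -- along `acc`. The start is kept out of the list, as for every walk.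
  back : V → List V → List V → List V
  back x []      acc = acc
  back x (y ∷ a) acc = back y a (x ∷ acc)

  ʳ++-back : ∀ x a acc → a ʳ++ (x ∷ acc) ≡ end x a ∷ back x a acc
  ʳ++-back x []      acc = refl
  ʳ++-back x (y ∷ a) acc = ʳ++-back y a (x ∷ acc)

  back-walk : ∀ x a acc → IsWalk x a → IsWalk x acc → IsWalk (end x a) (back x a acc)
  back-walk x []      acc w       v = v
  back-walk x (y ∷ a) acc (i , w) v = back-walk y a (x ∷ acc) w (nbrs-sym i , v)

  back-end : ∀ x a acc → end (end x a) (back x a acc) ≡ end x acc
  back-end x []      acc = refl
  back-end x (y ∷ a) acc = back-end y a (x ∷ acc)

  back-length : ∀ x a acc → length (back x a acc) ≡ length a + length acc
  back-length x []      acc = refl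
  back-length x (y ∷ a) acc = trans (back-length y a (x ∷ acc)) (+-suc (length a) (length acc))

  nbrs-irrefl : ∀ {x} → x ∉ nbrs x
  nbrs-irrefl {x} i with side x | nbrs-side i
  ... | true  | ()
  ... | false | ()

  ∑-legs-snoc : ∀ j x (f : List V → ℕ) →
    ∑ (legs (suc j) x) f ≡ ∑ (legs j x) (λ c → ∑ (nbrs (end x c)) (λ y → f (c ++ y ∷ [])))
  ∑-legs-snoc j x f = begin
    ∑ (legs (suc j) x) f                                                    ≡⟨ cong (λ t → ∑ (legs t x) f) (+-comm 1 j) ⟩
    ∑ (legs (j + 1) x) f                                                    ≡⟨ ∑-legs-+ j 1 x f ⟩
    ∑ (legs j x) (λ c → ∑ (legs 1 (end x c)) (λ b → f (c ++ b)))            ≡⟨ ∑-cong (legs j x) (λ c _ → trans (∑-legs-suc 0 (end x c) _) (∑-cong (nbrs (end x c)) λ y _ → +-identityʳ _)) ⟩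
    ∑ (legs j x) (λ c → ∑ (nbrs (end x c)) (λ y → f (c ++ y ∷ [])))         ∎
    where open ≡-Reasoning

  -- Sums over all walks of length i + j, indexed by the vertex reached after i steps.
  centred : ℕ → ℕ → Bool → (List V → ℕ) → ℕ
  centred i j s f = ∑ (verts s) λ w → ∑ (legs i w) λ a → ∑ (legs j w) λ b → f (a ʳ++ (w ∷ b))

  -- Double counting the first edge of the left leg makes its far end the new centre and hands the
  -- old centre to the right leg.
  centred-shift : ∀ i j s f → centred (suc i) j s f ≡ centred i (suc j) (not s) f
  centred-shift i j s f = begin
    ∑ (verts s) (λ w → ∑ (legs (suc i) w) (λ a → ∑ (legs j w) (λ b → f (a ʳ++ (w ∷ b)))))
      ≡⟨ ∑-cong (verts s) (λ w _ → ∑-legs-suc i w _) ⟩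
    ∑ (verts s) (λ w → ∑ (nbrs w) (λ y → ∑ (legs i y) (λ a → ∑ (legs j w) (λ b → f (a ʳ++ (y ∷ w ∷ b))))))
      ≡⟨ nbrs-swap s _ ⟩
    ∑ (verts (not s)) (λ y → ∑ (nbrs y) (λ w → ∑ (legs i y) (λ a → ∑ (legs j w) (λ b → f (a ʳ++ (y ∷ w ∷ b))))))
      ≡⟨ ∑-cong (verts (not s)) (λ y _ → ∑-swap (nbrs y) (legs i y) _) ⟩
    ∑ (verts (not s)) (λ y → ∑ (legs i y) (λ a → ∑ (nbrs y) (λ w → ∑ (legs j w) (λ b → f (a ʳ++ (y ∷ w ∷ b))))))
      ≡⟨ ∑-cong (verts (not s)) (λ y _ → ∑-cong (legs i y) (λ a _ → sym (∑-legs-suc j y _))) ⟩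
    ∑ (verts (not s)) (λ y → ∑ (legs i y) (λ a → ∑ (legs (suc j) y) (λ b → f (a ʳ++ (y ∷ b)))))
      ∎
    where open ≡-Reasoning

  centred-0 : ∀ i j s f → centred i j (flips i s) f ≡ centred 0 (i + j) s f
  centred-0 zero    j s f = refl
  centred-0 (suc i) j s f = begin
    centred (suc i) j (flips i (not s)) f     ≡⟨ centred-shift i j (flips i (not s)) f ⟩
    centred i (suc j) (not (flips i (not s))) f ≡⟨ cong (λ t → centred i (suc j) t f) (trans (cong not (flips-not i s)) (not-involutive (flips i s))) ⟩
    centred i (suc j) (flips i s) f           ≡⟨ centred-0 i (suc j) s f ⟩
    centred 0 (i + suc j) s f                 ≡⟨ cong (λ t → centred 0 t s f) (+-suc i j) ⟩
    centred 0 (suc i + j) s f                 ∎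
    where open ≡-Reasoning

  total : ℕ → Bool → ℕ
  total j s = ∑ (verts s) λ x → length (legs j x)

  centred-0-1 : ∀ j s f → centred 0 j s f ≡ ∑ (verts s) (λ x → ∑ (legs j x) (λ a → f (x ∷ a)))
  centred-0-1 j s f = ∑-cong (verts s) (λ x _ → +-identityʳ _)

-- Walk counts under almost-biregularity

module Degrees (Γ : BipartiteGraph) (μ : ℕ) (1≤μ : 1 ≤ μ) (d : Bool → ℕ)
  (deg-lo : ∀ x → d (BipartiteGraph.side Γ x) ≤ μ * length (BipartiteGraph.nbrs Γ x))
  (deg-hi : ∀ x → length (BipartiteGraph.nbrs Γ x) ≤ μ * d (BipartiteGraph.side Γ x))
  (D : ℕ) (D≤d : ∀ s → D ≤ d s) where

  open BipartiteGraph Γ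
  open Walks Γ

  -- The number of walks of length j from side s if each vertex had exactly the degree `d` of its
  -- side. The true numbers differ from it by a factor of at most μ^j in either direction.
  π : ℕ → Bool → ℕ
  π zero    s = 1
  π (suc j) s = d s * π j (not s)

  π-+ : ∀ i j s → π (i + j) s ≡ π i s * π j (flips i s)
  π-+ zero    j s = sym (+-identityʳ _)
  π-+ (suc i) j s = trans (cong (d s *_) (π-+ i j (not s))) (sym (*-assoc (d s) _ _))

  length-legs-suc : ∀ j x → length (legs (suc j) x) ≡ ∑ (nbrs x) (λ y → length (legs j y))
  length-legs-suc j x = begin
    length (legs (suc j) x)                          ≡⟨ sym (∑-1 (legs (suc j) x)) ⟩
    ∑ (legs (suc j) x) (λ _ → 1)                     ≡⟨ ∑-legs-suc j x _ ⟩
    ∑ (nbrs x) (λ y → ∑ (legs j y) (λ _ → 1))        ≡⟨ ∑-cong (nbrs x) (λ y _ → ∑-1 (legs j y)) ⟩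
    ∑ (nbrs x) (λ y → length (legs j y))             ∎
    where open ≡-Reasoning

  legs-hi : ∀ j x → length (legs j x) ≤ μ ^ j * π j (side x)
  legs-hi zero    x = ≤-refl
  legs-hi (suc j) x = begin
    length (legs (suc j) x)                           ≡⟨ length-legs-suc j x ⟩
    ∑ (nbrs x) (λ y → length (legs j y))              ≤⟨ ∑-bound (nbrs x) (λ y i → ≤-trans (legs-hi j y) (≤-reflexive (cong (λ s → μ ^ j * π j s) (nbrs-side i)))) ⟩
    length (nbrs x) * (μ ^ j * π j (not (side x)))    ≤⟨ *-monoˡ-≤ _ (deg-hi x) ⟩
    μ * d (side x) * (μ ^ j * π j (not (side x)))     ≡⟨ lem μ (d (side x)) (μ ^ j) (π j (not (side x))) ⟩
    μ ^ suc j * π (suc j) (side x)                    ∎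
    where
    open ≤-Reasoning
    lem : ∀ a b c e → a * b * (c * e) ≡ (a * c) * (b * e)
    lem = solve-∀

  legs-lo : ∀ j x → π j (side x) ≤ μ ^ j * length (legs j x)
  legs-lo zero    x = ≤-refl
  legs-lo (suc j) x = begin
    d (side x) * π j (not (side x))                        ≤⟨ *-monoˡ-≤ _ (deg-lo x) ⟩
    μ * length (nbrs x) * π j (not (side x))               ≡⟨ *-assoc μ _ _ ⟩
    μ * (length (nbrs x) * π j (not (side x)))             ≡⟨ cong (μ *_) (sym (∑-const (nbrs x) _)) ⟩
    μ * ∑ (nbrs x) (λ _ → π j (not (side x)))              ≤⟨ *-monoʳ-≤ μ (∑-mono (nbrs x) (λ y i → ≤-trans (≤-reflexive (cong (π j) (sym (nbrs-side i)))) (legs-lo j y))) ⟩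
    μ * ∑ (nbrs x) (λ y → μ ^ j * length (legs j y))       ≡⟨ cong (μ *_) (∑-*ˡ (nbrs x) (μ ^ j) _) ⟩
    μ * (μ ^ j * ∑ (nbrs x) (λ y → length (legs j y)))     ≡⟨ sym (*-assoc μ _ _) ⟩
    μ ^ suc j * ∑ (nbrs x) (λ y → length (legs j y))       ≡⟨ cong (μ ^ suc j *_) (sym (length-legs-suc j x)) ⟩
    μ ^ suc j * length (legs (suc j) x)                    ∎
    where open ≤-Reasoning

  legs-nonempty : 1 ≤ D → ∀ j x → 0 < length (legs j x)
  legs-nonempty 1≤D j x = n≢0⇒n>0 λ e → <⇒≱ (π-pos j (side x))
    (≤-trans (legs-lo j x) (≤-reflexive (trans (cong (μ ^ j *_) e) (*-zeroʳ (μ ^ j)))))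
    where
    π-pos : ∀ j s → 0 < π j s
    π-pos zero    s = s≤s z≤n
    π-pos (suc j) s = *-mono-≤ (≤-trans 1≤D (D≤d s)) (π-pos j (not s))

  meets? : (F a : List V) → Dec (Any (_∈ F) a)
  meets? F a = any? (_∈? F) a

  hits : ℕ → V → List V → ℕ
  hits j x F = ∑ (legs j x) (λ a → χ (meets? F a))

  -- Union bound over the j steps: a step into `F` has at most `length F` choices, which saves a
  -- factor of order `D` over an arbitrary step.
  hits-bound : ∀ j x F → D * hits j x F ≤ j * length F * (μ ^ j * π j (side x))
  hits-bound zero    x F = ≤-reflexive (*-zeroʳ D)
  hits-bound (suc j) x F = begin
    D * hits (suc j) x F
      ≡⟨ cong (D *_) (∑-legs-suc j x _) ⟩
    D * ∑ (nbrs x) (λ y → ∑ (legs j y) (λ a → χ (meets? F (y ∷ a))))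
      ≤⟨ *-monoʳ-≤ D (∑-mono (nbrs x) λ y _ → ≤-trans (∑-mono (legs j y) λ a _ → step y a) (≤-reflexive (trans (∑-+ (legs j y) _ _) (cong (_+ hits j y F) (∑-const (legs j y) _))))) ⟩
    D * ∑ (nbrs x) (λ y → length (legs j y) * χ (y ∈? F) + hits j y F)
      ≤⟨ *-monoʳ-≤ D (∑-mono (nbrs x) λ y i → +-monoˡ-≤ _ (*-monoˡ-≤ _ (≤-trans (legs-hi j y) (≤-reflexive (cong (λ s → μ ^ j * π j s) (nbrs-side i)))))) ⟩
    D * ∑ (nbrs x) (λ y → A * χ (y ∈? F) + hits j y F)
      ≡⟨ cong (D *_) (trans (∑-+ (nbrs x) _ _) (cong (_+ ∑ (nbrs x) (λ y → hits j y F)) (∑-*ˡ (nbrs x) A _))) ⟩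
    D * (A * ∑ (nbrs x) (λ y → χ (y ∈? F)) + ∑ (nbrs x) (λ y → hits j y F))
      ≡⟨ *-distribˡ-+ D _ _ ⟩
    D * (A * ∑ (nbrs x) (λ y → χ (y ∈? F))) + D * ∑ (nbrs x) (λ y → hits j y F)
      ≤⟨ +-mono-≤ (*-mono-≤ (D≤d (side x)) (*-monoʳ-≤ A (∑-unique-∈ _≟_ (nbrs-! x) F))) (≤-reflexive (sym (∑-*ˡ (nbrs x) D _))) ⟩
    d (side x) * (A * length F) + ∑ (nbrs x) (λ y → D * hits j y F)
      ≤⟨ +-monoʳ-≤ _ (∑-bound (nbrs x) λ y i → ≤-trans (hits-bound j y F) (≤-reflexive (cong (λ s → j * length F * (μ ^ j * π j s)) (nbrs-side i)))) ⟩
    d (side x) * (A * length F) + length (nbrs x) * (j * length F * A)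
      ≤⟨ +-mono-≤ (≤-trans (≤-reflexive (sym (*-identityˡ _))) (*-monoˡ-≤ _ 1≤μ)) (*-monoˡ-≤ _ (deg-hi x)) ⟩
    μ * (d (side x) * (A * length F)) + μ * d (side x) * (j * length F * A)
      ≡⟨ lem μ (d (side x)) (μ ^ j) (π j (not (side x))) (length F) j ⟩
    suc j * length F * (μ ^ suc j * π (suc j) (side x))
      ∎
    where
    open ≤-Reasoning
    A = μ ^ j * π j (not (side x))
    step : ∀ y a → χ (meets? F (y ∷ a)) ≤ χ (y ∈? F) + χ (meets? F a)
    step y a = χ-≤ (meets? F (y ∷ a)) λ { (here i) → χ-cover (y ∈? F) (meets? F a) (inj₁ i)
                                         ; (there i) → χ-cover (y ∈? F) (meets? F a) (inj₂ i) }
    lem : ∀ u e b p f j → u * (e * ((b * p) * f)) + u * e * (j * f * (b * p)) ≡ suc j * f * ((u * b) * (e * p))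
    lem = solve-∀

  hits-fraction : ∀ j x F → D * hits j x F ≤ j * length F * (μ ^ (j + j) * length (legs j x))
  hits-fraction j x F = ≤-trans (hits-bound j x F) (*-monoʳ-≤ (j * length F)
    (≤-trans (*-monoʳ-≤ (μ ^ j) (legs-lo j x)) (≤-reflexive (trans (sym (*-assoc (μ ^ j) _ _)) (cong (_* _) (sym (^-distribˡ-+-* μ j j)))))))

  nonpaths : ℕ → V → ℕ
  nonpaths j x = ∑ (legs j x) (λ a → χ (¬? (unique? (x ∷ a))))

  -- Either the start recurs, which is a hit of the one-element list `x ∷ []` after the first step
  -- since there are no loops, or a vertex recurs in the rest. This gives j + j^2, padded to (j +
  -- 1)^2.
  nonpaths-bound : ∀ j x → D * nonpaths j x ≤ j * j * (μ ^ j * π j (side x))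
  nonpaths-bound zero    x = ≤-reflexive (*-zeroʳ D)
  nonpaths-bound (suc j) x = begin
    D * nonpaths (suc j) x
      ≡⟨ cong (D *_) (∑-legs-suc j x _) ⟩
    D * ∑ (nbrs x) (λ y → ∑ (legs j y) (λ a → χ (¬? (unique? (x ∷ y ∷ a)))))
      ≤⟨ *-monoʳ-≤ D (∑-mono (nbrs x) λ y i → ≤-trans (∑-mono (legs j y) λ a _ → step y i a) (≤-reflexive (∑-+ (legs j y) _ _))) ⟩
    D * ∑ (nbrs x) (λ y → hits j y (x ∷ []) + nonpaths j y)
      ≡⟨ sym (∑-*ˡ (nbrs x) D _) ⟩
    ∑ (nbrs x) (λ y → D * (hits j y (x ∷ []) + nonpaths j y))
      ≤⟨ ∑-bound (nbrs x) (λ y i → ≤-trans (≤-reflexive (*-distribˡ-+ D _ _))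
           (≤-trans (+-mono-≤ (hits-bound j y (x ∷ [])) (nonpaths-bound j y))
             (≤-reflexive (cong (λ s → j * 1 * (μ ^ j * π j s) + j * j * (μ ^ j * π j s)) (nbrs-side i))))) ⟩
    length (nbrs x) * (j * 1 * A + j * j * A)
      ≤⟨ *-mono-≤ (deg-hi x) (≤-trans (m≤m+n _ (suc j * A)) (≤-reflexive (lem₁ j A))) ⟩
    μ * d (side x) * (suc j * suc j * A)
      ≡⟨ lem₂ μ (d (side x)) (μ ^ j) (π j (not (side x))) (suc j * suc j) ⟩
    suc j * suc j * (μ ^ suc j * π (suc j) (side x))
      ∎
    where
    open ≤-Reasoning
    A = μ ^ j * π j (not (side x))
    lem₁ : ∀ j a → (j * 1 * a + j * j * a) + (1 + j) * a ≡ (1 + j) * (1 + j) * a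
    lem₁ = solve-∀
    lem₂ : ∀ u e b p c → u * e * (c * (b * p)) ≡ c * ((u * b) * (e * p))
    lem₂ = solve-∀
    step : ∀ y → y ∈ nbrs x → ∀ a →
      χ (¬? (unique? (x ∷ y ∷ a))) ≤ χ (meets? (x ∷ []) a) + χ (¬? (unique? (y ∷ a)))
    step y i a = χ-≤ (¬? (unique? (x ∷ y ∷ a))) λ ¬u → χ-cover (meets? (x ∷ []) a) (¬? (unique? (y ∷ a))) (split ¬u)
      where
      split : ¬ Unique (x ∷ y ∷ a) → Any (_∈ x ∷ []) a ⊎ ¬ Unique (y ∷ a)
      split ¬u with meets? (x ∷ []) a
      ... | yes m = inj₁ m
      ... | no ¬m = inj₂ λ u → ¬u (((λ { refl → nbrs-irrefl i }) ∷ All.map (λ ¬e e → ¬e (here (sym e))) (Allₚ.¬Any⇒All¬ a ¬m)) ∷ u)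

-- Links

module Links (Γ : BipartiteGraph) where
  open BipartiteGraph Γ
  open Walks Γ

  -- The end `y` is exempt, so that a blocking set may contain it; the start does not occur in the
  -- list of a path anyway.
  Avoids : V → List V → List V → Set
  Avoids y F a = All (λ z → z ≡ y ⊎ z ∉ F) a

  Connects : V → V → List V → List V → Set
  Connects x y F a = end x a ≡ y × Unique (x ∷ a) × Avoids y F a

  abstract
    connects? : ∀ x y F a → Dec (Connects x y F a)
    connects? x y F a = (end x a ≟ y) ×-dec unique? (x ∷ a) ×-dec all? (λ z → (z ≟ y) ⊎-dec ¬? (z ∈? F)) a

  Path : ℕ → V → V → List V → Set
  Path ℓ x y F = ∃ λ a → a ∈ legs ℓ x × Connects x y F a

  abstract
    path? : ∀ ℓ x y F → Dec (Any (Connects x y F) (legs ℓ x))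
    path? ℓ x y F = any? (connects? x y F) (legs ℓ x)

  vertices : List V
  vertices = verts true ++ verts false

  ∈-vertices : ∀ x → x ∈ vertices
  ∈-vertices x with side x | verts-∈ x
  ... | true  | i = ∈-++⁺ˡ i
  ... | false | i = ∈-++⁺ʳ (verts true) i

  -- Link t ℓ x y F: every set of t further vertices, together with F, is avoided
  -- internally by some path of length ℓ from x to y.
  Link : ℕ → ℕ → V → V → List V → Set
  Link zero    ℓ x y F = Any (Connects x y F) (legs ℓ x)
  Link (suc t) ℓ x y F = All (λ z → Link t ℓ x y (z ∷ F)) vertices

  abstract
    link? : ∀ t ℓ x y F → Dec (Link t ℓ x y F)
    link? zero    ℓ x y F = path? ℓ x y F
    link? (suc t) ℓ x y F = all? (λ z → link? t ℓ x y (z ∷ F)) vertices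

  Avoids-⊆ : ∀ {y F F′ a} → (∀ {z} → z ∈ F → z ∈ F′) → Avoids y F′ a → Avoids y F a
  Avoids-⊆ sub = All.map (Sum.map₂ (_∘ sub))

  Link-⊆ : ∀ t {ℓ x y F F′} → (∀ {z} → z ∈ F → z ∈ F′) → Link t ℓ x y F′ → Link t ℓ x y F
  Link-⊆ zero    sub = Any.map λ (e , u , a) → e , u , Avoids-⊆ sub a
  Link-⊆ (suc t) sub = All.map (Link-⊆ t λ { (here e) → here e ; (there i) → there (sub i) })

  Link-pred : ∀ t {ℓ x y F} → Link (suc t) ℓ x y F → Link t ℓ x y F
  Link-pred t {x = x} l = Link-⊆ t there (All.lookup l (∈-vertices x))

  Link-≤ : ∀ {t t′ ℓ x y F} → t′ ≤ t → Link t ℓ x y F → Link t′ ℓ x y F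
  Link-≤ {t} {t′} t′≤t = go (≤⇒≤′ t′≤t)
    where
    go : ∀ {t ℓ x y F} → t′ ≤′ t → Link t ℓ x y F → Link t′ ℓ x y F
    go (≤′-reflexive refl) l = l
    go (≤′-step h)         l = go h (Link-pred _ l)

  -- The elements of `F′` are fed to the quantifiers of `Link` one by one. In `go`, `G` holds those
  -- still to come and `H` those already blocked.
  Link-path : ∀ t {ℓ x y F} F′ → length F′ ≤ t → Link t ℓ x y F → Path ℓ x y F′
  Link-path t {ℓ} {x} {y} {F} F′ le l = go F′ {F} (λ {z} → inj₁) (Link-≤ le l)
    where
    go : ∀ G {H} → (∀ {z} → z ∈ F′ → z ∈ G ⊎ z ∈ H) → Link (length G) ℓ x y H → Path ℓ x y F′
    go []      cov l = let (a , i , e , u , av) = find l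
                       in a , i , e , u , Avoids-⊆ (λ j → Sum.[ (λ ()) , id ] (cov j)) av
    go (g ∷ G) cov l = go G cov′ (All.lookup l (∈-vertices g))
      where
      cov′ : ∀ {z} → z ∈ F′ → z ∈ G ⊎ z ∈ g ∷ _
      cov′ j with cov j
      ... | inj₁ (here e)  = inj₂ (here e)
      ... | inj₁ (there k) = inj₁ k
      ... | inj₂ k         = inj₂ (there k)

  -- The vertices that falsify the successive quantifiers make up the blocking list.
  ¬Link : ∀ t {ℓ x y F} → ¬ Link t ℓ x y F → ∃ λ F′ → length F′ ≡ t + length F × ¬ Path ℓ x y F′
  ¬Link zero    {F = F} ¬l = F , refl , λ (a , i , c) → ¬l (lose i c)
  ¬Link (suc t) {ℓ} {x} {y} {F} ¬l =
    let (z , _ , ¬lz) = find (Allₚ.¬All⇒Any¬ (λ z → link? t ℓ x y (z ∷ F)) vertices ¬l)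
        (F′ , len , ¬p) = ¬Link t ¬lz
    in F′ , trans len (+-suc t (length F)) , ¬p

  -- If there were fewer than t walks, their second vertices would block all of them.
  Link-count : ∀ t {ℓ x y} → 2 ≤ ℓ → Link t ℓ x y [] → t ≤ ∑ (legs ℓ x) (λ a → χ (end x a ≟ y))
  Link-count t {suc (suc ℓ)} {x} {y} (s≤s (s≤s _)) l with t ≤? ∑ (legs (suc (suc ℓ)) x) (λ a → χ (end x a ≟ y))
  ... | yes h = h
  ... | no ¬h = ⊥-elim (contra (Link-path t F len l))
    where
    good : List (List V)
    good = filter (λ a → end x a ≟ y) (legs (suc (suc ℓ)) x)
    heads : List (List V) → List V
    heads = concatMap (take 1)
    F : List V
    F = heads good
    length-heads : ∀ as → length (heads as) ≤ length as
    length-heads []             = z≤n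
    length-heads ([] ∷ as)      = m≤n⇒m≤1+n (length-heads as)
    length-heads ((z ∷ a) ∷ as) = s≤s (length-heads as)
    len : length F ≤ t
    len = ≤-trans (length-heads good) (≤-trans (≤-reflexive (length-filter-χ (λ a → end x a ≟ y) (legs (suc (suc ℓ)) x))) (<⇒≤ (≰⇒> ¬h)))
    heads-∈ : ∀ {z a} as → (z ∷ a) ∈ as → z ∈ heads as
    heads-∈ (_ ∷ as) (here refl) = here refl
    heads-∈ (b ∷ as) (there i)   = ∈-++⁺ʳ (take 1 b) (heads-∈ as i)
    contra : ¬ Path (suc (suc ℓ)) x y F
    contra ([] , i , _) with () ← proj₁ (∈-legs⁻ (suc (suc ℓ)) i)
    contra (_ ∷ [] , i , _) with () ← proj₁ (∈-legs⁻ (suc (suc ℓ)) i)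
    contra (z ∷ z′ ∷ b , i , e , _ ∷ (z∉ ∷ _) , inj₁ z≡y ∷ _) = All.lookup z∉ (end-∈ z z′ b) (trans z≡y (sym e))
    contra (z ∷ z′ ∷ b , i , e , u , inj₂ z∉F ∷ _) = z∉F (heads-∈ good (∈-filter⁺ (λ a → end x a ≟ y) i e))

-- Light paths

module _ {A : Set} where
  take-length-++ : ∀ (c b : List A) {i} → length c ≡ i → take i (c ++ b) ≡ c
  take-length-++ []      b refl = refl
  take-length-++ (x ∷ c) b refl = cong (x ∷_) (take-length-++ c b refl)

  drop-length-++ : ∀ (c b : List A) {i} → length c ≡ i → drop i (c ++ b) ≡ b
  drop-length-++ []      b refl = refl
  drop-length-++ (x ∷ c) b refl = drop-length-++ c b refl

  take-++-≤ : ∀ i (c b : List A) → i ≤ length c → take i (c ++ b) ≡ take i c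
  take-++-≤ zero    c       b _       = refl
  take-++-≤ (suc i) (x ∷ c) b (s≤s h) = cong (x ∷_) (take-++-≤ i c b h)

  take⊆ : ∀ j (a : List A) {z} → z ∈ take j a → z ∈ a
  take⊆ (suc j) (y ∷ a) (here r)  = here r
  take⊆ (suc j) (y ∷ a) (there q) = there (take⊆ j a q)

  Unique-++ˡ : ∀ (c : List A) {b} → Unique (c ++ b) → Unique c
  Unique-++ˡ []      u       = []
  Unique-++ˡ (x ∷ c) (h ∷ u) = Allₚ.++⁻ˡ c h ∷ Unique-++ˡ c u

  Unique-++ʳ : ∀ (c : List A) {b} → Unique (c ++ b) → Unique b
  Unique-++ʳ []      u       = u
  Unique-++ʳ (x ∷ c) (h ∷ u) = Unique-++ʳ c u

drop-length : {A : Set} (i : ℕ) (q : List A) {u : A} {b : List A} → drop i q ≡ u ∷ b → i + suc (length b) ≡ length q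
drop-length zero    q       refl = refl
drop-length (suc i) (x ∷ q) e    = cong suc (drop-length i q e)

-- The recursion mirrors the cutting of light paths: `Z * lightBound Z H ℓ + H` is
-- `threshold Z H (suc ℓ)`, the size of a blocking set, `suc ℓ` bounds the number of positions of
-- the cut, and the square counts the pairs of shorter light paths.
lightBound : ℕ → ℕ → ℕ → ℕ
lightBound Z H zero    = 1
lightBound Z H (suc ℓ) = (Z * lightBound Z H ℓ + H) * suc ℓ * (lightBound Z H ℓ * lightBound Z H ℓ)

-- That threshold (suc ℓ) is a large multiple of lightBound ℓ makes walks rare whose last but one
-- vertex lies in a blocking set of their ends.
threshold : ℕ → ℕ → ℕ → ℕ
threshold Z H zero    = H
threshold Z H (suc ℓ) = Z * lightBound Z H ℓ + H

1≤lightBound : ∀ Z H → 1 ≤ H → ∀ ℓ → 1 ≤ lightBound Z H ℓ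
1≤lightBound Z H 1≤H zero    = ≤-refl
1≤lightBound Z H 1≤H (suc ℓ) =
  *-mono-≤ (*-mono-≤ (≤-trans 1≤H (m≤n+m H (Z * lightBound Z H ℓ))) (s≤s (z≤n {ℓ}))) (*-mono-≤ (1≤lightBound Z H 1≤H ℓ) (1≤lightBound Z H 1≤H ℓ))

lightBound-suc : ∀ Z H → 1 ≤ H → ∀ ℓ → lightBound Z H ℓ ≤ lightBound Z H (suc ℓ)
lightBound-suc Z H 1≤H ℓ = ≤-trans (≤-reflexive (sym (*-identityˡ _)))
  (*-mono-≤ {1} (*-mono-≤ {1} (≤-trans 1≤H (m≤n+m H (Z * lightBound Z H ℓ))) (s≤s (z≤n {ℓ})))
    (≤-trans (≤-reflexive (sym (*-identityˡ _))) (*-monoˡ-≤ _ (1≤lightBound Z H 1≤H ℓ))))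

module Light (Γ : BipartiteGraph) (Z H : ℕ) (1≤H : 1 ≤ H) where
  open BipartiteGraph Γ
  open Walks Γ
  open Links Γ

  G h : ℕ → ℕ
  G = lightBound Z H
  h = threshold Z H

  -- Length 1 has to be excluded: an edge has no inner vertex that could be blocked, so it would
  -- always be a link and no path with an edge would be light.
  Linked : ℕ → V → V → Set
  Linked ℓ x y = 2 ≤ ℓ × Link (h ℓ) ℓ x y []

  abstract
    linked? : ∀ ℓ x y → Dec (Linked ℓ x y)
    linked? ℓ x y = (2 ≤? ℓ) ×-dec link? (h ℓ) ℓ x y []

  data Has (ℓ : ℕ) : List V → Set where
    here  : ∀ {x a} → ℓ ≤ length a → Linked ℓ x (end x (take ℓ a)) → Has ℓ (x ∷ a)
    there : ∀ {x a} → Has ℓ a → Has ℓ (x ∷ a)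

  abstract
    has? : ∀ ℓ q → Dec (Has ℓ q)
    has? ℓ []      = no λ ()
    has? ℓ (x ∷ a) with (ℓ ≤? length a) ×-dec linked? ℓ x (end x (take ℓ a)) | has? ℓ a
    ... | yes (p , l) | _     = yes (here p l)
    ... | no _        | yes i = yes (there i)
    ... | no ¬p       | no ¬i = no λ { (here p l) → ¬p (p , l) ; (there i) → ¬i i }

  Has-length : ∀ {ℓ q} → Has ℓ q → ℓ < length q
  Has-length (here p _) = s≤s p
  Has-length (there i)  = m≤n⇒m≤1+n (Has-length i)

  Has-++ˡ : ∀ {ℓ q} s → Has ℓ q → Has ℓ (q ++ s)
  Has-++ˡ {ℓ} s (here {x} {a} p l) =
    here (≤-trans p (≤-trans (m≤m+n _ _) (≤-reflexive (sym (length-++ a)))))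
         (subst (λ b → Linked ℓ x (end x b)) (sym (take-++-≤ ℓ a s p)) l)
  Has-++ˡ s (there i) = there (Has-++ˡ s i)

  Has-++ʳ : ∀ {ℓ q} s → Has ℓ q → Has ℓ (s ++ q)
  Has-++ʳ []      i = i
  Has-++ʳ (_ ∷ s) i = there (Has-++ʳ s i)

  Has-end : ∀ {ℓ} x a {b} → Has ℓ (end x a ∷ b) → Has ℓ (x ∷ a ++ b)
  Has-end x []      i = i
  Has-end x (y ∷ a) i = there (Has-end y a i)

  Unique-end : ∀ x a {b} → Unique (x ∷ a ++ b) → Unique (end x a ∷ b)
  Unique-end x []      u       = u
  Unique-end x (y ∷ a) (_ ∷ u) = Unique-end y a u

  Has-position : ∀ {ℓ} q → Has ℓ q → ∃ λ i → ∃ λ u → ∃ λ b →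
    drop i q ≡ u ∷ b × ℓ ≤ length b × Linked ℓ u (end u (take ℓ b))
  Has-position (x ∷ a) (here le lk) = 0 , x , a , refl , le , lk
  Has-position (x ∷ a) (there h)    = let (i , rest) = Has-position a h in suc i , rest

  Light : List V → Set
  Light q = Unique q × (∀ ℓ → ¬ Has ℓ q)

  abstract
    light? : ∀ q → Dec (Light q)
    light? q = unique? q ×-dec map′ (λ f ℓ i → f (Has-length i) i) (λ f {ℓ} _ → f ℓ)
                                    (allUpTo? (λ ℓ → ¬? (has? ℓ q)) (length q))

  Light-prefix : ∀ x a {b} → Light (x ∷ a ++ b) → Light (x ∷ a)
  Light-prefix x a {b} (u , n) = Unique-++ˡ (x ∷ a) u , λ ℓ i → n ℓ (Has-++ˡ b i)

  Light-suffix : ∀ x a {b} → Light (x ∷ a ++ b) → Light (end x a ∷ b)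
  Light-suffix x a (u , n) = Unique-end x a u , λ ℓ i → n ℓ (Has-end x a i)

  LightTo : V → V → List V → Set
  LightTo x y a = end x a ≡ y × Light (x ∷ a)

  abstract
    lightTo? : ∀ x y a → Dec (LightTo x y a)
    lightTo? x y a = (end x a ≟ y) ×-dec light? (x ∷ a)

  lights : ℕ → V → V → ℕ
  lights ℓ x y = ∑ (legs ℓ x) (λ a → χ (lightTo? x y a))

  splitAt∈ : ∀ {x z} a → z ∈ a → ∃ λ c → ∃ λ b → a ≡ c ++ b × end x c ≡ z × 1 ≤ length c
  splitAt∈ (z ∷ a) (here refl) = z ∷ [] , a , refl , refl , ≤-refl
  splitAt∈ (y ∷ a) (there i)   = let (c , b , e , f , l) = splitAt∈ {y} a i
                                 in y ∷ c , b , cong (y ∷_) e , f , m≤n⇒m≤1+n l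

  -- A light path between unlinked ends meets the blocking set in an inner vertex,
  -- which cuts it into two shorter light paths.
  lights-step : ∀ n → (∀ ℓ → ℓ ≤ n → ∀ x y → lights ℓ x y ≤ G n) → ∀ x y → lights (suc n) x y ≤ G (suc n)
  lights-step n ih x y = main n refl
    where
    -- Between linked ends a light path of this length would itself contain a link, namely its whole
    -- length; the count is 0.
    linked-case : Linked (suc n) x y → lights (suc n) x y ≤ G (suc n)
    linked-case lk = ≤-trans (≤-trans (∑-mono (legs (suc n) x) (λ a i → χ-≤ (lightTo? x y a) {0} (λ (e , u , nl) →
       ⊥-elim (nl (suc n) (here (≤-reflexive (sym (proj₁ (∈-legs⁻ (suc n) i))))
         (subst (Linked (suc n) x) (trans (sym e) (cong (end x) (sym (take-all (suc n) a (≤-reflexive (proj₁ (∈-legs⁻ (suc n) i))))))) lk))))))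
       (≤-reflexive (∑-0 (legs (suc n) x)))) z≤n
    module Cut (F : List V) (¬path : ¬ Path (suc n) x y F) where
      first second : V → ℕ → List V → ℕ
      first  z i a = χ (lightTo? x z (take (suc i) a))
      second z i a = χ (lightTo? z y (drop (suc i) a))
      blocked : ∀ a → a ∈ legs (suc n) x → LightTo x y a →
        1 ≤ ∑ F (λ z → ∑ (upTo n) (λ i → first z i a * second z i a))
      blocked a a∈ (e , u , nl) with any? (λ z → (z ∈? F) ×-dec ¬? (z ≟ y)) a
      ... | no ¬any = ⊥-elim (¬path (a , a∈ , e , u , All.map avoid (Allₚ.¬Any⇒All¬ a ¬any)))
        where
        avoid : ∀ {z} → ¬ (z ∈ F × ¬ z ≡ y) → z ≡ y ⊎ z ∉ F
        avoid {z} no′ with z ≟ y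
        ... | yes p = inj₁ p
        ... | no ¬p = inj₂ λ i → no′ (i , ¬p)
      ... | yes any with find any
      ... | z , z∈a , z∈F , z≢y with splitAt∈ {x} a z∈a
      ... | c@(c₀ ∷ c′) , b , refl , ec , _ =
        ≤-trans one (≤-trans (∑-∈ (λ i → first z i a * second z i a) (∈-upTo⁺ c<n)) (∑-∈ _ z∈F))
        where
        len : length c + length b ≡ suc n
        len = trans (sym (length-++ c)) (proj₁ (∈-legs⁻ (suc n) a∈))
        -- The blocked vertex differs from `y`, so the second part is nonempty and both parts have
        -- length at most `n`.
        nonempty : ∀ b → end x (c ++ b) ≡ y → 1 ≤ length b
        nonempty []      e = ⊥-elim (z≢y (trans (sym ec) (trans (sym (end-++ x c [])) e)))
        nonempty (_ ∷ _) _ = s≤s z≤n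
        1≤b : 1 ≤ length b
        1≤b = nonempty b e
        c<n : length c′ < n
        c<n = s≤s⁻¹ (≤-trans (≤-reflexive (+-comm 1 (length c))) (≤-trans (+-monoʳ-≤ (length c) 1≤b) (≤-reflexive len)))
        one : 1 ≤ first z (length c′) a * second z (length c′) a
        one = *-mono-≤
          (1≤χ (lightTo? x z (take (length c) a)) (subst (LightTo x z) (sym (take-length-++ c b refl)) (ec , Light-prefix x c (u , nl))))
          (1≤χ (lightTo? z y (drop (length c) a)) (subst (LightTo z y) (sym (drop-length-++ c b refl))
            (trans (cong (λ w → end w b) (sym ec)) (trans (sym (end-++ x c b)) e) ,
             subst (λ w → Light (w ∷ b)) ec (Light-suffix x c (u , nl)))))
      factor : ∀ z i → i < n → ∑ (legs (suc n) x) (λ a → first z i a * second z i a) ≤ G n * G n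
      factor z i i<n = begin
        ∑ (legs (suc n) x) (λ a → first z i a * second z i a)
          ≡⟨ cong (λ t → ∑ (legs t x) (λ a → first z i a * second z i a)) (sym (cong suc (m+[n∸m]≡n (<⇒≤ i<n)))) ⟩
        ∑ (legs (suc i + (n ∸ i)) x) (λ a → first z i a * second z i a)
          ≡⟨ ∑-legs-+ (suc i) (n ∸ i) x _ ⟩
        ∑ (legs (suc i) x) (λ c → ∑ (legs (n ∸ i) (end x c)) (λ b → first z i (c ++ b) * second z i (c ++ b)))
          ≤⟨ ∑-mono (legs (suc i) x) (λ c c∈ → inner c (proj₁ (∈-legs⁻ (suc i) c∈))) ⟩
        ∑ (legs (suc i) x) (λ c → χ (lightTo? x z c) * G n)
          ≡⟨ ∑-*ʳ (legs (suc i) x) (G n) _ ⟩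
        lights (suc i) x z * G n
          ≤⟨ *-monoˡ-≤ (G n) (ih (suc i) i<n x z) ⟩
        G n * G n ∎
        where
        open ≤-Reasoning
        inner : ∀ c → length c ≡ suc i →
          ∑ (legs (n ∸ i) (end x c)) (λ b → first z i (c ++ b) * second z i (c ++ b)) ≤ χ (lightTo? x z c) * G n
        inner c len = begin
          ∑ (legs (n ∸ i) (end x c)) (λ b → first z i (c ++ b) * second z i (c ++ b))
            ≡⟨ ∑-cong (legs (n ∸ i) (end x c)) (λ b _ → cong₂ (λ u v → χ (lightTo? x z u) * χ (lightTo? z y v)) (take-length-++ c b len) (drop-length-++ c b len)) ⟩
          ∑ (legs (n ∸ i) (end x c)) (λ b → χ (lightTo? x z c) * χ (lightTo? z y b))
            ≡⟨ ∑-*ˡ (legs (n ∸ i) (end x c)) (χ (lightTo? x z c)) _ ⟩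
          χ (lightTo? x z c) * ∑ (legs (n ∸ i) (end x c)) (λ b → χ (lightTo? z y b))
            ≤⟨ χ*-≤ (lightTo? x z c) (λ (e , l) → ≤-trans (≤-trans (≤-reflexive (cong (λ w → ∑ (legs (n ∸ i) w) (λ b → χ (lightTo? z y b))) e)) (ih (n ∸ i) (m∸n≤m n i) z y))
                 (≤-trans (≤-reflexive (sym (*-identityˡ (G n)))) (*-monoˡ-≤ (G n) (1≤χ (lightTo? x z c) (e , l))))) ⟩
          χ (lightTo? x z c) * G n ∎
    main : ∀ m → m ≡ n → lights (suc n) x y ≤ G (suc n)
    -- `Linked` leaves out length 1, so the single edge from `x` to `y` is counted directly.
    main zero refl = ≤-trans (≤-trans (≤-reflexive (∑-legs-suc 0 x _))
        (∑-mono (nbrs x) (λ z _ → ≤-trans (≤-reflexive (+-identityʳ _)) (χ-mono (lightTo? x y (z ∷ [])) (z ≟ y) proj₁))))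
      (≤-trans (∑-unique-≟ _≟_ (nbrs-! x) y) (1≤lightBound Z H 1≤H 1))
    main (suc m) refl with linked? (suc n) x y
    ... | yes lk = linked-case lk
    ... | no ¬lk with ¬Link (h (suc n)) (λ l → ¬lk (s≤s (s≤s z≤n) , l))
    ... | F , lenF , ¬path = begin
      lights (suc n) x y
        ≤⟨ ∑-mono (legs (suc n) x) (λ a a∈ → χ-≤ (lightTo? x y a) (C.blocked a a∈)) ⟩
      ∑ (legs (suc n) x) (λ a → ∑ F (λ z → ∑ (upTo n) (λ i → C.first z i a * C.second z i a)))
        ≡⟨ ∑-swap (legs (suc n) x) F _ ⟩
      ∑ F (λ z → ∑ (legs (suc n) x) (λ a → ∑ (upTo n) (λ i → C.first z i a * C.second z i a)))
        ≡⟨ ∑-cong F (λ z _ → ∑-swap (legs (suc n) x) (upTo n) _) ⟩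
      ∑ F (λ z → ∑ (upTo n) (λ i → ∑ (legs (suc n) x) (λ a → C.first z i a * C.second z i a)))
        ≤⟨ ∑-bound F (λ z _ → ∑-bound (upTo n) (λ i i∈ → C.factor z i (∈-upTo⁻ i∈))) ⟩
      length F * (length (upTo n) * (G n * G n))
        ≡⟨ cong₂ (λ u v → u * (v * (G n * G n))) (trans lenF (+-identityʳ _)) (length-upTo n) ⟩
      h (suc n) * (n * (G n * G n))
        ≤⟨ *-monoʳ-≤ (h (suc n)) (*-monoˡ-≤ (G n * G n) (n≤1+n n)) ⟩
      h (suc n) * (suc n * (G n * G n))
        ≡⟨ sym (*-assoc (h (suc n)) (suc n) _) ⟩
      G (suc n) ∎
      where
      open ≤-Reasoning
      module C = Cut F ¬path

  lights-bound : ∀ n ℓ → ℓ ≤ n → ∀ x y → lights ℓ x y ≤ G n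
  lights-bound zero .zero z≤n x y = ≤-trans (≤-reflexive (+-identityʳ _)) (χ≤1 (lightTo? x y []))
  lights-bound (suc n) ℓ ℓ≤ x y with ℓ ≤? n
  ... | yes ℓ≤n = ≤-trans (lights-bound n ℓ ℓ≤n x y) (lightBound-suc Z H 1≤H n)
  ... | no  ℓ≰n with ≤-antisym ℓ≤ (≰⇒> ℓ≰n)
  ... | refl = lights-step n (lights-bound n) x y

-- Stretching links by two

record Setting : Set₁ where
  field
    Γ : BipartiteGraph
  open BipartiteGraph Γ public
  field
    μ D H E : ℕ
    1≤μ    : 1 ≤ μ
    d      : Bool → ℕ
    deg-lo : ∀ x → d (side x) ≤ μ * length (nbrs x)
    deg-hi : ∀ x → length (nbrs x) ≤ μ * d (side x)
    D≤d    : ∀ s → D ≤ d s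
    1≤H    : 1 ≤ H
    E≤D    : E * (suc H * μ) ≤ D
  open Walks Γ public
  open Degrees Γ μ 1≤μ d deg-lo deg-hi D D≤d public
  open Links Γ public
  open Light Γ (E * H) H 1≤H public

  vertices-! : Unique vertices
  vertices-! = Uniqueₚ.++⁺ (verts-! true) (verts-! false)
    λ (i , j) → case (trans (sym (verts-side i)) (verts-side j)) of λ ()

  -- The shortest linked subpaths are clean.
  Clean : ℕ → V → List V → Set
  Clean ℓ x a = Unique (x ∷ a) × Linked ℓ x (end x a) × Light (x ∷ take (pred ℓ) a)

  abstract
    clean? : ∀ ℓ x a → Dec (Clean ℓ x a)
    clean? ℓ x a = unique? (x ∷ a) ×-dec linked? ℓ x (end x a) ×-dec light? (x ∷ take (pred ℓ) a)

  walkCount : ℕ → Bool → {R : V → List V → Set} → (∀ x a → Dec (R x a)) → ℕ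
  walkCount ℓ s R? = ∑ (verts s) (λ x → ∑ (legs ℓ x) (λ a → χ (R? x a)))

module Stretching (S : Setting) where
  open Setting S

  -- The threshold drops by two because the shorter path has to miss the two vertices that the
  -- detour appends to it: the last but one vertex `z` of the walk and its last vertex `y₀`.
  module Stretch (ℓ′ : ℕ) (1≤ℓ′ : 1 ≤ ℓ′) (s : Bool) (l t t′ : ℕ) (t′<t : t′ + 2 ≤ t) (t′≤H : t′ ≤ H) where

    private ℓ = suc ℓ′

    Bad : V → List V → Set
    Bad x a = Clean ℓ x a × Link t l x (end x a) [] × ¬ Link t′ (2 + l) x (end x a) []

    abstract
      bad? : ∀ x a → Dec (Bad x a)
      bad? x a = clean? ℓ x a ×-dec link? t l x (end x a) [] ×-dec ¬? (link? t′ (2 + l) x (end x a) [])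

    -- The empty list is a default for pairs that are linked in length `2 + l`; with it the bound on
    -- the length holds for all pairs.
    blocking : V → V → List V
    blocking x y with link? t′ (2 + l) x y []
    ... | yes _ = []
    ... | no ¬p = proj₁ (¬Link t′ ¬p)

    blocking-length : ∀ x y → length (blocking x y) ≤ t′
    blocking-length x y with link? t′ (2 + l) x y []
    ... | yes _ = z≤n
    ... | no ¬p = ≤-reflexive (trans (proj₁ (proj₂ (¬Link t′ ¬p))) (+-identityʳ t′))

    blocking-blocks : ∀ x y → ¬ Link t′ (2 + l) x y [] → ¬ Path (2 + l) x y (blocking x y)
    blocking-blocks x y ¬lk with link? t′ (2 + l) x y []
    ... | yes lk = ⊥-elim (¬lk lk)
    ... | no ¬p  = proj₂ (proj₂ (¬Link t′ ¬p))

    module At (x : V) (c : List V) (c∈ : c ∈ legs ℓ′ x) where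
      z : V
      z = end x c

      len-c : length c ≡ ℓ′
      len-c = proj₁ (∈-legs⁻ ℓ′ c∈)

      end-snoc : ∀ y → end x (c ++ y ∷ []) ≡ y
      end-snoc y = end-++ x c (y ∷ [])

      take-snoc : ∀ y → take ℓ′ (c ++ y ∷ []) ≡ c
      take-snoc y = take-length-++ c (y ∷ []) len-c

      -- Otherwise the detour x … y z y₀ would avoid the blocking set of y₀.
      clash : ∀ {y₀ y} → y₀ ∈ nbrs z → y ∈ nbrs z →
        Bad x (c ++ y₀ ∷ []) → z ∉ blocking x y₀ → Bad x (c ++ y ∷ []) → y ∈ y₀ ∷ blocking x y₀
      clash {y₀} {y} y₀∈ y∈ ((u₀ , _) , _ , ¬lk) z∉ ((u , _) , lk , _) with y ∈? (y₀ ∷ blocking x y₀)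
      ... | yes i = i
      ... | no ¬i = ⊥-elim (blocking-blocks x y₀ (subst (λ w → ¬ Link t′ (2 + l) x w []) (end-snoc y₀) ¬lk) detour)
        where
        B : List V
        B = blocking x y₀
        F : List V
        F = B ++ z ∷ y₀ ∷ []
        |F| : length F ≤ t
        |F| = ≤-trans (≤-reflexive (length-++ B)) (≤-trans (+-monoˡ-≤ 2 (blocking-length x y₀)) t′<t)
        path : Path l x y F
        path = Link-path t F |F| (subst (λ w → Link t l x w []) (end-snoc y) lk)
        -- Here `1 ≤ ℓ′` enters: `z` lies on `c`, hence differs from `x`, and the detour does not
        -- return to its start.
        z∈c : z ∈ c
        z∈c = last∈ c (≤-trans 1≤ℓ′ (≤-reflexive (sym len-c)))
          where
          last∈ : ∀ c → 1 ≤ length c → end x c ∈ c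
          last∈ (w ∷ c) _ = end-∈ x w c
        x≢ : ∀ {w} → w ∈ c ++ y₀ ∷ [] → w ≢ x
        x≢ i e = All.lookup (AllPairs.head u₀) i (sym e)
        detour : Path (2 + l) x y₀ B
        detour with path
        ... | q , q∈ , eq , uq , av =
          q ++ z ∷ y₀ ∷ [] ,
          ∈-legs⁺′ _ (trans (length-++ q) (trans (+-comm (length q) 2) (cong (2 +_) (proj₁ (∈-legs⁻ l q∈)))))
            (IsWalk-++ q (proj₂ (∈-legs⁻ l q∈)) (subst (λ w → z ∈ nbrs w) (sym eq) (nbrs-sym y∈) , y₀∈ , tt)) ,
          end-++ x q _ ,
          Uniqueₚ.++⁺ uq (((λ { refl → nbrs-irrefl y₀∈ }) ∷ []) ∷ [] ∷ []) disj ,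
          Allₚ.++⁺ (All.map (λ { (inj₁ refl) → inj₂ (¬i ∘ there) ; (inj₂ n) → inj₂ (n ∘ ∈-++⁺ˡ) }) av)
                   (inj₂ z∉ ∷ inj₁ refl ∷ [])
          where
          noz : z ∉ q
          noz i with All.lookup av i
          ... | inj₁ e = nbrs-irrefl (subst (_∈ nbrs z) (sym e) y∈)
          ... | inj₂ n = n (∈-++⁺ʳ B (here refl))
          noy : y₀ ∉ q
          noy i with All.lookup av i
          ... | inj₁ e = ¬i (here (sym e))
          ... | inj₂ n = n (∈-++⁺ʳ B (there (here refl)))
          disj : ∀ {w} → ¬ (w ∈ x ∷ q × w ∈ z ∷ y₀ ∷ [])
          disj (here refl , here e)          = x≢ (∈-++⁺ˡ z∈c) (sym e)
          disj (here refl , there (here e))  = x≢ (∈-++⁺ʳ c (here refl)) (sym e)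
          disj (there i , here refl)         = noz i
          disj (there i , there (here refl)) = noy i

    abstract
      -- Bad walks are split by whether the blocking set already contains the last but one vertex.
      -- If so, no detour can use that vertex, and only the size of the thresholds shows that such
      -- walks are rare; if not, `clash` applies.
      early? : ∀ x a → Dec (Bad x a × end x (take ℓ′ a) ∈ blocking x (end x a))
      early? x a = bad? x a ×-dec (end x (take ℓ′ a) ∈? blocking x (end x a))

    abstract
      late? : ∀ x a → Dec (Bad x a × end x (take ℓ′ a) ∉ blocking x (end x a))
      late? x a = bad? x a ×-dec ¬? (end x (take ℓ′ a) ∈? blocking x (end x a))

    total-snoc : total ℓ s ≡ ∑ (verts s) (λ x → ∑ (legs ℓ′ x) (λ c → length (nbrs (end x c))))
    total-snoc = ∑-cong (verts s) λ x _ → trans (sym (∑-1 (legs ℓ x)))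
      (trans (∑-legs-snoc ℓ′ x _) (∑-cong (legs ℓ′ x) λ c _ → ∑-1 (nbrs (end x c))))

    -- A single late continuation `y₀` confines all others to `y₀ ∷ blocking x y₀`, by `clash`.
    late-at : ∀ x c → c ∈ legs ℓ′ x → ∑ (nbrs (end x c)) (λ y → χ (late? x (c ++ y ∷ []))) ≤ suc H
    late-at x c c∈ with any? (λ y → late? x (c ++ y ∷ [])) (nbrs (end x c))
    ... | no ¬any = ≤-trans (≤-trans (∑-mono (nbrs (end x c)) (λ y i → χ-≤ (late? x (c ++ y ∷ [])) {0} (λ p → ⊥-elim (¬any (lose i p)))))
                      (≤-reflexive (∑-0 (nbrs (end x c))))) z≤n
    ... | yes any with find any
    ... | y₀ , y₀∈ , bad₀ , out₀ = begin
      ∑ (nbrs z) (λ y → χ (late? x (c ++ y ∷ [])))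
        ≤⟨ ∑-mono (nbrs z) (λ y y∈ → χ-mono (late? x (c ++ y ∷ [])) (y ∈? (y₀ ∷ blocking x y₀)) (λ (b , _) → clash y₀∈ y∈ bad₀ out b)) ⟩
      ∑ (nbrs z) (λ y → χ (y ∈? (y₀ ∷ blocking x y₀)))
        ≤⟨ ∑-unique-∈ _≟_ (nbrs-! z) (y₀ ∷ blocking x y₀) ⟩
      suc (length (blocking x y₀))
        ≤⟨ s≤s (≤-trans (blocking-length x y₀) t′≤H) ⟩
      suc H ∎
      where
      open At x c c∈
      open ≤-Reasoning
      out : z ∉ blocking x y₀
      out i = out₀ (subst₂ (λ u v → end x u ∈ blocking x v) (sym (take-snoc y₀)) (sym (end-snoc y₀)) i)

    -- Of the at least D/μ last steps at most `suc H` are late, and `E≤D` turns this into a share of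
    -- 1/E.
    late-bound : E * walkCount ℓ s late? ≤ total ℓ s
    late-bound = *-cancelˡ-≤ (suc H * μ) {{m*n≢0 (suc H) μ {{_}} {{>-nonZero 1≤μ}}}} (begin
      suc H * μ * (E * W)                                                  ≡⟨ lem (suc H) μ E W ⟩
      E * (suc H * μ) * W                                                  ≤⟨ *-monoˡ-≤ W E≤D ⟩
      D * W                                                                ≡⟨ cong (D *_) (∑-cong (verts s) λ x _ → ∑-legs-snoc ℓ′ x _) ⟩
      D * ∑ (verts s) (λ x → ∑ (legs ℓ′ x) (λ c → ∑ (nbrs (end x c)) (λ y → χ (late? x (c ++ y ∷ [])))))
        ≤⟨ *-monoʳ-≤ D (∑-mono (verts s) λ x _ → ∑-mono (legs ℓ′ x) λ c c∈ → late-at x c c∈) ⟩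
      D * ∑ (verts s) (λ x → ∑ (legs ℓ′ x) (λ c → suc H))
        ≡⟨ trans (sym (∑-*ˡ (verts s) D _)) (∑-cong (verts s) λ x _ → sym (∑-*ˡ (legs ℓ′ x) D _)) ⟩
      ∑ (verts s) (λ x → ∑ (legs ℓ′ x) (λ c → D * suc H))
        ≤⟨ ∑-mono (verts s) (λ x _ → ∑-mono (legs ℓ′ x) λ c _ → ≤-trans (*-monoˡ-≤ (suc H) (≤-trans (D≤d _) (deg-lo (end x c)))) (≤-reflexive (lem₂ μ _ (suc H)))) ⟩
      ∑ (verts s) (λ x → ∑ (legs ℓ′ x) (λ c → suc H * μ * length (nbrs (end x c))))
        ≡⟨ trans (∑-cong (verts s) λ x _ → ∑-*ˡ (legs ℓ′ x) (suc H * μ) _) (∑-*ˡ (verts s) (suc H * μ) _) ⟩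
      suc H * μ * ∑ (verts s) (λ x → ∑ (legs ℓ′ x) (λ c → length (nbrs (end x c))))
        ≡⟨ cong (suc H * μ *_) (sym total-snoc) ⟩
      suc H * μ * total ℓ s ∎)
      where
      open ≤-Reasoning
      W = walkCount ℓ s late?
      lem : ∀ a b e w → a * b * (e * w) ≡ e * (a * b) * w
      lem = solve-∀
      lem₂ : ∀ u n a → u * n * a ≡ a * u * n
      lem₂ = solve-∀

    linkedPair? : ∀ x y → Dec (Linked ℓ x y)
    linkedPair? = linked? ℓ

    -- Cleanness is used here: once the end `v` is fixed, the walk without its last vertex is a
    -- light path from `x` into `blocking x v`, which leaves at most `H * G ℓ′` possibilities.
    early-at : ∀ x → ∑ (legs ℓ x) (λ a → χ (early? x a)) ≤ ∑ vertices (λ y → χ (linkedPair? x y) * (H * G ℓ′))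
    early-at x = begin
      ∑ (legs ℓ x) (λ a → χ (early? x a))
        ≡⟨ ∑-legs-snoc ℓ′ x _ ⟩
      ∑ (legs ℓ′ x) (λ c → ∑ (nbrs (end x c)) (λ y → χ (early? x (c ++ y ∷ []))))
        ≤⟨ ∑-mono (legs ℓ′ x) (λ c c∈ → ∑-mono (nbrs (end x c)) λ y _ → χ-≤ (early? x (c ++ y ∷ [])) (spread c c∈ y)) ⟩
      ∑ (legs ℓ′ x) (λ c → ∑ (nbrs (end x c)) (λ y → ∑ vertices (λ v → χ (linkedPair? x v) * inner c v * χ (y ≟ v))))
        ≡⟨ ∑-cong (legs ℓ′ x) (λ c _ → ∑-swap (nbrs (end x c)) vertices _) ⟩
      ∑ (legs ℓ′ x) (λ c → ∑ vertices (λ v → ∑ (nbrs (end x c)) (λ y → χ (linkedPair? x v) * inner c v * χ (y ≟ v))))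
        ≤⟨ ∑-mono (legs ℓ′ x) (λ c _ → ∑-mono vertices λ v _ → ≤-trans (≤-reflexive (∑-*ˡ (nbrs (end x c)) (χ (linkedPair? x v) * inner c v) _))
             (≤-trans (*-monoʳ-≤ (χ (linkedPair? x v) * inner c v) (∑-unique-≟ _≟_ (nbrs-! (end x c)) v)) (≤-reflexive (*-identityʳ _)))) ⟩
      ∑ (legs ℓ′ x) (λ c → ∑ vertices (λ v → χ (linkedPair? x v) * inner c v))
        ≡⟨ ∑-swap (legs ℓ′ x) vertices _ ⟩
      ∑ vertices (λ v → ∑ (legs ℓ′ x) (λ c → χ (linkedPair? x v) * inner c v))
        ≡⟨ ∑-cong vertices (λ v _ → ∑-*ˡ (legs ℓ′ x) (χ (linkedPair? x v)) _) ⟩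
      ∑ vertices (λ v → χ (linkedPair? x v) * ∑ (legs ℓ′ x) (λ c → inner c v))
        ≤⟨ ∑-mono vertices (λ v _ → *-monoʳ-≤ (χ (linkedPair? x v)) (few v)) ⟩
      ∑ vertices (λ v → χ (linkedPair? x v) * (H * G ℓ′)) ∎
      where
      open ≤-Reasoning
      inner : List V → V → ℕ
      inner c v = ∑ (blocking x v) (λ w → χ (lightTo? x w c))
      spread : ∀ c → c ∈ legs ℓ′ x → ∀ y → Bad x (c ++ y ∷ []) × end x (take ℓ′ (c ++ y ∷ [])) ∈ blocking x (end x (c ++ y ∷ [])) →
        1 ≤ ∑ vertices (λ v → χ (linkedPair? x v) * inner c v * χ (y ≟ v))
      spread c c∈ y (((_ , lk , li) , _) , i) = ≤-trans
        (*-mono-≤ (*-mono-≤ (1≤χ (linkedPair? x y) (subst (Linked ℓ x) (end-snoc y) lk))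
          (≤-trans (1≤χ (lightTo? x z c) (refl , subst (λ b → Light (x ∷ b)) (take-snoc y) li))
                   (∑-∈ (λ w → χ (lightTo? x w c)) (subst₂ (λ u v → end x u ∈ blocking x v) (take-snoc y) (end-snoc y) i))))
          (1≤χ (y ≟ y) refl))
        (∑-∈ (λ v → χ (linkedPair? x v) * inner c v * χ (y ≟ v)) (∈-vertices y))
        where open At x c c∈
      few : ∀ v → ∑ (legs ℓ′ x) (λ c → inner c v) ≤ H * G ℓ′
      few v = begin
        ∑ (legs ℓ′ x) (λ c → inner c v)                             ≡⟨ ∑-swap (legs ℓ′ x) (blocking x v) _ ⟩
        ∑ (blocking x v) (λ w → lights ℓ′ x w)                      ≤⟨ ∑-bound (blocking x v) (λ w _ → lights-bound ℓ′ ℓ′ ≤-refl x w) ⟩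
        length (blocking x v) * G ℓ′                                ≤⟨ *-monoˡ-≤ (G ℓ′) (≤-trans (blocking-length x v) t′≤H) ⟩
        H * G ℓ′                                                    ∎

    -- Each linked end accounts for at least `h ℓ` walks, by `Link-count`, and walks with different
    -- ends are different.
    linked-pairs : ∀ x → ∑ vertices (λ y → h ℓ * χ (linkedPair? x y)) ≤ length (legs ℓ x)
    linked-pairs x = begin
      ∑ vertices (λ y → h ℓ * χ (linkedPair? x y))
        ≤⟨ ∑-mono vertices (λ y _ → ≤-trans (≤-reflexive (*-comm (h ℓ) _)) (χ*-≤ (linkedPair? x y) (λ (2≤ , lk) → Link-count (h ℓ) 2≤ lk))) ⟩
      ∑ vertices (λ y → ∑ (legs ℓ x) (λ a → χ (end x a ≟ y)))
        ≡⟨ ∑-swap vertices (legs ℓ x) _ ⟩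
      ∑ (legs ℓ x) (λ a → ∑ vertices (λ y → χ (end x a ≟ y)))
        ≤⟨ ∑-mono (legs ℓ x) (λ a _ → ≤-trans (∑-mono vertices λ y _ → χ-mono (end x a ≟ y) (y ≟ end x a) sym) (∑-unique-≟ _≟_ vertices-! (end x a))) ⟩
      ∑ (legs ℓ x) (λ _ → 1)
        ≡⟨ ∑-1 (legs ℓ x) ⟩
      length (legs ℓ x) ∎
      where open ≤-Reasoning

    -- A linked end receives at most `H * G ℓ′` early walks but at least `h ℓ` walks in all. The
    -- choice Z = E * H in `Setting` makes `h ℓ` at least E times the former number.
    early-bound : E * walkCount ℓ s early? ≤ total ℓ s
    early-bound = *-cancelˡ-≤ (H * G ℓ′) {{m*n≢0 H (G ℓ′) {{>-nonZero 1≤H}} {{>-nonZero (1≤lightBound (E * H) H 1≤H ℓ′)}}}} (begin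
      H * G ℓ′ * (E * walkCount ℓ s early?)
        ≡⟨ lem H (G ℓ′) E (walkCount ℓ s early?) ⟩
      E * H * G ℓ′ * walkCount ℓ s early?
        ≤⟨ *-mono-≤ (m≤m+n (E * H * G ℓ′) H) (∑-mono (verts s) λ x _ → early-at x) ⟩
      h ℓ * ∑ (verts s) (λ x → ∑ vertices (λ y → χ (linkedPair? x y) * (H * G ℓ′)))
        ≡⟨ trans (sym (∑-*ˡ (verts s) (h ℓ) _)) (∑-cong (verts s) λ x _ → trans (sym (∑-*ˡ vertices (h ℓ) _)) (trans (∑-cong vertices λ y _ → lem₂ (h ℓ) (χ (linkedPair? x y)) (H * G ℓ′)) (∑-*ˡ vertices (H * G ℓ′) _))) ⟩
      ∑ (verts s) (λ x → H * G ℓ′ * ∑ vertices (λ y → h ℓ * χ (linkedPair? x y)))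
        ≤⟨ ∑-mono (verts s) (λ x _ → *-monoʳ-≤ (H * G ℓ′) (linked-pairs x)) ⟩
      ∑ (verts s) (λ x → H * G ℓ′ * length (legs ℓ x))
        ≡⟨ ∑-*ˡ (verts s) (H * G ℓ′) _ ⟩
      H * G ℓ′ * total ℓ s ∎)
      where
      open ≤-Reasoning
      lem : ∀ a b e w → a * b * (e * w) ≡ e * a * b * w
      lem = solve-∀
      lem₂ : ∀ a b c → a * (b * c) ≡ c * (a * b)
      lem₂ = solve-∀

    bad-bound : E * walkCount ℓ s bad? ≤ 2 * total ℓ s
    bad-bound = begin
      E * walkCount ℓ s bad?
        ≤⟨ *-monoʳ-≤ E (∑-mono (verts s) λ x _ → ∑-mono (legs ℓ x) λ a _ → χ-cases (bad? x a) (end x (take ℓ′ a) ∈? blocking x (end x a)) (early? x a) (late? x a) _,_ _,_) ⟩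
      E * ∑ (verts s) (λ x → ∑ (legs ℓ x) (λ a → χ (early? x a) + χ (late? x a)))
        ≡⟨ cong (E *_) (trans (∑-cong (verts s) λ x _ → ∑-+ (legs ℓ x) _ _) (∑-+ (verts s) _ _)) ⟩
      E * (walkCount ℓ s early? + walkCount ℓ s late?)
        ≡⟨ *-distribˡ-+ E _ _ ⟩
      E * walkCount ℓ s early? + E * walkCount ℓ s late?
        ≤⟨ +-mono-≤ early-bound late-bound ⟩
      total ℓ s + total ℓ s
        ≡⟨ cong (total ℓ s +_) (sym (+-identityʳ _)) ⟩
      2 * total ℓ s ∎
      where
      open ≤-Reasoning

-- Common neighbours

module CommonNeighbours {A B : Set} (_≟_ : DecidableEquality A) {R : A → B → Set} (R? : ∀ x y → Dec (R x y))
  (xs : List A) (xs-! : Unique xs) (K p : ℕ) (1≤K : 1 ≤ K) (0<xs : 0 < length xs) (p≤xs : 4 * K * p ≤ length xs) where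

  open import Data.List.Membership.DecPropositional _≟_ using (_∈?_)

  private
    n = length xs

  deg : B → ℕ
  deg y = ∑ xs (λ x → χ (R? x y))

  popular? : ∀ y → Dec (n ≤ 2 * K * deg y)
  popular? y = n ≤? 2 * K * deg y

  -- The unpopular `y` have degree below n/(2K) and together account for at most half of the pairs;
  -- a popular one accounts for at most n.
  popular-many : ∀ ys → n * length ys ≤ K * ∑ xs (λ x → ∑ ys (λ y → χ (R? x y))) →
    length ys ≤ 2 * K * length (filter popular? ys)
  popular-many ys dense = *-cancelˡ-≤ n {{>-nonZero 0<xs}} (+-cancelʳ-≤ (n * length ys) _ _ (begin
    n * length ys + n * length ys
      ≤⟨ +-mono-≤ dense dense ⟩
    K * ∑ xs (λ x → ∑ ys (λ y → χ (R? x y))) + K * ∑ xs (λ x → ∑ ys (λ y → χ (R? x y)))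
      ≡⟨ lem₁ K _ ⟩
    2 * K * ∑ xs (λ x → ∑ ys (λ y → χ (R? x y)))
      ≡⟨ cong (2 * K *_) (∑-swap xs ys _) ⟩
    2 * K * ∑ ys deg
      ≡⟨ sym (∑-*ˡ ys (2 * K) deg) ⟩
    ∑ ys (λ y → 2 * K * deg y)
      ≤⟨ ∑-mono ys (λ y _ → pointwise y) ⟩
    ∑ ys (λ y → 2 * K * n * χ (popular? y) + n)
      ≡⟨ trans (∑-+ ys _ _) (cong₂ _+_ (∑-*ˡ ys (2 * K * n) _) (trans (∑-const ys n) (*-comm (length ys) n))) ⟩
    2 * K * n * ∑ ys (λ y → χ (popular? y)) + n * length ys
      ≡⟨ cong (_+ n * length ys) (trans (cong (2 * K * n *_) (sym (length-filter-χ popular? ys))) (lem₂ K n _)) ⟩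
    n * (2 * K * length (filter popular? ys)) + n * length ys ∎))
    where
    open ≤-Reasoning
    lem₁ : ∀ a b → a * b + a * b ≡ 2 * a * b
    lem₁ = solve-∀
    lem₂ : ∀ a b c → 2 * a * b * c ≡ b * (2 * a * c)
    lem₂ = solve-∀
    pointwise : ∀ y → 2 * K * deg y ≤ 2 * K * n * χ (popular? y) + n
    pointwise y with popular? y
    ... | yes _ = ≤-trans (*-monoʳ-≤ (2 * K) (∑-χ≤length xs (λ x → R? x y))) (≤-trans (≤-reflexive (sym (*-identityʳ _))) (m≤m+n _ n))
    ... | no ¬h = ≤-trans (<⇒≤ (≰⇒> ¬h)) (m≤n+m n _)

  record Chosen (ys : List B) (i : ℕ) : Set where
    field
      as       : List A
      ys′      : List B
      |as|     : length as ≡ i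
      as-!     : Unique as
      as⊆      : All (_∈ xs) as
      -- Being a sublist with multiplicities, expressed through sums: in this form counts over `ys`
      -- bound counts over `ys′`.
      ys′⊆     : ∀ f → ∑ ys′ f ≤ ∑ ys f
      ys′∈     : ∀ {y} → y ∈ ys′ → y ∈ ys
      adjacent : ∀ {a y} → a ∈ as → y ∈ ys′ → R a y
      0<ys′    : 0 < length ys′
      many     : length ys ≤ (4 * K) ^ i * length ys′

  -- By averaging, some new element is related to a share of at least 1/(4K) of `ys′`. Popularity
  -- alone would give 1/(2K); the at most p elements already chosen take off no more than half of
  -- this, since 4Kp ≤ n.
  choose : ∀ ys → 0 < length ys → (∀ {y} → y ∈ ys → n ≤ 2 * K * deg y) → ∀ i → i ≤ p → Chosen ys i
  choose ys 0<ys pop zero    _   = record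
    { as = [] ; ys′ = ys ; |as| = refl ; as-! = [] ; as⊆ = [] ; ys′⊆ = λ _ → ≤-refl ; ys′∈ = id
    ; adjacent = λ () ; 0<ys′ = 0<ys ; many = ≤-reflexive (sym (+-identityʳ _)) }
  choose ys 0<ys pop (suc i) i<p = record
    { as = a ∷ as ; ys′ = filter (R? a) ys′ ; |as| = cong suc |as|
    ; as-! = All.tabulate (λ j e → a∉ (subst (_∈ as) (sym e) j)) ∷ as-! ; as⊆ = a∈ ∷ as⊆
    ; ys′⊆ = λ f → ≤-trans (≤-trans (≤-reflexive (∑-filter (R? a) ys′ f)) (∑-mono ys′ (λ y _ → ≤-trans (*-monoˡ-≤ (f y) (χ≤1 (R? a y))) (≤-reflexive (*-identityˡ _))))) (ys′⊆ f)
    ; ys′∈ = λ j → ys′∈ (proj₁ (∈-filter⁻ (R? a) j))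
    ; adjacent = λ { (here refl) j → proj₂ (∈-filter⁻ (R? a) {xs = ys′} j) ; (there k) j → adjacent k (proj₁ (∈-filter⁻ (R? a) j)) }
    ; 0<ys′ = 0<new
    ; many = ≤-trans many (≤-trans (*-monoʳ-≤ ((4 * K) ^ i) shrink) (≤-reflexive (lem₃ ((4 * K) ^ i) (4 * K) _))) }
    where
    open Chosen (choose ys 0<ys pop i (<⇒≤ i<p))
    open ≤-Reasoning
    lem₃ : ∀ a b c → a * (b * c) ≡ b * a * c
    lem₃ = solve-∀
    fresh : A → ℕ
    fresh x = χ (¬? (x ∈? as))
    score : A → ℕ
    score x = fresh x * ∑ ys′ (λ y → χ (R? x y))
    deg-split : ∀ y → y ∈ ys → n ≤ 4 * K * ∑ xs (λ x → fresh x * χ (R? x y))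
    deg-split y y∈ = +-cancelʳ-≤ n _ _ (begin
      n + n
        ≤⟨ +-mono-≤ (pop y∈) (pop y∈) ⟩
      2 * K * deg y + 2 * K * deg y
        ≡⟨ lem₄ K (deg y) ⟩
      4 * K * deg y
        ≤⟨ *-monoʳ-≤ (4 * K) (≤-trans (∑-mono xs (λ x _ → cover x)) (≤-reflexive (∑-+ xs _ _))) ⟩
      4 * K * (∑ xs (λ x → fresh x * χ (R? x y)) + ∑ xs (λ x → χ (x ∈? as)))
        ≤⟨ *-monoʳ-≤ (4 * K) (+-monoʳ-≤ _ old) ⟩
      4 * K * (∑ xs (λ x → fresh x * χ (R? x y)) + p)
        ≡⟨ *-distribˡ-+ (4 * K) _ p ⟩
      4 * K * ∑ xs (λ x → fresh x * χ (R? x y)) + 4 * K * p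
        ≤⟨ +-monoʳ-≤ _ p≤xs ⟩
      4 * K * ∑ xs (λ x → fresh x * χ (R? x y)) + n ∎)
      where
      lem₄ : ∀ a b → 2 * a * b + 2 * a * b ≡ 4 * a * b
      lem₄ = solve-∀
      cover : ∀ x → χ (R? x y) ≤ fresh x * χ (R? x y) + χ (x ∈? as)
      cover x with x ∈? as
      ... | no _  = ≤-trans (≤-reflexive (sym (+-identityʳ _))) (m≤m+n _ _)
      ... | yes _ = χ≤1 (R? x y)
      old : ∑ xs (λ x → χ (x ∈? as)) ≤ p
      old = ≤-trans (∑-unique-∈ _≟_ xs-! as) (≤-trans (≤-reflexive |as|) (<⇒≤ i<p))
    best : ∃ λ x → x ∈ xs × length ys′ ≤ 4 * K * score x
    best = ∑-≤-∃ xs 0<xs (begin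
      ∑ xs (λ _ → length ys′)                                                    ≡⟨ ∑-const xs (length ys′) ⟩
      n * length ys′                                                             ≡⟨ *-comm n _ ⟩
      length ys′ * n                                                             ≡⟨ sym (∑-const ys′ n) ⟩
      ∑ ys′ (λ _ → n)                                                            ≤⟨ ∑-mono ys′ (λ y j → deg-split y (ys′∈ j)) ⟩
      ∑ ys′ (λ y → 4 * K * ∑ xs (λ x → fresh x * χ (R? x y)))                    ≡⟨ ∑-*ˡ ys′ (4 * K) _ ⟩
      4 * K * ∑ ys′ (λ y → ∑ xs (λ x → fresh x * χ (R? x y)))                    ≡⟨ cong (4 * K *_) (∑-swap ys′ xs _) ⟩
      4 * K * ∑ xs (λ x → ∑ ys′ (λ y → fresh x * χ (R? x y)))                    ≡⟨ cong (4 * K *_) (∑-cong xs (λ x _ → ∑-*ˡ ys′ (fresh x) _)) ⟩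
      4 * K * ∑ xs score                                                         ≡⟨ sym (∑-*ˡ xs (4 * K) score) ⟩
      ∑ xs (λ x → 4 * K * score x)                                               ∎)
    a : A
    a = proj₁ best
    a∈ : a ∈ xs
    a∈ = proj₁ (proj₂ best)
    -- An element chosen before scores 0, while the best score is positive because `ys′` is
    -- nonempty.
    a∉ : a ∉ as
    a∉ j = <⇒≱ 0<ys′ (≤-trans (proj₂ (proj₂ best)) (≤-reflexive (trans (cong (4 * K *_) (cong (_* ∑ ys′ (λ y → χ (R? a y))) (χ-false (¬? (a ∈? as)) (λ n → n j)))) (*-zeroʳ (4 * K)))))
      where
      χ-false : {P : Set} (d : Dec P) → ¬ P → χ d ≡ 0
      χ-false (yes p) ¬p = ⊥-elim (¬p p)
      χ-false (no _)  _  = refl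
    shrink : length ys′ ≤ 4 * K * length (filter (R? a) ys′)
    shrink = ≤-trans (proj₂ (proj₂ best)) (*-monoʳ-≤ (4 * K) (≤-trans (*-monoˡ-≤ _ (χ≤1 (¬? (a ∈? as))))
      (≤-reflexive (trans (*-identityˡ _) (sym (length-filter-χ (R? a) ys′))))))
    0<new : 0 < length (filter (R? a) ys′)
    0<new = n≢0⇒n>0 λ e → <⇒≱ 0<ys′ (≤-trans shrink (≤-reflexive (trans (cong (4 * K *_) e) (*-zeroʳ (4 * K)))))

-- Hubs from frequent short links

module Joins (Γ : BipartiteGraph) where
  open BipartiteGraph Γ
  open Walks Γ
  open Links Γ

  -- `Unique W` leaves out the start `x`. In the embedding `F` contains all branch vertices, and
  -- this keeps `x` off the interior of `W`.
  Join : ℕ → V → V → List V → Set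
  Join L x y F = ∃ λ W → length W ≡ L × IsWalk x W × end x W ≡ y × Unique W × Avoids y F W

  Joinable : ℕ → ℕ → V → V → Set
  Joinable L h x y = ∀ F → length F ≤ h → Join L x y F

  back-∈ : ∀ {z} x a acc → z ∈ back x a acc → z ∈ x ∷ a ⊎ z ∈ acc
  back-∈ x []      acc i = inj₂ i
  back-∈ x (y ∷ a) acc i with back-∈ y a (x ∷ acc) i
  ... | inj₁ j         = inj₁ (there j)
  ... | inj₂ (here e)  = inj₁ (here e)
  ... | inj₂ (there j) = inj₂ j

  back-unique : ∀ x a acc → Unique (x ∷ a) → Unique (x ∷ acc) → (∀ {z} → z ∈ a → z ∉ x ∷ acc) →
    Unique (end x a ∷ back x a acc)
  back-unique x []      acc u       v disj = v
  back-unique x (y ∷ a) acc (_ ∷ u) v disj = back-unique y a (x ∷ acc) u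
    (All.tabulate (λ j e → disj (here refl) (subst (_∈ x ∷ acc) (sym e) j)) ∷ v)
    λ { i (here e) → All.lookup (AllPairs.head u) i (sym e) ; i (there j) → disj (there i) j }

  -- The walk runs along `A` and then along `B` backwards; the common end is listed by `A` only, as
  -- `back` starts behind it.
  join : ∀ {x y F} A B → IsWalk x A → IsWalk y B → end x A ≡ end y B → Unique A → Unique (y ∷ B) →
    (∀ {z} → z ∈ A → z ∈ y ∷ B → z ≡ end y B) → Avoids y F A → Avoids y F B →
    Join (length A + length B) x y F
  join {x} {y} {F} A B wA wB e uA uB meet avA avB =
    A ++ R ,
    trans (length-++ A) (cong (length A +_) (trans (back-length y B []) (+-identityʳ _))) ,
    IsWalk-++ A wA (subst (λ v → IsWalk v R) (sym e) (back-walk y B [] wB tt)) ,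
    trans (end-++ x A R) (trans (cong (λ v → end v R) e) (back-end y B [])) ,
    Uniqueₚ.++⁺ uA (AllPairs.tail uR) disj ,
    Allₚ.++⁺ avA (All.tabulate avR)
    where
    R = back y B []
    uR : Unique (end y B ∷ R)
    uR = back-unique y B [] uB ([] ∷ []) λ { i (here refl) → All.lookup (AllPairs.head uB) i refl }
    R⊆ : ∀ {z} → z ∈ R → z ∈ y ∷ B
    R⊆ i with back-∈ y B [] i
    ... | inj₁ j = j
    disj : ∀ {z} → ¬ (z ∈ A × z ∈ R)
    disj (i , j) = All.lookup (AllPairs.head uR) j (sym (meet i (R⊆ j)))
    avR : ∀ {z} → z ∈ R → z ≡ y ⊎ z ∉ F
    avR i with R⊆ i
    ... | here e  = inj₁ e
    ... | there j = All.lookup avB j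

  record Hub (p L h : ℕ) : Set where
    field
      branch   : List V
      |branch| : length branch ≡ p
      branch-! : Unique branch
      joinable : AllPairs (Joinable L h) branch

module ShortLinks (S : Setting) where
  open Setting S

  module CaseA (k p K H₀ : ℕ) (1≤k : 1 ≤ k) (1≤K : 1 ≤ K)
    (E≡ : E ≡ 4 * (K * k)) (H≥ : H₀ + 4 * k + 4 ≤ H)
    (D-deg : μ * (4 * (2 * K) * suc p) ≤ D)
    (D-hits : k * H₀ * μ ^ (k + k) * (2 * (2 * K) * (4 * (2 * K)) ^ p) < D)
    (ℓ′ : ℕ) (1≤ℓ′ : 1 ≤ ℓ′) (ℓ≤k : suc ℓ′ ≤ k) (s : Bool) (0<verts : 0 < length (verts (not s)))
    (dense : total (suc ℓ′) s ≤ K * walkCount (suc ℓ′) s (clean? (suc ℓ′))) where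

    open Joins Γ

    private
      ℓ = suc ℓ′

    -- Defined by recursion so that `far (suc n)` computes to `2 + far n`, the length that one
    -- stretch produces.
    far : ℕ → ℕ
    far zero    = ℓ
    far (suc n) = 2 + far n

    far-≡ : ∀ n → far n ≡ ℓ + 2 * n
    far-≡ zero    = sym (+-identityʳ ℓ)
    far-≡ (suc n) = trans (cong (2 +_) (far-≡ n)) (lem ℓ n)
      where
      lem : ∀ a b → 2 + (a + 2 * b) ≡ a + 2 * (1 + b)
      lem = solve-∀

    Good : ℕ → V → List V → Set
    Good n x a = Clean ℓ x a × Link (H ∸ 2 * n) (far n) x (end x a) []

    abstract
      good? : ∀ n x a → Dec (Good n x a)
      good? n x a = clean? ℓ x a ×-dec link? (H ∸ 2 * n) (far n) x (end x a) []

    drop2 : ∀ n → n < k → H ∸ 2 * suc n + 2 ≤ H ∸ 2 * n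
    drop2 n n<k = ≤-reflexive (begin
      H ∸ 2 * suc n + 2        ≡⟨ cong (λ t → H ∸ t + 2) (lem n) ⟩
      H ∸ (2 * n + 2) + 2      ≡⟨ cong (_+ 2) (sym (∸-+-assoc H (2 * n) 2)) ⟩
      H ∸ 2 * n ∸ 2 + 2        ≡⟨ m∸n+n≡m (m+n≤o⇒m≤o∸n 2 (≤-trans (≤-reflexive (sym (trans (lem n) (+-comm (2 * n) 2)))) (≤-trans 2k≤ H≥))) ⟩
      H ∸ 2 * n                ∎)
      where
      open ≡-Reasoning
      lem : ∀ n → 2 * (1 + n) ≡ 2 * n + 2
      lem = solve-∀
      2k≤ : 2 * suc n ≤ H₀ + 4 * k + 4
      2k≤ = ≤-trans (*-mono-≤ {2} {4} (s≤s (s≤s z≤n)) n<k) (≤-trans (m≤n+m (4 * k) H₀) (m≤m+n _ 4))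

    chain : ∀ n → n ≤ k → E * walkCount ℓ s (clean? ℓ) ≤ E * walkCount ℓ s (good? n) + n * (2 * total ℓ s)
    chain zero    _   = ≤-trans (*-monoʳ-≤ E (∑-mono (verts s) λ x _ → ∑-mono (legs ℓ x) λ a _ →
        χ-mono (clean? ℓ x a) (good? 0 x a) λ { c@(_ , (_ , lk) , _) → c , Link-≤ (m≤n+m H _) lk }))
      (≤-reflexive (sym (+-identityʳ _)))
    chain (suc n) n<k = begin
      E * walkCount ℓ s (clean? ℓ)
        ≤⟨ chain n (<⇒≤ n<k) ⟩
      E * walkCount ℓ s (good? n) + n * (2 * total ℓ s)
        ≤⟨ +-monoˡ-≤ _ (*-monoʳ-≤ E (∑-mono (verts s) λ x _ → ∑-mono (legs ℓ x) λ a _ →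
             χ-cases (good? n x a) (link? (H ∸ 2 * suc n) (far (suc n)) x (end x a) []) (good? (suc n) x a) (T.bad? x a)
               (λ (c , _) q → c , q) (λ (c , l) q → c , l , q))) ⟩
      E * ∑ (verts s) (λ x → ∑ (legs ℓ x) (λ a → χ (good? (suc n) x a) + χ (T.bad? x a))) + n * (2 * total ℓ s)
        ≡⟨ cong (λ t → E * t + n * (2 * total ℓ s)) (trans (∑-cong (verts s) λ x _ → ∑-+ (legs ℓ x) _ _) (∑-+ (verts s) _ _)) ⟩
      E * (walkCount ℓ s (good? (suc n)) + walkCount ℓ s T.bad?) + n * (2 * total ℓ s)
        ≡⟨ trans (cong (_+ n * (2 * total ℓ s)) (*-distribˡ-+ E _ _)) (+-assoc (E * walkCount ℓ s (good? (suc n))) _ _) ⟩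
      E * walkCount ℓ s (good? (suc n)) + (E * walkCount ℓ s T.bad? + n * (2 * total ℓ s))
        ≤⟨ +-monoʳ-≤ (E * walkCount ℓ s (good? (suc n))) (+-monoˡ-≤ _ T.bad-bound) ⟩
      E * walkCount ℓ s (good? (suc n)) + suc n * (2 * total ℓ s) ∎
      where
      open ≤-Reasoning
      module T = Stretching.Stretch S ℓ′ 1≤ℓ′ s (far n) (H ∸ 2 * n) (H ∸ 2 * suc n) (drop2 n n<k) (m∸n≤m H (2 * suc n))

    N : ℕ
    N = k ∸ ℓ

    -- Each of at most k stretches loses a share of 2/E of all walks. With E = 4Kk the total loss is
    -- at most 1/(2K), half of the share 1/K of clean walks.
    good-many : total ℓ s ≤ 2 * K * walkCount ℓ s (good? N)
    good-many = *-cancelˡ-≤ (2 * k) {{m*n≢0 2 k {{_}} {{>-nonZero 1≤k}}}} (+-cancelʳ-≤ (2 * k * T) _ _ (begin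
      2 * k * T + 2 * k * T                ≡⟨ lem₁ k T ⟩
      4 * k * T                            ≤⟨ *-monoʳ-≤ (4 * k) dense ⟩
      4 * k * (K * X)                      ≡⟨ lem₂ k K X ⟩
      4 * (K * k) * X                      ≡⟨ cong (_* X) (sym E≡) ⟩
      E * X                                ≤⟨ chain N (m∸n≤m k ℓ) ⟩
      E * Y + N * (2 * T)                  ≤⟨ +-mono-≤ (≤-reflexive (cong (_* Y) E≡)) (*-monoˡ-≤ (2 * T) (m∸n≤m k ℓ)) ⟩
      4 * (K * k) * Y + k * (2 * T)        ≡⟨ lem₃ k K Y T ⟩
      2 * k * (2 * K * Y) + 2 * k * T      ∎))
      where
      open ≤-Reasoning
      T = total ℓ s
      X = walkCount ℓ s (clean? ℓ)
      Y = walkCount ℓ s (good? N)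
      lem₁ : ∀ k t → 2 * k * t + 2 * k * t ≡ 4 * k * t
      lem₁ = solve-∀
      lem₂ : ∀ k c x → 4 * k * (c * x) ≡ 4 * (c * k) * x
      lem₂ = solve-∀
      lem₃ : ∀ k c y t → 4 * (c * k) * y + k * (2 * t) ≡ 2 * k * (2 * c * y) + 2 * k * t
      lem₃ = solve-∀

    Rel : V → V → List V → Set
    Rel w x b = Good N x (w ∷ b)

    rel? : ∀ w x b → Dec (Rel w x b)
    rel? w x b = good? N x (w ∷ b)

    -- Cutting each walk at its second vertex `w` makes the start `x` and the rest `b` range
    -- independently, so that `rel?` is a dense relation between neighbours of `w` and legs from
    -- `w`.
    centre : ∃ λ w → w ∈ verts (not s) ×
      length (nbrs w) * length (legs ℓ′ w) ≤ 2 * K * ∑ (nbrs w) (λ x → ∑ (legs ℓ′ w) (λ b → χ (rel? w x b)))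
    centre = ∑-≤-∃ (verts (not s)) 0<verts (begin
      ∑ (verts (not s)) (λ w → length (nbrs w) * length (legs ℓ′ w))
        ≡⟨ ∑-cong (verts (not s)) (λ w _ → sym (∑-const (nbrs w) _)) ⟩
      ∑ (verts (not s)) (λ w → ∑ (nbrs w) (λ x → length (legs ℓ′ w)))
        ≡⟨ sym (nbrs-swap s _) ⟩
      ∑ (verts s) (λ x → ∑ (nbrs x) (λ w → length (legs ℓ′ w)))
        ≡⟨ ∑-cong (verts s) (λ x _ → sym (length-legs-suc ℓ′ x)) ⟩
      total ℓ s
        ≤⟨ good-many ⟩
      2 * K * walkCount ℓ s (good? N)
        ≡⟨ cong (2 * K *_) (trans (∑-cong (verts s) λ x _ → ∑-legs-suc ℓ′ x _) (nbrs-swap s _)) ⟩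
      2 * K * ∑ (verts (not s)) (λ w → ∑ (nbrs w) (λ x → ∑ (legs ℓ′ w) (λ b → χ (rel? w x b))))
        ≡⟨ sym (∑-*ˡ (verts (not s)) (2 * K) _) ⟩
      ∑ (verts (not s)) (λ w → 2 * K * ∑ (nbrs w) (λ x → ∑ (legs ℓ′ w) (λ b → χ (rel? w x b)))) ∎)
      where open ≤-Reasoning

    1≤D : 1 ≤ D
    1≤D = ≤-trans (s≤s z≤n) D-hits

    module AtCentre (w : V) (dense-w : length (nbrs w) * length (legs ℓ′ w) ≤ 2 * K * ∑ (nbrs w) (λ x → ∑ (legs ℓ′ w) (λ b → χ (rel? w x b)))) where

      many-nbrs : 4 * (2 * K) * suc p ≤ length (nbrs w)
      many-nbrs = *-cancelˡ-≤ μ {{>-nonZero 1≤μ}} (≤-trans D-deg (≤-trans (D≤d (side w)) (deg-lo w)))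

      module CN = CommonNeighbours _≟_ (rel? w) (nbrs w) (nbrs-! w) (2 * K) p (*-mono-≤ {1} {2} (s≤s z≤n) 1≤K)
        (≤-trans (*-mono-≤ {1} (*-mono-≤ {1} {4} (s≤s z≤n) (*-mono-≤ {1} {2} (s≤s z≤n) 1≤K)) (s≤s z≤n)) many-nbrs)
        (≤-trans (*-monoʳ-≤ (4 * (2 * K)) (n≤1+n p)) many-nbrs)

      Y₀ : List (List V)
      Y₀ = filter CN.popular? (legs ℓ′ w)

      Y₀-many : length (legs ℓ′ w) ≤ 2 * (2 * K) * length Y₀
      Y₀-many = CN.popular-many (legs ℓ′ w) dense-w

      0<Y₀ : 0 < length Y₀
      0<Y₀ = n≢0⇒n>0 λ e → <⇒≱ (legs-nonempty 1≤D ℓ′ w) (≤-trans Y₀-many (≤-reflexive (trans (cong (2 * (2 * K) *_) e) (*-zeroʳ (2 * (2 * K))))))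

      choice : CN.Chosen Y₀ p
      choice = CN.choose Y₀ 0<Y₀ (λ i → proj₂ (∈-filter⁻ CN.popular? {xs = legs ℓ′ w} i)) p ≤-refl

      module AtChoice (C : CN.Chosen Y₀ p) where
        open CN.Chosen C

        -- By `D-hits` fewer than `length ys′` legs meet `F`. The leg matters through its end: as
        -- the target of both links the end is exempt from `Avoids` and must be kept off `F` by the
        -- choice of the leg.
        fresh-leg : ∀ F → length F ≤ H₀ → ∃ λ b → b ∈ ys′ × ¬ Any (_∈ F) b
        fresh-leg F |F| with any? (λ b → ¬? (meets? F b)) ys′
        ... | yes any = find any
        ... | no ¬any = ⊥-elim (<⇒≱ D-hits (*-cancelʳ-≤ D _ (length ys′) {{>-nonZero 0<ys′}} (begin
          D * length ys′
            ≡⟨ cong (D *_) (sym (∑-1 ys′)) ⟩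
          D * ∑ ys′ (λ _ → 1)
            ≤⟨ *-monoʳ-≤ D (∑-mono ys′ λ b i → 1≤χ (meets? F b) (decidable-stable (meets? F b) λ n → ¬any (lose i n))) ⟩
          D * ∑ ys′ (λ b → χ (meets? F b))
            ≤⟨ *-monoʳ-≤ D (≤-trans (ys′⊆ _) (≤-trans (≤-reflexive (∑-filter CN.popular? (legs ℓ′ w) _))
                 (∑-mono (legs ℓ′ w) λ b _ → ≤-trans (*-monoˡ-≤ _ (χ≤1 (CN.popular? b))) (≤-reflexive (*-identityˡ _))))) ⟩
          D * hits ℓ′ w F
            ≤⟨ hits-fraction ℓ′ w F ⟩
          ℓ′ * length F * (μ ^ (ℓ′ + ℓ′) * length (legs ℓ′ w))
            ≤⟨ *-mono-≤ (*-mono-≤ ℓ′≤k |F|) (*-mono-≤ (^-monoʳ-≤ μ {{>-nonZero 1≤μ}} (+-mono-≤ ℓ′≤k ℓ′≤k)) (≤-trans Y₀-many (*-monoʳ-≤ (2 * (2 * K)) many))) ⟩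
          k * H₀ * (μ ^ (k + k) * (2 * (2 * K) * ((4 * (2 * K)) ^ p * length ys′)))
            ≡⟨ lem (k * H₀) (μ ^ (k + k)) (2 * (2 * K)) ((4 * (2 * K)) ^ p) (length ys′) ⟩
          k * H₀ * μ ^ (k + k) * (2 * (2 * K) * (4 * (2 * K)) ^ p) * length ys′ ∎)))
          where
          open ≤-Reasoning
          ℓ′≤k : ℓ′ ≤ k
          ℓ′≤k = ≤-trans (n≤1+n ℓ′) ℓ≤k
          lem : ∀ a b c e f → a * (b * (c * (e * f))) ≡ a * b * (c * e) * f
          lem = solve-∀

        joinable-all : ∀ {x y} → x ∈ as → y ∈ as → Joinable (2 * k) H₀ x y
        joinable-all {x} {y} x∈ y∈ F |F| with fresh-leg F |F|
        ... | b , b∈ , ¬meets with adjacent x∈ b∈ | adjacent y∈ b∈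
        ... | (_ , (_ , lkx) , _) , _ | (uy , _) , lky
          -- The first path, of length ℓ from `x`, avoids `y` and `F`; the second, of length 2k - ℓ
          -- from `y`, avoids the first path and `F`. They meet only in `v`.
          with Link-path (h ℓ) (y ∷ F) |yF| lkx
          where
          |yF| : suc (length F) ≤ h ℓ
          |yF| = ≤-trans (s≤s |F|) (≤-trans (≤-trans (≤-trans (≤-reflexive (+-comm 1 H₀)) (+-mono-≤ (m≤m+n H₀ (4 * k)) (s≤s {n = 3} z≤n))) H≥) (m≤n+m H _))
        ... | A , A∈ , eA , uA , avA
          with Link-path (H ∸ 2 * N) (A ++ F) |AF| lky
          where
          |AF| : length (A ++ F) ≤ H ∸ 2 * N
          |AF| = m+n≤o⇒m≤o∸n (length (A ++ F)) (begin
            length (A ++ F) + 2 * N        ≡⟨ cong (_+ 2 * N) (trans (length-++ A) (cong (_+ length F) (proj₁ (∈-legs⁻ ℓ A∈)))) ⟩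
            ℓ + length F + 2 * N           ≤⟨ +-mono-≤ (+-mono-≤ ℓ≤k |F|) (*-monoʳ-≤ 2 (m∸n≤m k ℓ)) ⟩
            k + H₀ + 2 * k                 ≤⟨ m≤m+n _ (k + 4) ⟩
            k + H₀ + 2 * k + (k + 4)       ≡⟨ lem k H₀ ⟩
            H₀ + 4 * k + 4                 ≤⟨ H≥ ⟩
            H                              ∎)
            where
            open ≤-Reasoning
            lem : ∀ k a → k + a + 2 * k + (k + 4) ≡ a + 4 * k + 4
            lem = solve-∀
        ... | B , B∈ , eB , uB , avB =
          subst (λ L → Join L x y F) lenAB
            (join A B (proj₂ (∈-legs⁻ ℓ A∈)) (proj₂ (∈-legs⁻ (far N) B∈)) (trans eA (sym eB)) (AllPairs.tail uA) uB meet
              (All.map (λ { (inj₁ refl) → inj₂ v∉F ; (inj₂ n) → inj₂ (n ∘ there) }) avA)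
              (All.map (λ { (inj₁ refl) → inj₂ v∉F ; (inj₂ n) → inj₂ (n ∘ ∈-++⁺ʳ A) }) avB))
          where
          v = end w b
          b≢[] : 1 ≤ length b
          b≢[] = ≤-trans 1≤ℓ′ (≤-reflexive (sym (proj₁ (∈-legs⁻ ℓ′ (proj₁ (∈-filter⁻ CN.popular? {xs = legs ℓ′ w} (ys′∈ b∈)))))))
          v∈b : ∀ b → 1 ≤ length b → end w b ∈ b
          v∈b (z ∷ b) _ = end-∈ w z b
          v∉F : v ∉ F
          v∉F i = ¬meets (lose (v∈b b b≢[]) i)
          v≢y : v ≢ y
          v≢y e = All.lookup (AllPairs.head uy) (there (v∈b b b≢[])) (sym e)
          meet : ∀ {z} → z ∈ A → z ∈ y ∷ B → z ≡ end y B
          meet i (here refl) with All.lookup avA i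
          ... | inj₁ e = ⊥-elim (v≢y (sym e))
          ... | inj₂ n = ⊥-elim (n (here refl))
          meet i (there j) with All.lookup avB j
          ... | inj₁ e = trans e (sym eB)
          ... | inj₂ n = ⊥-elim (n (∈-++⁺ˡ i))
          lenAB : length A + length B ≡ 2 * k
          lenAB = trans (cong₂ _+_ (proj₁ (∈-legs⁻ ℓ A∈)) (trans (proj₁ (∈-legs⁻ (far N) B∈)) (far-≡ N)))
            (trans (lem ℓ N) (cong (2 *_) (m+[n∸m]≡n ℓ≤k)))
            where
            lem : ∀ a b → a + (a + 2 * b) ≡ 2 * (a + b)
            lem = solve-∀

        hub : Hub p (2 * k) H₀
        hub = record { branch = as ; |branch| = |as| ; branch-! = as-! ; joinable = allPairs as (λ i → i) }
          where
          allPairs : ∀ xs → (∀ {x} → x ∈ xs → x ∈ as) → AllPairs (Joinable (2 * k) H₀) xs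
          allPairs []       _   = []
          allPairs (x ∷ xs) sub = All.tabulate (λ j → joinable-all (sub (here refl)) (sub (there j))) ∷ allPairs xs (sub ∘ there)

    hub : Hub p (2 * k) H₀
    hub = AtCentre.AtChoice.hub (proj₁ centre) (proj₂ (proj₂ centre)) (AtCentre.choice (proj₁ centre) (proj₂ (proj₂ centre)))

-- Walks without long links

least : {P : ℕ → Set} → (∀ n → Dec (P n)) → ∀ n → P n → ∃ λ m → P m × (∀ j → j < m → ¬ P j)
least {P} P? = <-rec (λ n → P n → ∃ λ m → P m × (∀ j → j < m → ¬ P j)) step
  where
  step : ∀ n → (∀ {j} → j < n → P j → ∃ λ m → P m × (∀ j → j < m → ¬ P j)) → P n → ∃ λ m → P m × (∀ j → j < m → ¬ P j)
  step n rec Pn with anyUpTo? P? n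
  ... | yes (j , j<n , Pj) = rec j<n Pj
  ... | no ¬any            = n , Pn , λ j j<n Pj → ¬any (j , j<n , Pj)

drop-ʳ++ : {A : Set} (a c : List A) {i : ℕ} → length a ≡ i → drop i (a ʳ++ c) ≡ c
drop-ʳ++ []      c refl = refl
drop-ʳ++ (x ∷ a) c refl = drop-suc (length a) (a ʳ++ (x ∷ c)) (drop-ʳ++ a (x ∷ c) refl)
  where
  drop-suc : ∀ {A : Set} n (xs : List A) {y ys} → drop n xs ≡ y ∷ ys → drop (suc n) xs ≡ ys
  drop-suc zero    (x ∷ xs) refl = refl
  drop-suc (suc n) (x ∷ xs) e    = drop-suc n xs e

Unique-ʳ++ : {A : Set} (a {c} : List A) → Unique (a ʳ++ c) → Unique a × Unique c × (∀ {z} → z ∈ a → z ∉ c)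
Unique-ʳ++ []      u = [] , u , λ ()
Unique-ʳ++ (x ∷ a) u with Unique-ʳ++ a u
... | ua , h ∷ uc , disj =
  All.tabulate (λ j e → disj j (here (sym e))) ∷ ua , uc ,
  λ { (here refl) j → All.lookup h j refl ; (there i) j → disj i (there j) }

flips-even : ∀ k s → flips (k + k) s ≡ s
flips-even zero    s = refl
flips-even (suc k) s = trans (cong (λ t → flips t (not s)) (+-suc k k)) (trans (flips-even k (not (not s))) (not-involutive s))

module LongWalks (S : Setting) where
  open Setting S

  -- A walk of length 2k fails by repeating a vertex, by being light, or by having a shortest link
  -- of length at most k. `D≥`, `C≥` and `K≥` make each kind at most a share of 1/(4 K₂).
  module BadWalks (k K₂ K C : ℕ) (1≤k : 1 ≤ k)
    (K≥ : 4 * K₂ * ((k + k) * k * (μ ^ (k + k) * μ ^ (k + k))) ≤ K)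
    (D≥ : 4 * K₂ * ((k + k) * (k + k) * (μ ^ (k + k) * μ ^ (k + k))) ≤ D)
    (C≥ : 4 * K₂ * (G (k + k) * μ ^ (k + k)) ≤ C)
    (C-π : C * length (verts true) ≤ π (k + k) true)
    (sparse : ∀ ℓ′ s → 1 ≤ ℓ′ → suc ℓ′ ≤ k → K * walkCount (suc ℓ′) s (clean? (suc ℓ′)) ≤ total (suc ℓ′) s) where

    L M : ℕ
    L = k + k
    M = μ ^ L * μ ^ L

    GoodWalk : List V → Set
    GoodWalk q = Unique q × ∃ λ g′ → g′ < k × Has (k + suc g′) q

    abstract
      goodWalk? : ∀ q → Dec (GoodWalk q)
      goodWalk? q = unique? q ×-dec anyUpTo? (λ g′ → has? (k + suc g′) q) k

    ShortAt : ℕ → ℕ → List V → Set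
    ShortAt i ℓ q = ∃ λ u → ∃ λ b → drop i q ≡ u ∷ b × ℓ ≤ length b × Clean ℓ u (take ℓ b)

    abstract
      shortAt? : ∀ i ℓ q → Dec (ShortAt i ℓ q)
      shortAt? i ℓ q with drop i q
      ... | []    = no λ { (_ , _ , () , _) }
      ... | u ∷ b with (ℓ ≤? length b) ×-dec clean? ℓ u (take ℓ b)
      ...   | yes (le , c) = yes (u , b , refl , le , c)
      ...   | no ¬c        = no λ { (_ , _ , refl , le , c) → ¬c (le , c) }

    -- The shortest link of the path is taken. By minimality its subwalk is clean, and if it were
    -- longer than k the walk would be good.
    classify : ∀ q → length q ≡ suc L → ¬ GoodWalk q →
      ¬ Unique q ⊎ Light q ⊎ ∃ λ i → ∃ λ ℓ′ → i < L × ℓ′ < k × ShortAt i (suc ℓ′) q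
    classify q |q| ¬good with unique? q
    ... | no ¬u = inj₁ ¬u
    ... | yes u with anyUpTo? (λ ℓ → has? ℓ q) (length q)
    ... | no ¬has = inj₂ (inj₁ (u , λ ℓ h → ¬has (ℓ , Has-length h , h)))
    ... | yes (ℓ₀ , _ , has₀) with least (λ ℓ → has? ℓ q) ℓ₀ has₀
    ... | zero , has , _ = ⊥-elim (n≮0 (proj₁ (proj₂ (proj₂ (proj₂ (proj₂ (proj₂ (Has-position q has))))))))
    ... | suc ℓ′ , has , minimal with Has-position q has
    ... | i , v , b , eq , le , lk = inj₂ (inj₂ (i , ℓ′ , i<L , ℓ′<k , v , b , eq , le , unique-vc , lk , light))
      where
      c = take (suc ℓ′) b
      unique-vb : Unique (v ∷ b)
      unique-vb = subst Unique eq (Uniqueₚ.drop⁺ i u)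
      unique-vc : Unique (v ∷ c)
      unique-vc = Uniqueₚ.take⁺ (suc (suc ℓ′)) unique-vb
      i+ : i + suc (length b) ≡ suc L
      i+ = trans (drop-length i q eq) |q|
      i<L : i < L
      i<L = s≤s⁻¹ (≤-trans (≤-trans (≤-reflexive (+-comm 2 i)) (+-monoʳ-≤ i (s≤s (≤-trans (s≤s z≤n) le)))) (≤-reflexive i+))
      ℓ≤L : suc ℓ′ ≤ L
      ℓ≤L = s≤s⁻¹ (≤-trans (s≤s le) (≤-trans (m≤n+m _ i) (≤-reflexive i+)))
      ℓ′<k : ℓ′ < k
      ℓ′<k with ℓ′ <? k
      ... | yes p = p
      ... | no ¬p = ⊥-elim (¬good (u , ℓ′ ∸ k , m<n+o⇒m∸n<o ℓ′ k {{>-nonZero 1≤k}} ℓ≤L ,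
          subst (λ t → Has t q) (sym (trans (+-suc k (ℓ′ ∸ k)) (cong suc (m+[n∸m]≡n (≮⇒≥ ¬p))))) has))
      light : Light (v ∷ take ℓ′ c)
      light = Uniqueₚ.take⁺ (suc ℓ′) unique-vc , λ j hj → minimal j (short hj) (subst (Has j) (take++drop≡id i q)
          (Has-++ʳ (take i q) (subst (Has j) (sym eq) (subst (Has j) (take++drop≡id (suc (suc ℓ′)) (v ∷ b)) (Has-++ˡ _
            (subst (Has j) (take++drop≡id (suc ℓ′) (v ∷ c)) (Has-++ˡ _ hj)))))))
        where
        short : ∀ {j} → Has j (v ∷ take ℓ′ c) → j < suc ℓ′
        short hj = ≤-trans (Has-length hj) (s≤s (≤-trans (≤-reflexive (length-take ℓ′ c)) (m⊓n≤m ℓ′ _)))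

    T : ℕ
    T = total L true

    T-centred : ∀ i j → i + j ≡ L → T ≡ ∑ (verts (flips i true)) (λ u → length (legs i u) * length (legs j u))
    T-centred i j e = sym (begin
      ∑ (verts (flips i true)) (λ u → length (legs i u) * length (legs j u))
        ≡⟨ ∑-cong (verts (flips i true)) (λ u _ → trans (sym (∑-const (legs i u) _)) (∑-cong (legs i u) λ a _ → sym (∑-1 (legs j u)))) ⟩
      centred i j (flips i true) (λ _ → 1)
        ≡⟨ trans (centred-0 i j true (λ _ → 1)) (cong (λ t → centred 0 t true (λ _ → 1)) e) ⟩
      centred 0 L true (λ _ → 1)
        ≡⟨ centred-0-1 L true (λ _ → 1) ⟩
      ∑ (verts true) (λ x → ∑ (legs L x) (λ a → 1))
        ≡⟨ ∑-cong (verts true) (λ x _ → ∑-1 (legs L x)) ⟩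
      T ∎)
      where open ≡-Reasoning

    -- The total number of walks bounded below from the vertex at step i. The loss μ^L is the same
    -- for all i, so counts localised at any step become shares of `T`.
    π-T : ∀ i j → i + j ≡ L → length (verts (flips i true)) * (π i (flips i true) * π j (flips i true)) ≤ μ ^ L * T
    π-T i j e = begin
      length (verts t) * (π i t * π j t)
        ≡⟨ sym (∑-const (verts t) _) ⟩
      ∑ (verts t) (λ u → π i t * π j t)
        ≤⟨ ∑-mono (verts t) (λ u u∈ → ≤-trans (≤-reflexive (cong (λ r → π i r * π j r) (sym (verts-side u∈)))) (*-mono-≤ (legs-lo i u) (legs-lo j u))) ⟩
      ∑ (verts t) (λ u → μ ^ i * length (legs i u) * (μ ^ j * length (legs j u)))
        ≡⟨ ∑-cong (verts t) (λ u _ → trans (lem (μ ^ i) _ (μ ^ j) _) (cong (_* (length (legs i u) * length (legs j u))) (trans (sym (^-distribˡ-+-* μ i j)) (cong (μ ^_) e)))) ⟩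
      ∑ (verts t) (λ u → μ ^ L * (length (legs i u) * length (legs j u)))
        ≡⟨ ∑-*ˡ (verts t) (μ ^ L) _ ⟩
      μ ^ L * ∑ (verts t) (λ u → length (legs i u) * length (legs j u))
        ≡⟨ cong (μ ^ L *_) (sym (T-centred i j e)) ⟩
      μ ^ L * T ∎
      where
      open ≤-Reasoning
      t = flips i true
      lem : ∀ a b c e → a * b * (c * e) ≡ a * c * (b * e)
      lem = solve-∀

    tally : {R : List V → Set} → (∀ q → Dec (R q)) → ℕ
    tally R? = ∑ (verts true) (λ x → ∑ (legs L x) (λ a → χ (R? (x ∷ a))))

    1≤M : 1 ≤ M
    1≤M = *-mono-≤ {1} (≤-trans (≤-reflexive (sym (^-zeroˡ L))) (^-monoˡ-≤ L 1≤μ)) (≤-trans (≤-reflexive (sym (^-zeroˡ L))) (^-monoˡ-≤ L 1≤μ))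

    1≤L : 1 ≤ L
    1≤L = ≤-trans 1≤k (m≤m+n k k)

    nonpath-bound : 4 * K₂ * tally (λ q → ¬? (unique? q)) ≤ T
    nonpath-bound = *-cancelˡ-≤ (L * L * M) {{>-nonZero (*-mono-≤ (*-mono-≤ 1≤L 1≤L) 1≤M)}} (begin
      L * L * M * (4 * K₂ * Q)              ≡⟨ lem₁ (L * L * M) (4 * K₂) Q ⟩
      4 * K₂ * (L * L * M) * Q              ≤⟨ *-monoˡ-≤ Q D≥ ⟩
      D * Q                                 ≡⟨ sym (∑-*ˡ (verts true) D _) ⟩
      ∑ (verts true) (λ x → D * nonpaths L x)
        ≤⟨ ∑-bound (verts true) (λ x x∈ → ≤-trans (nonpaths-bound L x) (≤-reflexive (cong (λ s → L * L * (μ ^ L * π L s)) (verts-side x∈)))) ⟩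
      length (verts true) * (L * L * (μ ^ L * π L true))
        ≡⟨ lem₂ (length (verts true)) (L * L) (μ ^ L) (π L true) ⟩
      L * L * (μ ^ L * (length (verts true) * (1 * π L true)))
        ≤⟨ *-monoʳ-≤ (L * L) (*-monoʳ-≤ (μ ^ L) (π-T 0 L refl)) ⟩
      L * L * (μ ^ L * (μ ^ L * T))
        ≡⟨ lem₃ (L * L) (μ ^ L) T ⟩
      L * L * M * T ∎)
      where
      open ≤-Reasoning
      Q = tally (λ q → ¬? (unique? q))
      lem₁ : ∀ a b c → a * (b * c) ≡ b * a * c
      lem₁ = solve-∀
      lem₂ : ∀ m a b c → m * (a * (b * c)) ≡ a * (b * (m * (1 * c)))
      lem₂ = solve-∀
      lem₃ : ∀ a b t → a * (b * (b * t)) ≡ a * (b * b) * t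
      lem₃ = solve-∀

    -- Here |M| enters. Since 2k is even, both ends lie in `verts true`, and there are at most m^2
    -- times `G L` light walks, whereas `C-π` forces the number of all walks to be at least C m^2 up
    -- to a power of μ.
    light-bound : 4 * K₂ * tally light? ≤ T
    light-bound = *-cancelˡ-≤ (G L * μ ^ L) {{>-nonZero (*-mono-≤ (1≤lightBound (E * H) H 1≤H L) 1≤μL)}} (begin
      G L * μ ^ L * (4 * K₂ * Q)              ≡⟨ lem₁ (G L * μ ^ L) (4 * K₂) Q ⟩
      4 * K₂ * (G L * μ ^ L) * Q              ≤⟨ *-mono-≤ C≥ Q≤ ⟩
      C * (m * (m * G L))                     ≡⟨ lem₂ C m (G L) ⟩
      G L * (m * (1 * (C * m)))               ≤⟨ *-monoʳ-≤ (G L) (*-monoʳ-≤ m (*-monoʳ-≤ 1 C-π)) ⟩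
      G L * (m * (1 * π L true))              ≤⟨ *-monoʳ-≤ (G L) (π-T 0 L refl) ⟩
      G L * (μ ^ L * T)                       ≡⟨ sym (*-assoc (G L) _ _) ⟩
      G L * μ ^ L * T                         ∎)
      where
      open ≤-Reasoning
      Q = tally light?
      m = length (verts true)
      1≤μL : 1 ≤ μ ^ L
      1≤μL = ≤-trans (≤-reflexive (sym (^-zeroˡ L))) (^-monoˡ-≤ L 1≤μ)
      lem₁ : ∀ a b c → a * (b * c) ≡ b * a * c
      lem₁ = solve-∀
      lem₂ : ∀ c m g → c * (m * (m * g)) ≡ g * (m * (1 * (c * m)))
      lem₂ = solve-∀
      Q≤ : Q ≤ m * (m * G L)
      Q≤ = ∑-bound (verts true) λ x x∈ → begin
        ∑ (legs L x) (λ a → χ (light? (x ∷ a)))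
          ≤⟨ ∑-mono (legs L x) (λ a a∈ → χ-≤ (light? (x ∷ a)) λ li → ≤-trans (1≤χ (lightTo? x (end x a) a) (refl , li))
               (∑-∈ (λ y → χ (lightTo? x y a)) (end∈ x x∈ a a∈))) ⟩
        ∑ (legs L x) (λ a → ∑ (verts true) (λ y → χ (lightTo? x y a)))
          ≡⟨ ∑-swap (legs L x) (verts true) _ ⟩
        ∑ (verts true) (λ y → lights L x y)
          ≤⟨ ∑-bound (verts true) (λ y _ → lights-bound L L ≤-refl x y) ⟩
        m * G L ∎
        where
        end∈ : ∀ x → x ∈ verts true → ∀ a → a ∈ legs L x → end x a ∈ verts true
        end∈ x x∈ a a∈ = subst (λ s → end x a ∈ verts s) side≡ (verts-∈ (end x a))
          where
          side≡ : side (end x a) ≡ true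
          side≡ = let (len , w) = ∈-legs⁻ L a∈ in
            trans (end-side a w) (trans (cong₂ flips len (verts-side x∈)) (flips-even k true))

    -- A walk with a clean piece at step i is a clean walk with free continuations on both sides.
    -- The numbers of continuations agree up to powers of μ, so the rarity of clean walks passes to
    -- the long walks at the cost of the factor `M`.
    short-bound : ∀ i ℓ′ → ℓ′ < k → K * tally (shortAt? i (suc ℓ′)) ≤ M * T
    -- Links have length at least 2, so nothing is counted at length 1.
    short-bound i zero ℓ′<k = ≤-trans (≤-reflexive (trans (cong (K *_) (trans (∑-cong (verts true) λ x _ → trans (∑-cong (legs L x) λ a _ → zero′ (x ∷ a)) (∑-0 (legs L x))) (∑-0 (verts true)))) (*-zeroʳ K))) z≤n
      where
      zero′ : ∀ q → χ (shortAt? i 1 q) ≡ 0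
      zero′ q = n≤0⇒n≡0 (χ-≤ (shortAt? i 1 q) λ { (_ , _ , _ , _ , _ , (s≤s () , _) , _) })
    short-bound i ℓ′@(suc _) ℓ′<k with i + suc ℓ′ ≤? L
    ... | no ¬le = ≤-trans (≤-reflexive (trans (cong (K *_) (trans (∑-cong (verts true) λ x _ → trans (∑-cong (legs L x) λ a a∈ → zero′ x a (proj₁ (∈-legs⁻ L a∈))) (∑-0 (legs L x))) (∑-0 (verts true)))) (*-zeroʳ K))) z≤n
      where
      zero′ : ∀ x a → length a ≡ L → χ (shortAt? i (suc ℓ′) (x ∷ a)) ≡ 0
      zero′ x a len = n≤0⇒n≡0 (χ-≤ (shortAt? i (suc ℓ′) (x ∷ a)) λ { (_ , b , eq , le , _) → ⊥-elim (¬le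
        (s≤s⁻¹ (≤-trans (≤-reflexive (sym (+-suc i (suc ℓ′)))) (≤-trans (+-monoʳ-≤ i (s≤s le)) (≤-reflexive (trans (drop-length i (x ∷ a) eq) (cong suc len))))))) })
    ... | yes le = begin
      K * tally (shortAt? i ℓ)
        ≡⟨ cong (K *_) (trans (sym (centred-0-1 L true f)) (trans (cong (λ t → centred 0 t true f) (sym e)) (sym (centred-0 i (ℓ + j) true f)))) ⟩
      K * centred i (ℓ + j) s f
        ≤⟨ *-monoʳ-≤ K (∑-mono (verts s) λ u u∈ → at u u∈) ⟩
      K * ∑ (verts s) (λ u → R * ∑ (legs ℓ u) (λ c → χ (clean? ℓ u c)))
        ≡⟨ trans (cong (K *_) (∑-*ˡ (verts s) R _)) (lem₁ K R _) ⟩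
      R * (K * walkCount ℓ s (clean? ℓ))
        ≤⟨ *-monoʳ-≤ R (≤-trans (sparse ℓ′ s (s≤s z≤n) ℓ′<k) (∑-bound (verts s) λ u u∈ → ≤-trans (legs-hi ℓ u) (≤-reflexive (cong (λ t → μ ^ ℓ * π ℓ t) (verts-side u∈))))) ⟩
      R * (length (verts s) * (μ ^ ℓ * π ℓ s))
        ≡⟨ lem₂ (μ ^ i) (π i s) (μ ^ j) (π j (flips ℓ s)) (length (verts s)) (μ ^ ℓ) (π ℓ s) ⟩
      μ ^ i * (μ ^ ℓ * μ ^ j) * (length (verts s) * (π i s * (π ℓ s * π j (flips ℓ s))))
        ≡⟨ cong₂ (λ p q → p * (length (verts s) * (π i s * q))) (trans (cong (μ ^ i *_) (sym (^-distribˡ-+-* μ ℓ j))) (trans (sym (^-distribˡ-+-* μ i (ℓ + j))) (cong (μ ^_) e))) (sym (π-+ ℓ j s)) ⟩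
      μ ^ L * (length (verts s) * (π i s * π (ℓ + j) s))
        ≤⟨ *-monoʳ-≤ (μ ^ L) (π-T i (ℓ + j) e) ⟩
      μ ^ L * (μ ^ L * T)
        ≡⟨ sym (*-assoc (μ ^ L) _ _) ⟩
      M * T ∎
      where
      open ≤-Reasoning
      ℓ = suc ℓ′
      j = L ∸ (i + ℓ)
      e : i + (ℓ + j) ≡ L
      e = trans (sym (+-assoc i ℓ j)) (m+[n∸m]≡n le)
      s = flips i true
      f : List V → ℕ
      f q = χ (shortAt? i ℓ q)
      R = μ ^ i * π i s * (μ ^ j * π j (flips ℓ s))
      lem₁ : ∀ a b c → a * (b * c) ≡ b * (a * c)
      lem₁ = solve-∀
      lem₂ : ∀ a p b q n c r → a * p * (b * q) * (n * (c * r)) ≡ a * (c * b) * (n * (p * (r * q)))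
      lem₂ = solve-∀
      pick : ∀ u a c b → length a ≡ i → length c ≡ ℓ → ShortAt i ℓ (a ʳ++ (u ∷ c ++ b)) → Clean ℓ u c
      pick u a c b la lc (u′ , b′ , eq , _ , cl) with trans (sym (drop-ʳ++ a (u ∷ c ++ b) la)) eq
      ... | refl = subst (Clean ℓ u) (take-length-++ c b lc) cl
      at : ∀ u → u ∈ verts s → ∑ (legs i u) (λ a → ∑ (legs (ℓ + j) u) (λ b → f (a ʳ++ (u ∷ b)))) ≤ R * ∑ (legs ℓ u) (λ c → χ (clean? ℓ u c))
      at u u∈ = begin
        ∑ (legs i u) (λ a → ∑ (legs (ℓ + j) u) (λ b → f (a ʳ++ (u ∷ b))))
          ≤⟨ ∑-bound (legs i u) inner ⟩
        length (legs i u) * (∑ (legs ℓ u) (λ c → χ (clean? ℓ u c)) * (μ ^ j * π j (flips ℓ s)))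
          ≤⟨ *-monoˡ-≤ _ (≤-trans (legs-hi i u) (≤-reflexive (cong (λ t → μ ^ i * π i t) (verts-side u∈)))) ⟩
        μ ^ i * π i s * (∑ (legs ℓ u) (λ c → χ (clean? ℓ u c)) * (μ ^ j * π j (flips ℓ s)))
          ≡⟨ lem₃ (μ ^ i * π i s) (∑ (legs ℓ u) (λ c → χ (clean? ℓ u c))) _ ⟩
        R * ∑ (legs ℓ u) (λ c → χ (clean? ℓ u c)) ∎
        where
        lem₃ : ∀ a b c → a * (b * c) ≡ a * c * b
        lem₃ = solve-∀
        inner : ∀ a → a ∈ legs i u → ∑ (legs (ℓ + j) u) (λ b → f (a ʳ++ (u ∷ b))) ≤ ∑ (legs ℓ u) (λ c → χ (clean? ℓ u c)) * (μ ^ j * π j (flips ℓ s))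
        inner a a∈ = begin
          ∑ (legs (ℓ + j) u) (λ b → f (a ʳ++ (u ∷ b)))
            ≡⟨ ∑-legs-+ ℓ j u _ ⟩
          ∑ (legs ℓ u) (λ c → ∑ (legs j (end u c)) (λ b → f (a ʳ++ (u ∷ c ++ b))))
            ≤⟨ ∑-mono (legs ℓ u) (λ c c∈ → ∑-bound (legs j (end u c)) λ b _ → χ-mono (shortAt? i ℓ (a ʳ++ (u ∷ c ++ b))) (clean? ℓ u c) (pick u a c b (proj₁ (∈-legs⁻ i a∈)) (proj₁ (∈-legs⁻ ℓ c∈)))) ⟩
          ∑ (legs ℓ u) (λ c → length (legs j (end u c)) * χ (clean? ℓ u c))
            ≤⟨ ∑-mono (legs ℓ u) (λ c c∈ → ≤-trans (≤-reflexive (*-comm _ (χ (clean? ℓ u c)))) (*-monoʳ-≤ (χ (clean? ℓ u c)) (≤-trans (legs-hi j (end u c)) (≤-reflexive (cong (λ t → μ ^ j * π j t) (side≡ c c∈)))))) ⟩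
          ∑ (legs ℓ u) (λ c → χ (clean? ℓ u c) * (μ ^ j * π j (flips ℓ s)))
            ≡⟨ ∑-*ʳ (legs ℓ u) _ _ ⟩
          ∑ (legs ℓ u) (λ c → χ (clean? ℓ u c)) * (μ ^ j * π j (flips ℓ s)) ∎
          where
          side≡ : ∀ c → c ∈ legs ℓ u → side (end u c) ≡ flips ℓ s
          side≡ c c∈ = let (len , w) = ∈-legs⁻ ℓ c∈ in trans (end-side c w) (cong₂ flips len (verts-side u∈))

    shorts : List V → ℕ
    shorts q = ∑ (upTo L) (λ i → ∑ (upTo k) (λ ℓ′ → χ (shortAt? i (suc ℓ′) q)))

    shorts-bound : 4 * K₂ * ∑ (verts true) (λ x → ∑ (legs L x) (λ a → shorts (x ∷ a))) ≤ T
    shorts-bound = *-cancelˡ-≤ (L * k * M) {{>-nonZero (*-mono-≤ (*-mono-≤ 1≤L 1≤k) 1≤M)}} (begin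
      L * k * M * (4 * K₂ * Q)
        ≡⟨ lem₁ (L * k * M) (4 * K₂) Q ⟩
      4 * K₂ * (L * k * M) * Q
        ≤⟨ *-monoˡ-≤ Q K≥ ⟩
      K * Q
        ≡⟨ cong (K *_) reorder ⟩
      K * ∑ (upTo L) (λ i → ∑ (upTo k) (λ ℓ′ → tally (shortAt? i (suc ℓ′))))
        ≡⟨ trans (sym (∑-*ˡ (upTo L) K _)) (∑-cong (upTo L) λ i _ → sym (∑-*ˡ (upTo k) K _)) ⟩
      ∑ (upTo L) (λ i → ∑ (upTo k) (λ ℓ′ → K * tally (shortAt? i (suc ℓ′))))
        ≤⟨ ∑-bound (upTo L) (λ i _ → ∑-bound (upTo k) λ ℓ′ ℓ′∈ → short-bound i ℓ′ (∈-upTo⁻ ℓ′∈)) ⟩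
      length (upTo L) * (length (upTo k) * (M * T))
        ≡⟨ cong₂ (λ p q → p * (q * (M * T))) (length-upTo L) (length-upTo k) ⟩
      L * (k * (M * T))
        ≡⟨ lem₂ L k M T ⟩
      L * k * M * T ∎)
      where
      open ≤-Reasoning
      Q = ∑ (verts true) (λ x → ∑ (legs L x) (λ a → shorts (x ∷ a)))
      lem₁ : ∀ a b c → a * (b * c) ≡ b * a * c
      lem₁ = solve-∀
      lem₂ : ∀ a b c e → a * (b * (c * e)) ≡ a * b * c * e
      lem₂ = solve-∀
      reorder : Q ≡ ∑ (upTo L) (λ i → ∑ (upTo k) (λ ℓ′ → tally (shortAt? i (suc ℓ′))))
      reorder = trans (∑-cong (verts true) λ x _ → trans (∑-swap (legs L x) (upTo L) _) (∑-cong (upTo L) λ i _ → ∑-swap (legs L x) (upTo k) _))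
        (trans (∑-swap (verts true) (upTo L) _) (∑-cong (upTo L) λ i _ → ∑-swap (verts true) (upTo k) _))

    bad-bound : K₂ * tally (λ q → ¬? (goodWalk? q)) ≤ T
    bad-bound = *-cancelˡ-≤ 4 (begin
      4 * (K₂ * Q)
        ≡⟨ sym (*-assoc 4 K₂ Q) ⟩
      4 * K₂ * Q
        ≤⟨ *-monoʳ-≤ (4 * K₂) (≤-trans (∑-mono (verts true) λ x _ → ≤-trans (∑-mono (legs L x) λ a a∈ → pointwise x a (proj₁ (∈-legs⁻ L a∈)))
              (≤-reflexive (trans (∑-+ (legs L x) _ _) (cong (_+ ∑ (legs L x) (λ a → shorts (x ∷ a))) (∑-+ (legs L x) _ _)))))
            (≤-reflexive (trans (∑-+ (verts true) _ _) (cong (_+ Q₃) (∑-+ (verts true) _ _))))) ⟩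
      4 * K₂ * (Q₁ + Q₂ + Q₃)
        ≡⟨ trans (*-distribˡ-+ (4 * K₂) (Q₁ + Q₂) Q₃) (cong (_+ 4 * K₂ * Q₃) (*-distribˡ-+ (4 * K₂) Q₁ Q₂)) ⟩
      4 * K₂ * Q₁ + 4 * K₂ * Q₂ + 4 * K₂ * Q₃
        ≤⟨ +-mono-≤ (+-mono-≤ nonpath-bound light-bound) shorts-bound ⟩
      T + T + T
        ≤⟨ m≤m+n _ T ⟩
      T + T + T + T
        ≡⟨ lem T ⟩
      4 * T ∎)
      where
      open ≤-Reasoning
      Q  = tally (λ q → ¬? (goodWalk? q))
      Q₁ = tally (λ q → ¬? (unique? q))
      Q₂ = tally light?
      Q₃ = ∑ (verts true) (λ x → ∑ (legs L x) (λ a → shorts (x ∷ a)))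
      lem : ∀ t → t + t + t + t ≡ 4 * t
      lem = solve-∀
      pointwise : ∀ x a → length a ≡ L → χ (¬? (goodWalk? (x ∷ a))) ≤ χ (¬? (unique? (x ∷ a))) + χ (light? (x ∷ a)) + shorts (x ∷ a)
      pointwise x a len = χ-≤ (¬? (goodWalk? (x ∷ a))) (λ ¬good → cover (classify (x ∷ a) (cong suc len) ¬good))
        where
        q = x ∷ a
        cover : ¬ Unique q ⊎ Light q ⊎ (∃ λ i → ∃ λ ℓ′ → i < L × ℓ′ < k × ShortAt i (suc ℓ′) q) →
          1 ≤ χ (¬? (unique? q)) + χ (light? q) + shorts q
        cover (inj₁ ¬u) = ≤-trans (χ-cover (¬? (unique? q)) (light? q) (inj₁ ¬u)) (m≤m+n _ _)
        cover (inj₂ (inj₁ li)) = ≤-trans (χ-cover (¬? (unique? q)) (light? q) (inj₂ li)) (m≤m+n _ _)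
        cover (inj₂ (inj₂ (i , ℓ′ , i<L , ℓ′<k , sh))) = ≤-trans (1≤χ (shortAt? i (suc ℓ′) q) sh)
          (≤-trans (∑-∈ (λ ℓ′ → χ (shortAt? i (suc ℓ′) q)) (∈-upTo⁺ ℓ′<k)) (≤-trans (∑-∈ (λ i → ∑ (upTo k) (λ ℓ′ → χ (shortAt? i (suc ℓ′) q))) (∈-upTo⁺ i<L)) (m≤n+m _ _)))

    centre : 0 < length (verts (flips k true)) → ∃ λ w → w ∈ verts (flips k true) ×
      K₂ * ∑ (legs k w) (λ a → ∑ (legs k w) (λ b → χ (¬? (goodWalk? (a ʳ++ (w ∷ b)))))) ≤ length (legs k w) * length (legs k w)
    centre 0<v = ∑-≤-∃ (verts (flips k true)) 0<v (begin
      ∑ (verts (flips k true)) (λ w → K₂ * ∑ (legs k w) (λ a → ∑ (legs k w) (λ b → f (a ʳ++ (w ∷ b)))))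
        ≡⟨ ∑-*ˡ (verts (flips k true)) K₂ _ ⟩
      K₂ * centred k k (flips k true) f
        ≡⟨ cong (K₂ *_) (trans (centred-0 k k true f) (centred-0-1 L true f)) ⟩
      K₂ * tally (λ q → ¬? (goodWalk? q))
        ≤⟨ bad-bound ⟩
      T
        ≡⟨ T-centred k k refl ⟩
      ∑ (verts (flips k true)) (λ w → length (legs k w) * length (legs k w)) ∎)
      where
      open ≤-Reasoning
      f : List V → ℕ
      f q = χ (¬? (goodWalk? q))

-- Hubs from long links

-- A density form of Ramsey's theorem: some ordered pairs, the diagonal included, may have no colour
-- as long as these are rare. Colours may depend on the order of a pair, because only an earlier and
-- a later pick are compared.
module Ramsey {A : Set} (k : ℕ) (1≤k : 1 ≤ k) {Col : ℕ → A → A → Set} (col? : ∀ g a b → Dec (Col g a b)) where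

  Coloured : A → A → Set
  Coloured a b = ∃ λ g → g < k × Col g a b

  coloured? : ∀ a b → Dec (Coloured a b)
  coloured? a b = anyUpTo? (λ g → col? g a b) k

  uncoloured : List A → A → ℕ
  uncoloured S a = ∑ S (λ b → χ (¬? (coloured? a b)))

  Pick : A × ℕ → A × ℕ → Set
  Pick (a , g) (b , _) = Col g a b

  Picks : List A → ℕ → Set
  Picks S N = ∃ λ ps → length ps ≡ N × All (λ (a , g) → a ∈ S × g < k) ps × AllPairs Pick ps

  const-k : ℕ → ℕ
  const-k N = (4 * (k * k)) ^ N

  class : List A → A → ℕ → List A
  class S a g = filter (col? g a) S

  classes : ∀ S a → 2 * uncoloured S a ≤ length S → length S ≤ 2 * ∑ (upTo k) (λ g → length (class S a g))
  classes S a half = +-cancelʳ-≤ (length S) _ _ (begin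
    length S + length S
      ≡⟨ cong₂ _+_ (sym (∑-1 S)) (trans (sym (∑-1 S)) (sym (+-identityʳ _))) ⟩
    2 * ∑ S (λ _ → 1)
      ≤⟨ *-monoʳ-≤ 2 (≤-trans (∑-mono S λ b _ → cover b) (≤-reflexive (∑-+ S _ _))) ⟩
    2 * (uncoloured S a + ∑ S (λ b → ∑ (upTo k) (λ g → χ (col? g a b))))
      ≡⟨ cong (λ t → 2 * (uncoloured S a + t)) (trans (∑-swap S (upTo k) _) (∑-cong (upTo k) λ g _ → sym (length-filter-χ (col? g a) S))) ⟩
    2 * (uncoloured S a + ∑ (upTo k) (λ g → length (class S a g)))
      ≡⟨ trans (*-distribˡ-+ 2 (uncoloured S a) _) (+-comm (2 * uncoloured S a) _) ⟩
    2 * ∑ (upTo k) (λ g → length (class S a g)) + 2 * uncoloured S a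
      ≤⟨ +-monoʳ-≤ _ half ⟩
    2 * ∑ (upTo k) (λ g → length (class S a g)) + length S ∎)
    where
    open ≤-Reasoning
    cover : ∀ b → 1 ≤ χ (¬? (coloured? a b)) + ∑ (upTo k) (λ g → χ (col? g a b))
    cover b with coloured? a b
    ... | yes (g , g<k , c) = ≤-trans (1≤χ (col? g a b) c) (∑-∈ (λ g → χ (col? g a b)) (∈-upTo⁺ g<k))
    ... | no _              = s≤s z≤n

  largest : ∀ S a → 2 * uncoloured S a ≤ length S → ∃ λ g → g ∈ upTo k × length S ≤ 2 * k * length (class S a g)
  largest S a half = ∑-≤-∃ (upTo k) (≤-trans 1≤k (≤-reflexive (sym (length-upTo k)))) (begin
    ∑ (upTo k) (λ _ → length S)                                 ≡⟨ trans (∑-const (upTo k) _) (cong (_* length S) (length-upTo k)) ⟩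
    k * length S                                                ≤⟨ *-monoʳ-≤ k (classes S a half) ⟩
    k * (2 * ∑ (upTo k) (λ g → length (class S a g)))           ≡⟨ lem k _ ⟩
    2 * k * ∑ (upTo k) (λ g → length (class S a g))             ≡⟨ sym (∑-*ˡ (upTo k) (2 * k) _) ⟩
    ∑ (upTo k) (λ g → 2 * k * length (class S a g))             ∎)
    where
    open ≤-Reasoning
    lem : ∀ k t → k * (2 * t) ≡ 2 * k * t
    lem = solve-∀

  average : ∀ c S → 0 < length S → c * ∑ S (uncoloured S) ≤ length S * length S → ∃ λ a → a ∈ S × c * uncoloured S a ≤ length S
  average c S 0<S few = ∑-≤-∃ S 0<S (≤-trans (≤-reflexive (∑-*ˡ S c _)) (≤-trans few (≤-reflexive (sym (∑-const S (length S))))))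

  -- The class keeps a share of at least 1/(2k) of `S`, so the share of uncoloured pairs grows at
  -- most by the factor 4k^2. This is the base of the power `const-k`.
  class-few : ∀ c S a g → 4 * (k * k) * c * ∑ S (uncoloured S) ≤ length S * length S → length S ≤ 2 * k * length (class S a g) →
    c * ∑ (class S a g) (uncoloured (class S a g)) ≤ length (class S a g) * length (class S a g)
  class-few c S a g few S≤ = *-cancelˡ-≤ (4 * (k * k)) {{>-nonZero (*-mono-≤ {1} {4} (s≤s z≤n) (*-mono-≤ 1≤k 1≤k))}} (begin
    4 * (k * k) * (c * ∑ S′ (uncoloured S′))        ≡⟨ sym (*-assoc (4 * (k * k)) c _) ⟩
    4 * (k * k) * c * ∑ S′ (uncoloured S′)          ≤⟨ *-monoʳ-≤ (4 * (k * k) * c) (≤-trans (smaller _) (∑-mono S λ b _ → smaller _)) ⟩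
    4 * (k * k) * c * ∑ S (uncoloured S)            ≤⟨ few ⟩
    length S * length S                             ≤⟨ *-mono-≤ S≤ S≤ ⟩
    2 * k * length S′ * (2 * k * length S′)         ≡⟨ lem k (length S′) ⟩
    4 * (k * k) * (length S′ * length S′)           ∎)
    where
    open ≤-Reasoning
    S′ = class S a g
    smaller : ∀ f → ∑ S′ f ≤ ∑ S f
    smaller f = ≤-trans (≤-reflexive (∑-filter (col? g a) S f)) (∑-mono S λ b _ → ≤-trans (*-monoˡ-≤ (f b) (χ≤1 (col? g a b))) (≤-reflexive (*-identityˡ _)))
    lem : ∀ k s → 2 * k * s * (2 * k * s) ≡ 4 * (k * k) * (s * s)
    lem = solve-∀

  1≤const-k : ∀ N → 1 ≤ const-k N
  1≤const-k zero    = ≤-refl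
  1≤const-k (suc N) = *-mono-≤ (*-mono-≤ {1} {4} (s≤s z≤n) (*-mono-≤ 1≤k 1≤k)) (1≤const-k N)

  2≤const-k : ∀ N → 2 ≤ const-k (suc N)
  2≤const-k N = *-mono-≤ {2} (*-mono-≤ {2} {4} (s≤s (s≤s z≤n)) (*-mono-≤ 1≤k 1≤k)) (1≤const-k N)

  -- After each pick the list is cut down to the largest colour class of that pick, which therefore
  -- has a single colour towards all later picks.
  select : ∀ N S → 0 < length S → const-k N * ∑ S (uncoloured S) ≤ length S * length S → Picks S N
  select zero    S 0<S few = [] , refl , [] , []
  select (suc N) S 0<S few with average (const-k (suc N)) S 0<S few
  ... | a , a∈ , sparse-a with largest S a (≤-trans (*-monoˡ-≤ (uncoloured S a) (2≤const-k N)) sparse-a)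
  ... | g , g∈ , S≤ with select N (class S a g) 0<S′ (class-few (const-k N) S a g few S≤)
    where
    0<S′ : 0 < length (class S a g)
    0<S′ = n≢0⇒n>0 λ e → <⇒≱ 0<S (≤-trans S≤ (≤-reflexive (trans (cong (2 * k *_) e) (*-zeroʳ (2 * k)))))
  ... | ps , len , members , pairs =
      (a , g) ∷ ps , cong suc len ,
      (a∈ , ∈-upTo⁻ g∈) ∷ All.map (λ (i , l) → proj₁ (∈-filter⁻ (col? g a) {xs = S} i) , l) members ,
      All.map (λ (i , _) → proj₂ (∈-filter⁻ (col? g a) {xs = S} i)) members ∷ pairs

  Mono : List A → ℕ → Set
  Mono S p = ∃ λ g → g < k × ∃ λ as → length as ≡ p × All (_∈ S) as × AllPairs (Col g) as

  -- Pigeonhole: among k * p picks with k possible colours, p share one.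
  monochromatic : ∀ p S → 0 < length S → const-k (k * p) * ∑ S (uncoloured S) ≤ length S * length S → Mono S p
  monochromatic p S 0<S few with select (k * p) S 0<S few
  ... | ps , len , members , pairs = g , ∈-upTo⁻ g∈ , map proj₁ cs , trans (length-map proj₁ cs) len-cs ,
      Allₚ.map⁺ (All.map proj₁ (Allₚ.take⁺ p (Allₚ.filter⁺ (hasColour g) members))) ,
      AllPairsₚ.map⁺ (recolour cs (Allₚ.take⁺ p (Allₚ.all-filter (hasColour g) ps)) (AllPairsₚ.take⁺ p (AllPairsₚ.filter⁺ (hasColour g) pairs)))
    where
    open ≤-Reasoning
    hasColour : ∀ g (x : A × ℕ) → Dec (proj₂ x ≡ g)
    hasColour g (_ , g′) = g′ ℕₚ.≟ g
    big : ∃ λ g → g ∈ upTo k × p ≤ length (filter (hasColour g) ps)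
    big = ∑-≤-∃ (upTo k) (≤-trans 1≤k (≤-reflexive (sym (length-upTo k)))) (begin
      ∑ (upTo k) (λ _ → p)                                          ≡⟨ trans (∑-const (upTo k) p) (cong (_* p) (length-upTo k)) ⟩
      k * p                                                         ≡⟨ sym len ⟩
      length ps                                                     ≡⟨ sym (∑-1 ps) ⟩
      ∑ ps (λ _ → 1)                                                ≤⟨ ∑-mono ps (λ x i → ≤-trans (1≤χ (hasColour (proj₂ x) x) refl) (∑-∈ (λ g → χ (hasColour g x)) (∈-upTo⁺ (proj₂ (All.lookup members i))))) ⟩
      ∑ ps (λ x → ∑ (upTo k) (λ g → χ (hasColour g x)))             ≡⟨ trans (∑-swap ps (upTo k) _) (∑-cong (upTo k) λ g _ → sym (length-filter-χ (hasColour g) ps)) ⟩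
      ∑ (upTo k) (λ g → length (filter (hasColour g) ps))           ∎)
    g = proj₁ big
    g∈ = proj₁ (proj₂ big)
    cs = take p (filter (hasColour g) ps)
    len-cs : length cs ≡ p
    len-cs = trans (length-take p (filter (hasColour g) ps)) (m≤n⇒m⊓n≡m (proj₂ (proj₂ big)))
    recolour : ∀ xs → All (λ x → proj₂ x ≡ g) xs → AllPairs Pick xs → AllPairs (λ x y → Col g (proj₁ x) (proj₁ y)) xs
    recolour []       _          _        = []
    recolour (x ∷ xs) (refl ∷ c) (h ∷ ap) = h ∷ recolour xs c ap

module LongLinks (S : Setting) where
  open Setting S

  module CaseB (k p K₃ K₄ H₀ : ℕ) (1≤k : 1 ≤ k)
    (K₄≡ : K₄ ≡ (4 * (k * k)) ^ (k * p)) (K₃≡ : K₃ ≡ 2 * K₄ * k)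
    (H≥ : H₀ + 4 * k + 4 ≤ H)
    (D-hits : K₃ * (2 * (k * H₀ * μ ^ (k + k))) < D)
    (w : V)
    (GoodWalk : List V → Set) (goodWalk? : ∀ q → Dec (GoodWalk q))
    (good-unique : ∀ {q} → GoodWalk q → Unique q)
    (good-has : ∀ {q} → GoodWalk q → ∃ λ g′ → g′ < k × Has (k + suc g′) q)
    (few-bad : 2 * K₄ * ∑ (legs k w) (λ a → ∑ (legs k w) (λ b → χ (¬? (goodWalk? (a ʳ++ (w ∷ b)))))) ≤ length (legs k w) * length (legs k w)) where

    open Joins Γ

    Ω : List (List V)
    Ω = legs k w

    -- Colour g′ stands for a link of length k + g, where g = suc g′, between a vertex at distance
    -- g + i from w on one leg and a vertex at distance k - i on the other.
    Crossing : ℕ → List V → List V → Set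
    Crossing g′ a b = Unique (a ʳ++ (w ∷ b)) ×
      ∃ λ i → i < suc (k ∸ suc g′) × Linked (k + suc g′) (end w (take (suc g′ + i) a)) (end w (take (k ∸ i) b))

    abstract
      crossing? : ∀ g′ a b → Dec (Crossing g′ a b)
      crossing? g′ a b = unique? (a ʳ++ (w ∷ b)) ×-dec
        anyUpTo? (λ i → linked? (k + suc g′) (end w (take (suc g′ + i) a)) (end w (take (k ∸ i) b))) (suc (k ∸ suc g′))

    end-back : ∀ x a acc t → end (end x a) (take (length a + t) (back x a acc)) ≡ end x (take t acc)
    end-back x []      acc t = refl
    end-back x (y ∷ a) acc t = trans (cong (λ n → end (end y a) (take n (back y a (x ∷ acc)))) (sym (+-suc (length a) t))) (end-back y a (x ∷ acc) (suc t))

    crossing : ∀ {g′} a b → g′ < k → length a ≡ k → length b ≡ k → Unique (a ʳ++ (w ∷ b)) →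
      Has (k + suc g′) (a ʳ++ (w ∷ b)) → Crossing g′ a b
    crossing {g′} a b g′<k la lb u has with Has-position (a ʳ++ (w ∷ b)) has
    ... | j , v , c , eq , le , lk = u , i , s≤s i≤ , subst₂ (Linked (k + g)) v≡ v′≡ lk
      where
      open ≡-Reasoning
      g = suc g′
      len′ : j + suc (length c) ≡ suc (k + k)
      len′ = trans (drop-length j (a ʳ++ (w ∷ b)) eq) (trans (length-ʳ++ a) (trans (cong₂ (λ p q → p + suc q) la lb) (+-suc k k)))
      j+g≤k : j + g ≤ k
      j+g≤k = +-cancelʳ-≤ k _ _ (s≤s⁻¹ (≤-trans (≤-reflexive (lem j g k)) (≤-trans (+-monoʳ-≤ j (s≤s le)) (≤-reflexive len′))))
        where
        lem : ∀ j g k → suc (j + g + k) ≡ j + suc (k + g)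
        lem = solve-∀
      -- The position `j` is measured from the far end of `a`, so the link starts at distance k - j
      -- = g + i from `w`; its length k + g takes it to distance j + g = k - i on the other leg.
      i = (k ∸ g) ∸ j
      j≤k∸g : j ≤ k ∸ g
      j≤k∸g = m+n≤o⇒m≤o∸n j j+g≤k
      i≤ : i ≤ k ∸ g
      i≤ = m∸n≤m (k ∸ g) j
      j≤k : j ≤ k
      j≤k = ≤-trans (m≤m+n j g) j+g≤k
      a₁ = take (k ∸ j) a
      a₂ = drop (k ∸ j) a
      la₂ : length a₂ ≡ j
      la₂ = trans (length-drop (k ∸ j) a) (trans (cong (_∸ (k ∸ j)) la) (m∸[m∸n]≡n j≤k))
      la₁ : length a₁ ≡ k ∸ j
      la₁ = trans (length-take (k ∸ j) a) (trans (cong ((k ∸ j) ⊓_) la) (m≤n⇒m⊓n≡m (m∸n≤m k j)))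
      shape : v ∷ c ≡ end w a₁ ∷ back w a₁ b
      shape = begin
        v ∷ c                                     ≡⟨ sym eq ⟩
        drop j (a ʳ++ (w ∷ b))                    ≡⟨ cong (λ t → drop j (t ʳ++ (w ∷ b))) (sym (take++drop≡id (k ∸ j) a)) ⟩
        drop j ((a₁ ++ a₂) ʳ++ (w ∷ b))           ≡⟨ cong (drop j) (++-ʳ++ a₁) ⟩
        drop j (a₂ ʳ++ (a₁ ʳ++ (w ∷ b)))          ≡⟨ drop-ʳ++ a₂ _ la₂ ⟩
        a₁ ʳ++ (w ∷ b)                            ≡⟨ ʳ++-back w a₁ b ⟩
        end w a₁ ∷ back w a₁ b                    ∎
      g+i : g + i ≡ k ∸ j
      g+i = trans (sym (+-∸-assoc g j≤k∸g)) (cong (_∸ j) (m+[n∸m]≡n g′<k))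
      k∸i : k ∸ i ≡ j + g
      k∸i = begin
        k ∸ i                      ≡⟨ cong (_∸ i) (sym total-k) ⟩
        (j + g) + i ∸ i            ≡⟨ m+n∸n≡m (j + g) i ⟩
        j + g                      ∎
        where
        total-k : (j + g) + i ≡ k
        total-k = trans (+-assoc j g i) (trans (cong (j +_) g+i) (m+[n∸m]≡n j≤k))
      v≡ : v ≡ end w (take (g + i) a)
      v≡ = trans (∷-injectiveˡ shape) (cong (λ t → end w (take t a)) (sym g+i))
      v′≡ : end v (take (k + g) c) ≡ end w (take (k ∸ i) b)
      v′≡ = begin
        end v (take (k + g) c)                                     ≡⟨ cong₂ (λ x y → end x (take (k + g) y)) (∷-injectiveˡ shape) (∷-injectiveʳ shape) ⟩
        end (end w a₁) (take (k + g) (back w a₁ b))                ≡⟨ cong (λ t → end (end w a₁) (take t (back w a₁ b))) k+g ⟩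
        end (end w a₁) (take (length a₁ + (j + g)) (back w a₁ b))  ≡⟨ end-back w a₁ b (j + g) ⟩
        end w (take (j + g) b)                                     ≡⟨ cong (λ t → end w (take t b)) (sym k∸i) ⟩
        end w (take (k ∸ i) b)                                     ∎
        where
        k+g : k + g ≡ length a₁ + (j + g)
        k+g = trans (cong (_+ g) (sym (m∸n+n≡m j≤k))) (trans (+-assoc (k ∸ j) j g) (cong (_+ (j + g)) (sym la₁)))

    extensions : ℕ → List V → List (List V)
    extensions g′ c = legs (k ∸ suc g′) (end w c)

    crossings : ℕ → List V → List V → ℕ
    crossings g′ c c′ = ∑ (extensions g′ c) (λ e → ∑ (extensions g′ c′) (λ e′ → χ (crossing? g′ (c ++ e) (c′ ++ e′))))

    -- One crossing yields one way of joining, which a bounded set can destroy. Density among the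
    -- continuations survives such sets, and it depends only on the prefixes, whose ends become the
    -- branch vertices.
    Dense : ℕ → List V → List V → Set
    Dense g′ c c′ = length (extensions g′ c) * length (extensions g′ c′) ≤ K₃ * crossings g′ c c′

    Colour : ℕ → List V → List V → Set
    Colour g′ a b = Crossing g′ a b × Dense g′ (take (suc g′) a) (take (suc g′) b)

    abstract
      dense? : ∀ g′ c c′ → Dec (Dense g′ c c′)
      dense? g′ c c′ = _ ≤? _

      colour? : ∀ g′ a b → Dec (Colour g′ a b)
      colour? g′ a b = crossing? g′ a b ×-dec dense? g′ (take (suc g′) a) (take (suc g′) b)

      stray? : ∀ g′ a b → Dec (Crossing g′ a b × ¬ Dense g′ (take (suc g′) a) (take (suc g′) b))
      stray? g′ a b = crossing? g′ a b ×-dec ¬? (dense? g′ (take (suc g′) a) (take (suc g′) b))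

    -- The pairs are grouped by their prefixes of length g. A dense group has no strays, and in any
    -- other group crossings make up less than a share of 1/K₃.
    stray-bound : ∀ g′ → g′ < k → K₃ * ∑ Ω (λ a → ∑ Ω (λ b → χ (stray? g′ a b))) ≤ length Ω * length Ω
    stray-bound g′ g′<k = begin
      K₃ * ∑ Ω (λ a → ∑ Ω (λ b → χ (stray? g′ a b)))
        ≡⟨ cong (K₃ *_) (trans (split _) (∑-cong (legs g w) λ c _ → ∑-cong (extensions g′ c) λ e _ → split _)) ⟩
      K₃ * ∑ (legs g w) (λ c → ∑ (extensions g′ c) (λ e → ∑ (legs g w) (λ c′ → ∑ (extensions g′ c′) (λ e′ → χ (stray? g′ (c ++ e) (c′ ++ e′))))))
        ≡⟨ trans (cong (K₃ *_) (∑-cong (legs g w) λ c _ → ∑-swap (extensions g′ c) (legs g w) _))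
             (trans (sym (∑-*ˡ (legs g w) K₃ _)) (∑-cong (legs g w) λ c _ → sym (∑-*ˡ (legs g w) K₃ _))) ⟩
      ∑ (legs g w) (λ c → ∑ (legs g w) (λ c′ → K₃ * ∑ (extensions g′ c) (λ e → ∑ (extensions g′ c′) (λ e′ → χ (stray? g′ (c ++ e) (c′ ++ e′))))))
        ≤⟨ ∑-mono (legs g w) (λ c c∈ → ∑-mono (legs g w) λ c′ c′∈ → at c c′ (proj₁ (∈-legs⁻ g c∈)) (proj₁ (∈-legs⁻ g c′∈))) ⟩
      ∑ (legs g w) (λ c → ∑ (legs g w) (λ c′ → length (extensions g′ c) * length (extensions g′ c′)))
        ≡⟨ trans (∑-cong (legs g w) λ c _ → ∑-*ˡ (legs g w) (length (extensions g′ c)) _) (∑-*ʳ (legs g w) _ _) ⟩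
      ∑ (legs g w) (λ c → length (extensions g′ c)) * ∑ (legs g w) (λ c → length (extensions g′ c))
        ≡⟨ cong (λ t → t * t) (trans (∑-cong (legs g w) λ c _ → sym (∑-1 (extensions g′ c))) (trans (sym (split (λ _ → 1))) (∑-1 Ω))) ⟩
      length Ω * length Ω ∎
      where
      open ≤-Reasoning
      g = suc g′
      split : ∀ f → ∑ Ω f ≡ ∑ (legs g w) (λ c → ∑ (extensions g′ c) (λ e → f (c ++ e)))
      split f = trans (cong (λ t → ∑ (legs t w) f) (sym (m+[n∸m]≡n g′<k))) (∑-legs-+ g (k ∸ g) w f)
      at : ∀ c c′ → length c ≡ g → length c′ ≡ g →
        K₃ * ∑ (extensions g′ c) (λ e → ∑ (extensions g′ c′) (λ e′ → χ (stray? g′ (c ++ e) (c′ ++ e′)))) ≤ length (extensions g′ c) * length (extensions g′ c′)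
      at c c′ lc lc′ with dense? g′ c c′
      ... | yes dn = ≤-trans (≤-reflexive (trans (cong (K₃ *_) (trans (∑-cong (extensions g′ c) λ e _ → trans (∑-cong (extensions g′ c′) λ e′ _ → none e e′) (∑-0 (extensions g′ c′))) (∑-0 (extensions g′ c)))) (*-zeroʳ K₃))) z≤n
        where
        none : ∀ e e′ → χ (stray? g′ (c ++ e) (c′ ++ e′)) ≡ 0
        none e e′ = n≤0⇒n≡0 (χ-≤ (stray? g′ (c ++ e) (c′ ++ e′)) λ (_ , ¬dn) → ⊥-elim (¬dn (subst₂ (Dense g′) (sym (take-length-++ c e lc)) (sym (take-length-++ c′ e′ lc′)) dn)))
      ... | no ¬dn = ≤-trans (*-monoʳ-≤ K₃ (∑-mono (extensions g′ c) λ e _ → ∑-mono (extensions g′ c′) λ e′ _ → χ-mono (stray? g′ (c ++ e) (c′ ++ e′)) (crossing? g′ (c ++ e) (c′ ++ e′)) proj₁))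
                       (<⇒≤ (≰⇒> ¬dn))

    module R = Ramsey k 1≤k colour?

    -- An uncoloured pair either forms a walk that is not good or is a stray for one of k colours.
    -- K₃ = 2 K₄ k lets each of the two kinds use half of the share 1/K₄.
    few-uncoloured : (4 * (k * k)) ^ (k * p) * ∑ Ω (R.uncoloured Ω) ≤ length Ω * length Ω
    few-uncoloured = *-cancelˡ-≤ 2 (begin
      2 * ((4 * (k * k)) ^ (k * p) * U)
        ≡⟨ trans (sym (*-assoc 2 ((4 * (k * k)) ^ (k * p)) U)) (cong (λ t → 2 * t * U) (sym K₄≡)) ⟩
      2 * K₄ * U
        ≤⟨ *-monoʳ-≤ (2 * K₄) (≤-trans (∑-mono Ω λ a a∈ → ≤-trans (∑-mono Ω λ b b∈ → pointwise a b (proj₁ (∈-legs⁻ k a∈)) (proj₁ (∈-legs⁻ k b∈))) (≤-reflexive (∑-+ Ω _ _))) (≤-reflexive (∑-+ Ω _ _))) ⟩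
      2 * K₄ * (Bd + St)
        ≡⟨ *-distribˡ-+ (2 * K₄) Bd St ⟩
      2 * K₄ * Bd + 2 * K₄ * St
        ≤⟨ +-mono-≤ few-bad strays ⟩
      length Ω * length Ω + length Ω * length Ω
        ≡⟨ cong (length Ω * length Ω +_) (sym (+-identityʳ _)) ⟩
      2 * (length Ω * length Ω) ∎)
      where
      open ≤-Reasoning
      U  = ∑ Ω (R.uncoloured Ω)
      Bd = ∑ Ω (λ a → ∑ Ω (λ b → χ (¬? (goodWalk? (a ʳ++ (w ∷ b))))))
      St = ∑ Ω (λ a → ∑ Ω (λ b → ∑ (upTo k) (λ g′ → χ (stray? g′ a b))))
      strays : 2 * K₄ * St ≤ length Ω * length Ω
      strays = *-cancelˡ-≤ k {{>-nonZero 1≤k}} (begin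
        k * (2 * K₄ * St)
          ≡⟨ lem k (2 * K₄) St ⟩
        2 * K₄ * k * St
          ≡⟨ cong₂ _*_ (sym K₃≡) (trans (∑-cong Ω λ a _ → ∑-swap Ω (upTo k) _) (∑-swap Ω (upTo k) _)) ⟩
        K₃ * ∑ (upTo k) (λ g′ → ∑ Ω (λ a → ∑ Ω (λ b → χ (stray? g′ a b))))
          ≡⟨ sym (∑-*ˡ (upTo k) K₃ _) ⟩
        ∑ (upTo k) (λ g′ → K₃ * ∑ Ω (λ a → ∑ Ω (λ b → χ (stray? g′ a b))))
          ≤⟨ ∑-bound (upTo k) (λ g′ i → stray-bound g′ (∈-upTo⁻ i)) ⟩
        length (upTo k) * (length Ω * length Ω)
          ≡⟨ cong (_* (length Ω * length Ω)) (length-upTo k) ⟩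
        k * (length Ω * length Ω) ∎)
        where
        lem : ∀ a b c → a * (b * c) ≡ b * a * c
        lem = solve-∀
      pointwise : ∀ a b → length a ≡ k → length b ≡ k →
        χ (¬? (R.coloured? a b)) ≤ χ (¬? (goodWalk? (a ʳ++ (w ∷ b)))) + ∑ (upTo k) (λ g′ → χ (stray? g′ a b))
      pointwise a b la lb = χ-≤ (¬? (R.coloured? a b)) λ ¬col → cover ¬col (goodWalk? (a ʳ++ (w ∷ b)))
        where
        cover : ¬ R.Coloured a b → (d : Dec (GoodWalk (a ʳ++ (w ∷ b)))) → 1 ≤ χ (¬? d) + ∑ (upTo k) (λ g′ → χ (stray? g′ a b))
        cover ¬col (no _) = s≤s z≤n
        cover ¬col (yes gw) with good-has gw
        ... | g′ , g′<k , has = ≤-trans (1≤χ (stray? g′ a b) (cr , λ dn → ¬col (g′ , g′<k , cr , dn))) (∑-∈ (λ g′ → χ (stray? g′ a b)) (∈-upTo⁺ g′<k))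
          where
          cr : Crossing g′ a b
          cr = crossing a b g′<k la lb (good-unique gw) has

    1≤D : 1 ≤ D
    1≤D = ≤-trans (s≤s z≤n) D-hits

    module Join-legs (g′ : ℕ) (g′<k : g′ < k) where

      private
        g = suc g′
        n = k ∸ g

      -- By `D-hits` the pairs of continuations in which one meets `F` are a smaller share than the
      -- 1/K₃ that `Dense` provides.
      fresh-extensions : ∀ c c′ → Dense g′ c c′ → ∀ F → length F ≤ H₀ →
        ∃ λ e → ∃ λ e′ → e ∈ extensions g′ c × e′ ∈ extensions g′ c′ × Crossing g′ (c ++ e) (c′ ++ e′) × ¬ Any (_∈ F) e × ¬ Any (_∈ F) e′
      fresh-extensions c c′ dn F |F| with any? (λ e → any? (λ e′ → crossing? g′ (c ++ e) (c′ ++ e′) ×-dec ¬? (meets? F e) ×-dec ¬? (meets? F e′)) X′) X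
        where
        X = extensions g′ c
        X′ = extensions g′ c′
      ... | yes any = let (e , e∈ , any′) = find any
                          (e′ , e′∈ , cr , ¬m , ¬m′) = find any′
                      in e , e′ , e∈ , e′∈ , cr , ¬m , ¬m′
      ... | no ¬any = ⊥-elim (<⇒≱ D-hits (*-cancelʳ-≤ D _ (x * x′) {{>-nonZero (*-mono-≤ (legs-nonempty 1≤D n (end w c)) (legs-nonempty 1≤D n (end w c′)))}} (begin
        D * (x * x′)
          ≤⟨ *-monoʳ-≤ D dn ⟩
        D * (K₃ * crossings g′ c c′)
          ≡⟨ lem₁ D K₃ _ ⟩
        K₃ * (D * crossings g′ c c′)
          ≤⟨ *-monoʳ-≤ K₃ (*-monoʳ-≤ D (∑-mono X λ e e∈ → ∑-mono X′ λ e′ e′∈ → pointwise e e′ e∈ e′∈)) ⟩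
        K₃ * (D * ∑ X (λ e → ∑ X′ (λ e′ → χ (meets? F e) + χ (meets? F e′))))
          ≡⟨ cong (λ t → K₃ * (D * t)) (trans (∑-cong X λ e _ → trans (∑-+ X′ _ _) (cong (_+ hits n (end w c′) F) (trans (∑-const X′ _) (*-comm x′ _)))) (trans (∑-+ X _ _) (cong₂ _+_ (∑-*ʳ X x′ _) (∑-const X _)))) ⟩
        K₃ * (D * (hits n (end w c) F * x′ + x * hits n (end w c′) F))
          ≡⟨ cong (K₃ *_) (lem₂ D (hits n (end w c) F) x′ x (hits n (end w c′) F)) ⟩
        K₃ * (D * hits n (end w c) F * x′ + D * hits n (end w c′) F * x)
          ≤⟨ *-monoʳ-≤ K₃ (+-mono-≤ (*-monoˡ-≤ x′ (bound c)) (*-monoˡ-≤ x (bound c′))) ⟩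
        K₃ * (Q * x * x′ + Q * x′ * x)
          ≡⟨ lem₃ K₃ Q x x′ ⟩
        K₃ * (2 * Q) * (x * x′) ∎)))
        where
        open ≤-Reasoning
        X = extensions g′ c
        X′ = extensions g′ c′
        x = length X
        x′ = length X′
        Q = k * H₀ * μ ^ (k + k)
        lem₁ : ∀ a b c → a * (b * c) ≡ b * (a * c)
        lem₁ = solve-∀
        lem₂ : ∀ d h x′ x h′ → d * (h * x′ + x * h′) ≡ d * h * x′ + d * h′ * x
        lem₂ = solve-∀
        lem₃ : ∀ a q x y → a * (q * x * y + q * y * x) ≡ a * (2 * q) * (x * y)
        lem₃ = solve-∀
        bound : ∀ c → D * hits n (end w c) F ≤ Q * length (extensions g′ c)
        bound c = ≤-trans (hits-fraction n (end w c) F) (≤-trans (*-mono-≤ (*-mono-≤ (m∸n≤m k g) |F|) (*-monoˡ-≤ _ (^-monoʳ-≤ μ {{>-nonZero 1≤μ}} (+-mono-≤ (m∸n≤m k g) (m∸n≤m k g)))))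
                    (≤-reflexive (sym (*-assoc (k * H₀) _ _))))
        pointwise : ∀ e e′ → e ∈ X → e′ ∈ X′ → χ (crossing? g′ (c ++ e) (c′ ++ e′)) ≤ χ (meets? F e) + χ (meets? F e′)
        pointwise e e′ e∈ e′∈ = χ-≤ (crossing? g′ (c ++ e) (c′ ++ e′)) λ cr → cover cr (meets? F e) (meets? F e′)
          where
          cover : Crossing g′ (c ++ e) (c′ ++ e′) → (m : Dec (Any (_∈ F) e)) (m′ : Dec (Any (_∈ F) e′)) → 1 ≤ χ m + χ m′
          cover cr (yes _) _       = s≤s z≤n
          cover cr (no _)  (yes _) = ≤-refl
          cover cr (no ¬m) (no ¬m′) = ⊥-elim (¬any (lose e∈ (lose e′∈ (cr , ¬m , ¬m′))))

      -- The three pieces have lengths i, k + g and k - g - i, with sum 2k for every i. Hence the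
      -- position of the link may vary with the continuations, and with `F`.
      joinable-prefixes : ∀ c c′ → length c ≡ g → length c′ ≡ g → Dense g′ c c′ → Joinable (2 * k) H₀ (end w c) (end w c′)
      joinable-prefixes c c′ lc lc′ dn F |F| with fresh-extensions c c′ dn F |F|
      ... | e , e′ , e∈ , e′∈ , (u , i , s≤s i≤n , lk₀) , ¬m , ¬m′ = go (Link-path (h (k + g)) F′ |F′| (proj₂ lk))
        where
        v v′ : V
        v  = end w c
        v′ = end w c′
        e₁ e₁′ : List V
        e₁  = take i e
        e₁′ = take (n ∸ i) e′
        le : length e ≡ n
        le = proj₁ (∈-legs⁻ n e∈)
        le′ : length e′ ≡ n
        le′ = proj₁ (∈-legs⁻ n e′∈)
        take-+ : ∀ (c e : List V) j → take (length c + j) (c ++ e) ≡ c ++ take j e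
        take-+ []      e j = refl
        take-+ (x ∷ c) e j = cong (x ∷_) (take-+ c e j)
        x x′ : V
        x  = end v e₁
        x′ = end v′ e₁′
        k∸i : k ∸ i ≡ g + (n ∸ i)
        k∸i = trans (cong (_∸ i) (sym (m+[n∸m]≡n g′<k))) (+-∸-assoc g i≤n)
        x≡ : end w (take (g + i) (c ++ e)) ≡ x
        x≡ = trans (cong (λ t → end w (take (t + i) (c ++ e))) (sym lc)) (trans (cong (end w) (take-+ c e i)) (end-++ w c e₁))
        x′≡ : end w (take (k ∸ i) (c′ ++ e′)) ≡ x′
        x′≡ = trans (cong (λ t → end w (take t (c′ ++ e′))) (trans k∸i (cong (_+ (n ∸ i)) (sym lc′)))) (trans (cong (end w) (take-+ c′ e′ (n ∸ i))) (end-++ w c′ e₁′))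
        lk : Linked (k + g) x x′
        lk = subst₂ (Linked (k + g)) x≡ x′≡ lk₀
        F′ : List V
        -- Besides `F` the path of the link must miss both continuations and the second branch
        -- vertex; only its own end `x′`, which lies among these, is exempt.
        F′ = F ++ e ++ v′ ∷ e′
        |F′| : length F′ ≤ h (k + g)
        |F′| = begin
          length F′                          ≡⟨ trans (length-++ F) (cong (length F +_) (trans (length-++ e) (cong₂ (λ p q → p + suc q) le le′))) ⟩
          length F + (n + suc n)             ≤⟨ +-mono-≤ |F| (+-mono-≤ (m∸n≤m k g) (s≤s (m∸n≤m k g))) ⟩
          H₀ + (k + suc k)                   ≤⟨ m≤m+n _ (2 * k + 3) ⟩
          H₀ + (k + suc k) + (2 * k + 3)     ≡⟨ lem H₀ k ⟩
          H₀ + 4 * k + 4                     ≤⟨ H≥ ⟩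
          H                                  ≤⟨ H≤h (k + g) ⟩
          h (k + g)                          ∎
          where
          open ≤-Reasoning
          lem : ∀ a k → a + (k + suc k) + (2 * k + 3) ≡ a + 4 * k + 4
          lem = solve-∀
          H≤h : ∀ ℓ → H ≤ h ℓ
          H≤h zero    = ≤-refl
          H≤h (suc ℓ) = m≤n+m H _
        parts = Unique-ʳ++ (c ++ e) u
        ue : Unique e
        ue = Unique-++ʳ c (proj₁ parts)
        uv′e′ : Unique (v′ ∷ e′)
        uv′e′ = Unique-end w c′ (proj₁ (proj₂ parts))
        suffix⊆ : ∀ y c {b z} → z ∈ end y c ∷ b → z ∈ y ∷ c ++ b
        suffix⊆ y []      j = j
        suffix⊆ y (_ ∷ c) j = there (suffix⊆ _ c j)
        disj : ∀ {z} → z ∈ e → z ∉ v′ ∷ e′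
        disj j j′ = proj₂ (proj₂ parts) (∈-++⁺ʳ c j) (suffix⊆ w c′ j′)
        walk-take : ∀ {y} j a → IsWalk y a → IsWalk y (take j a)
        walk-take j a wk = proj₁ (IsWalk-++⁻ (take j a) (subst (IsWalk _) (sym (take++drop≡id j a)) wk))
        x′∈ : x′ ∈ v′ ∷ e′
        x′∈ with end-∈∷ v′ e₁′
        ... | here r  = here r
        ... | there q = there (take⊆ (n ∸ i) e′ q)
        go : Path (k + g) x x′ F′ → Join (2 * k) v v′ F
        go (Q , Q∈ , eQ , uQ , avQ) = subst (λ L → Join L v v′ F) lenAB
          (join (e₁ ++ Q) e₁′
            (IsWalk-++ e₁ (walk-take i e (proj₂ (∈-legs⁻ n e∈))) (proj₂ (∈-legs⁻ (k + g) Q∈)))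
            (walk-take (n ∸ i) e′ (proj₂ (∈-legs⁻ n e′∈)))
            (trans (end-++ v e₁ Q) eQ)
            (Uniqueₚ.++⁺ (Uniqueₚ.take⁺ i ue) (AllPairs.tail uQ) disjQ)
            (Uniqueₚ.take⁺ (suc (n ∸ i)) uv′e′)
            meet
            (Allₚ.++⁺ (All.tabulate λ j → inj₂ λ f → ¬m (lose (take⊆ i e j) f)) (All.map avoidQ avQ))
            (All.tabulate λ j → inj₂ λ f → ¬m′ (lose (take⊆ (n ∸ i) e′ j) f)))
          where
          disjQ : ∀ {z} → ¬ (z ∈ e₁ × z ∈ Q)
          disjQ (j , q) with All.lookup avQ q
          ... | inj₁ refl = disj (take⊆ i e j) x′∈
          ... | inj₂ ∉F′  = ∉F′ (∈-++⁺ʳ F (∈-++⁺ˡ (take⊆ i e j)))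
          ⊆e′ : ∀ {z} → z ∈ v′ ∷ e₁′ → z ∈ v′ ∷ e′
          ⊆e′ (here r)  = here r
          ⊆e′ (there q) = there (take⊆ (n ∸ i) e′ q)
          meet : ∀ {z} → z ∈ e₁ ++ Q → z ∈ v′ ∷ e₁′ → z ≡ x′
          meet j j′ with ∈-++⁻ e₁ j
          ... | inj₁ q = ⊥-elim (disj (take⊆ i e q) (⊆e′ j′))
          ... | inj₂ q with All.lookup avQ q
          ...   | inj₁ r   = r
          ...   | inj₂ ∉F′ = ⊥-elim (∉F′ (∈-++⁺ʳ F (∈-++⁺ʳ e (⊆e′ j′))))
          avoidQ : ∀ {z} → z ≡ x′ ⊎ z ∉ F′ → z ≡ v′ ⊎ z ∉ F
          avoidQ (inj₂ ∉F′) = inj₂ (∉F′ ∘ ∈-++⁺ˡ)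
          avoidQ (inj₁ refl) with x′∈
          ... | here r  = inj₁ r
          ... | there q = inj₂ λ f → ¬m′ (lose q f)
          lenAB : length (e₁ ++ Q) + length e₁′ ≡ 2 * k
          lenAB = begin
            length (e₁ ++ Q) + length e₁′          ≡⟨ cong₂ _+_ (trans (length-++ e₁) (cong₂ _+_ (len-take i e i≤n le) (proj₁ (∈-legs⁻ (k + g) Q∈)))) (len-take (n ∸ i) e′ (m∸n≤m n i) le′) ⟩
            i + (k + g) + (n ∸ i)                  ≡⟨ lem i k g (n ∸ i) ⟩
            k + (g + (i + (n ∸ i)))                ≡⟨ cong (λ t → k + (g + t)) (m+[n∸m]≡n i≤n) ⟩
            k + (g + n)                            ≡⟨ cong (k +_) (m+[n∸m]≡n g′<k) ⟩
            k + k                                  ≡⟨ cong (k +_) (sym (+-identityʳ k)) ⟩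
            2 * k                                  ∎
            where
            open ≡-Reasoning
            lem : ∀ i k g t → i + (k + g) + t ≡ k + (g + (i + t))
            lem = solve-∀
            len-take : ∀ j (a : List V) → j ≤ n → length a ≡ n → length (take j a) ≡ j
            len-take j a j≤n la = trans (length-take j a) (trans (cong (j ⊓_) la) (m≤n⇒m⊓n≡m j≤n))

    mono⇒hub : R.Mono Ω p → Hub p (2 * k) H₀
    mono⇒hub (g′ , g′<k , as , |as| , as⊆ , pairs) = record
      { branch = map v as ; |branch| = trans (length-map v as) |as|
      ; branch-! = AllPairsₚ.map⁺ (strengthen as as⊆ pairs λ {a} {b} a∈ b∈ ((u , _) , _) e → distinct a b a∈ b∈ u e)
      ; joinable = AllPairsₚ.map⁺ (strengthen as as⊆ pairs λ {a} {b} a∈ b∈ (_ , dn) → joinable-prefixes (take g a) (take g b) (len-g a a∈) (len-g b b∈) dn) }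
      where
      open Join-legs g′ g′<k
      g = suc g′
      v : List V → V
      v a = end w (take g a)
      len-g : ∀ a → a ∈ Ω → length (take g a) ≡ g
      len-g a a∈ = trans (length-take g a) (trans (cong (g ⊓_) (proj₁ (∈-legs⁻ k a∈))) (m≤n⇒m⊓n≡m g′<k))
      strengthen : ∀ {Q : List V → List V → Set} as → All (_∈ Ω) as → AllPairs (Colour g′) as →
        (∀ {a b} → a ∈ Ω → b ∈ Ω → Colour g′ a b → Q a b) → AllPairs Q as
      strengthen []       _          _        f = []
      strengthen (a ∷ as) (a∈ ∷ as∈) (h ∷ ap) f = All.zipWith (λ (c , b∈) → f a∈ b∈ c) (h , as∈) ∷ strengthen as as∈ ap f
      v∈ : ∀ a → a ∈ Ω → v a ∈ a
      v∈ a a∈ = in-take a (≤-trans (s≤s z≤n) (≤-trans g′<k (≤-reflexive (sym (proj₁ (∈-legs⁻ k a∈))))))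
        where
        in-take : ∀ a → 1 ≤ length a → end w (take g a) ∈ a
        in-take (y ∷ a) _ = take⊆ g (y ∷ a) (end-∈ w y (take g′ a))
      distinct : ∀ a b → a ∈ Ω → b ∈ Ω → Unique (a ʳ++ (w ∷ b)) → v a ≢ v b
      distinct a b a∈ b∈ u e = proj₂ (proj₂ (Unique-ʳ++ a u)) (v∈ a a∈) (there (subst (_∈ b) (sym e) (v∈ b b∈)))

    hub : Hub p (2 * k) H₀
    hub = mono⇒hub (R.monochromatic p Ω (legs-nonempty 1≤D k w) few-uncoloured)

-- Embedding the subdivision

∑-tabulate : ∀ {A : Set} n (f : Fin n → A) (φ : A → ℕ) → ∑ (tabulate f) φ ≡ sumFin n (φ ∘ f)
∑-tabulate zero    f φ = refl
∑-tabulate (suc n) f φ = cong (φ (f fz) +_) (∑-tabulate n (f ∘ fs) φ)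

count-χ : ∀ n (f : Fin n → Bool) → count n f ≡ sumFin n (λ i → χ (T? (f i)))
count-χ zero    f = refl
count-χ (suc n) f with f fz
... | true  = cong suc (count-χ n (f ∘ fs))
... | false = count-χ n (f ∘ fs)

sumFin-cong : ∀ n {f g : Fin n → ℕ} → (∀ i → f i ≡ g i) → sumFin n f ≡ sumFin n g
sumFin-cong zero    h = refl
sumFin-cong (suc n) h = cong₂ _+_ (h fz) (sumFin-cong n (h ∘ fs))

module Concrete {m n : ℕ} (G : BipGraph m n) where

  open import Data.List.Relation.Unary.Unique.Propositional.Properties using (map⁺; filter⁺; allFin⁺)

  rowFilter : (a : Fin m) → List (Fin n)
  rowFilter a = filter (λ b → T? (G a b)) (allFin n)

  colFilter : (b : Fin n) → List (Fin m)
  colFilter b = filter (λ a → T? (G a b)) (allFin m)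

  nbrs : Vert m n → List (Vert m n)
  nbrs (inj₁ a) = map inj₂ (rowFilter a)
  nbrs (inj₂ b) = map inj₁ (colFilter b)

  side : Vert m n → Bool
  side (inj₁ _) = true
  side (inj₂ _) = false

  verts : Bool → List (Vert m n)
  verts true  = map inj₁ (allFin m)
  verts false = map inj₂ (allFin n)

  nbrs-Adj : ∀ x {y} → y ∈ nbrs x → Adj G x y
  nbrs-Adj (inj₁ a) i with ∈-map∘filter⁻ inj₂ (λ b → T? (G a b)) {xs = allFin n} i
  ... | b , _ , refl , t = t
  nbrs-Adj (inj₂ b) i with ∈-map∘filter⁻ inj₁ (λ a → T? (G a b)) {xs = allFin m} i
  ... | a , _ , refl , t = t

  Adj-nbrs : ∀ {x y} → Adj G x y → y ∈ nbrs x
  Adj-nbrs {inj₁ a} {inj₂ b} t = ∈-map∘filter⁺ inj₂ (λ b → T? (G a b)) (b , ∈-allFin b , refl , t)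
  Adj-nbrs {inj₂ b} {inj₁ a} t = ∈-map∘filter⁺ inj₁ (λ a → T? (G a b)) (a , ∈-allFin a , refl , t)

  Adj-sym : ∀ {x y} → Adj G x y → Adj G y x
  Adj-sym {inj₁ _} {inj₂ _} t = t
  Adj-sym {inj₂ _} {inj₁ _} t = t

  Adj-side : ∀ {x y} → Adj G x y → side y ≡ not (side x)
  Adj-side {inj₁ _} {inj₂ _} _ = refl
  Adj-side {inj₂ _} {inj₁ _} _ = refl

  ∑-row : ∀ a φ → ∑ (nbrs (inj₁ a)) φ ≡ ∑ (allFin n) (λ b → χ (T? (G a b)) * φ (inj₂ b))
  ∑-row a φ = trans (∑-map inj₂ (rowFilter a) φ) (∑-filter (λ b → T? (G a b)) (allFin n) (φ ∘ inj₂))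

  ∑-col : ∀ b φ → ∑ (nbrs (inj₂ b)) φ ≡ ∑ (allFin m) (λ a → χ (T? (G a b)) * φ (inj₁ a))
  ∑-col b φ = trans (∑-map inj₁ (colFilter b) φ) (∑-filter (λ a → T? (G a b)) (allFin m) (φ ∘ inj₁))

  by-rows : ∀ (f : Vert m n → Vert m n → ℕ) →
    ∑ (verts true) (λ x → ∑ (nbrs x) (f x)) ≡ ∑ (allFin m) (λ a → ∑ (allFin n) (λ b → χ (T? (G a b)) * f (inj₁ a) (inj₂ b)))
  by-rows f = trans (∑-map inj₁ (allFin m) _) (∑-cong (allFin m) λ a _ → ∑-row a (f (inj₁ a)))

  by-cols : ∀ (f : Vert m n → Vert m n → ℕ) →
    ∑ (verts false) (λ y → ∑ (nbrs y) (f y)) ≡ ∑ (allFin n) (λ b → ∑ (allFin m) (λ a → χ (T? (G a b)) * f (inj₂ b) (inj₁ a)))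
  by-cols f = trans (∑-map inj₂ (allFin n) _) (∑-cong (allFin n) λ b _ → ∑-col b (f (inj₂ b)))

  nbrs-swap : ∀ s (f : Vert m n → Vert m n → ℕ) →
    ∑ (verts s) (λ x → ∑ (nbrs x) (f x)) ≡ ∑ (verts (not s)) (λ y → ∑ (nbrs y) (λ x → f x y))
  nbrs-swap true  f = trans (by-rows f) (trans (∑-swap (allFin m) (allFin n) _) (sym (by-cols (λ y x → f x y))))
  nbrs-swap false f = trans (by-cols f) (trans (∑-swap (allFin n) (allFin m) _) (sym (by-rows (λ y x → f x y))))

  graph : BipartiteGraph
  graph = record
    { V = Vert m n
    ; _≟_ = Sumₚ.≡-dec Fin._≟_ Fin._≟_
    ; side = side
    ; verts = verts
    ; verts-∈ = λ { (inj₁ a) → ∈-map⁺ inj₁ (∈-allFin a) ; (inj₂ b) → ∈-map⁺ inj₂ (∈-allFin b) }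
    ; verts-side = λ { {true} i → side₁ i ; {false} i → side₂ i }
    ; verts-! = λ { true → map⁺ Sumₚ.inj₁-injective (allFin⁺ m) ; false → map⁺ Sumₚ.inj₂-injective (allFin⁺ n) }
    ; nbrs = nbrs
    ; nbrs-! = λ { (inj₁ a) → map⁺ Sumₚ.inj₂-injective (filter⁺ (λ b → T? (G a b)) (allFin⁺ n))
                 ; (inj₂ b) → map⁺ Sumₚ.inj₁-injective (filter⁺ (λ a → T? (G a b)) (allFin⁺ m)) }
    ; nbrs-side = λ {x} {y} i → Adj-side {x} {y} (nbrs-Adj x i)
    ; nbrs-sym = λ {x} {y} i → Adj-nbrs {y} {x} (Adj-sym {x} {y} (nbrs-Adj x i))
    ; nbrs-swap = nbrs-swap
    }
    where
    side₁ : ∀ {x} → x ∈ verts true → side x ≡ true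
    side₁ i with ∈-map⁻ inj₁ i
    ... | _ , _ , refl = refl
    side₂ : ∀ {x} → x ∈ verts false → side x ≡ false
    side₂ i with ∈-map⁻ inj₂ i
    ... | _ , _ , refl = refl

  length-row : ∀ a → length (nbrs (inj₁ a)) ≡ degM G a
  length-row a = begin
    length (nbrs (inj₁ a))                          ≡⟨ length-map inj₂ (rowFilter a) ⟩
    length (rowFilter a)                            ≡⟨ length-filter-χ (λ b → T? (G a b)) (allFin n) ⟩
    ∑ (allFin n) (λ b → χ (T? (G a b)))             ≡⟨ ∑-tabulate n id _ ⟩
    sumFin n (λ b → χ (T? (G a b)))                 ≡⟨ sym (count-χ n (G a)) ⟩
    degM G a                                        ∎
    where open ≡-Reasoning

  length-col : ∀ b → length (nbrs (inj₂ b)) ≡ degN G b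
  length-col b = begin
    length (nbrs (inj₂ b))                          ≡⟨ length-map inj₁ (colFilter b) ⟩
    length (colFilter b)                            ≡⟨ length-filter-χ (λ a → T? (G a b)) (allFin m) ⟩
    ∑ (allFin m) (λ a → χ (T? (G a b)))             ≡⟨ ∑-tabulate m id _ ⟩
    sumFin m (λ a → χ (T? (G a b)))                 ≡⟨ sym (count-χ m (λ a → G a b)) ⟩
    degN G b                                        ∎
    where open ≡-Reasoning

  edges-rows : edges G ≡ ∑ (verts true) (λ x → length (nbrs x))
  edges-rows = sym (trans (∑-map inj₁ (allFin m) _) (trans (∑-tabulate m id _) (sumFin-cong m length-row)))

  edges-cols : edges G ≡ ∑ (verts false) (λ x → length (nbrs x))
  edges-cols = trans edges-rows (trans (∑-cong (verts true) λ x _ → sym (∑-1 (nbrs x)))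
    (trans (nbrs-swap true (λ _ _ → 1)) (∑-cong (verts false) λ x _ → ∑-1 (nbrs x))))

  length-verts-true : length (verts true) ≡ m
  length-verts-true = trans (length-map inj₁ (allFin m)) (length-tabulate {n = m} id)

  length-verts-false : length (verts false) ≡ n
  length-verts-false = trans (length-map inj₂ (allFin n)) (length-tabulate {n = n} id)

AllPairs-lookup : ∀ {A : Set} {R : A → A → Set} {xs} → AllPairs R xs → ∀ i j → i <ᶠ j → R (lookup xs i) (lookup xs j)
AllPairs-lookup (h ∷ _)  fz     (fs j) _       = All.lookup h (∈-lookup j)
AllPairs-lookup (_ ∷ ap) (fs i) (fs j) (s≤s l) = AllPairs-lookup ap i j l

Unique-lookup : ∀ {A : Set} {xs : List A} → Unique xs → ∀ i j → lookup xs i ≡ lookup xs j → i ≡ j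
Unique-lookup u i j e with Finₚ.<-cmp i j
... | tri< l _ _ = ⊥-elim (AllPairs-lookup u i j l e)
... | tri≈ _ r _ = r
... | tri> _ _ l = ⊥-elim (AllPairs-lookup u j i l (sym e))

-- Each list chosen is added to the set that later ones must avoid, which yields pairwise
-- disjointness; `step` bounds the growth of that set per key.
module Greedy {Key A : Set} (_≟_ : DecidableEquality Key) (P : Key → List A → Set) (step h : ℕ) (F₀ : List A)
  (one : ∀ κ F → (∀ {z} → z ∈ F₀ → z ∈ F) → length F ≤ h → ∃ λ c → length c ≤ step × P κ c × All (_∉ F) c) where

  Family : List Key → List A → Set
  Family ks F = ∃ λ (f : Key → List A) →
    (∀ {κ} → κ ∈ ks → P κ (f κ) × All (_∉ F) (f κ)) ×
    (∀ {κ κ′} → κ ∈ ks → κ′ ∈ ks → κ ≢ κ′ → ∀ {z} → z ∈ f κ → z ∉ f κ′)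

  family : ∀ ks F → (∀ {z} → z ∈ F₀ → z ∈ F) → length F + length ks * step ≤ h → Family ks F
  family []       F sub le = (λ _ → []) , (λ ()) , λ ()
  family (κ ∷ ks) F sub le with one κ F sub (≤-trans (m≤m+n _ _) le)
  ... | c , |c| , Pc , avc with family ks (c ++ F) (∈-++⁺ʳ c ∘ sub) (≤-trans (begin
      length (c ++ F) + length ks * step           ≡⟨ cong (_+ length ks * step) (trans (length-++ c) (+-comm (length c) _)) ⟩
      length F + length c + length ks * step       ≡⟨ +-assoc (length F) _ _ ⟩
      length F + (length c + length ks * step)     ≤⟨ +-monoʳ-≤ (length F) (+-monoˡ-≤ _ |c|) ⟩
      length F + (step + length ks * step)         ∎) le)
    where open ≤-Reasoning
  ... | f , good , disjoint = (λ κ′ → pick (κ′ ≟ κ)) , (λ {κ′} → good′ (κ′ ≟ κ)) , λ {κ₁} {κ₂} → disjoint′ (κ₁ ≟ κ) (κ₂ ≟ κ)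
    where
    pick : ∀ {κ′} → Dec (κ′ ≡ κ) → List A
    pick          (yes _) = c
    pick {κ′} (no _)  = f κ′
    tail∈ : ∀ {κ′} → ¬ κ′ ≡ κ → κ′ ∈ κ ∷ ks → κ′ ∈ ks
    tail∈ ¬e (here e)  = ⊥-elim (¬e e)
    tail∈ ¬e (there i) = i
    good′ : ∀ {κ′} (q : Dec (κ′ ≡ κ)) → κ′ ∈ κ ∷ ks → P κ′ (pick q) × All (_∉ F) (pick q)
    good′ (yes refl) i = Pc , avc
    good′ (no ¬e)    i = let (Pf , av) = good (tail∈ ¬e i) in Pf , All.map (λ ∉F → ∉F ∘ ∈-++⁺ʳ c) av
    disjoint′ : ∀ {κ₁ κ₂} (q₁ : Dec (κ₁ ≡ κ)) (q₂ : Dec (κ₂ ≡ κ)) → κ₁ ∈ κ ∷ ks → κ₂ ∈ κ ∷ ks → κ₁ ≢ κ₂ → ∀ {z} → z ∈ pick q₁ → z ∉ pick q₂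
    disjoint′ (yes refl) (yes refl) i₁ i₂ ne j₁ j₂ = ne refl
    disjoint′ (yes refl) (no ¬e)    i₁ i₂ ne j₁ j₂ = All.lookup (proj₂ (good (tail∈ ¬e i₂))) j₂ (∈-++⁺ˡ j₁)
    disjoint′ (no ¬e)    (yes refl) i₁ i₂ ne j₁ j₂ = All.lookup (proj₂ (good (tail∈ ¬e i₁))) j₁ (∈-++⁺ˡ j₂)
    disjoint′ (no ¬e₁)   (no ¬e₂)   i₁ i₂ ne j₁ j₂ = disjoint (tail∈ ¬e₁ i₁) (tail∈ ¬e₂ i₂) ne j₁ j₂

length-cartesianProduct : ∀ {A B : Set} (xs : List A) (ys : List B) → length (cartesianProduct xs ys) ≡ length xs * length ys
length-cartesianProduct []       ys = refl
length-cartesianProduct (x ∷ xs) ys = trans (length-++ (map (x ,_) ys))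
  (cong₂ _+_ (length-map (x ,_) ys) (length-cartesianProduct xs ys))

module Embedding {m n : ℕ} (G : BipGraph m n) (k r : ℕ) (1≤k : 1 ≤ k) where

  open Concrete G using (graph; nbrs-Adj)
  open BipartiteGraph graph using (V; nbrs)
  open Walks graph
  open Links graph
  open Joins graph

  module _ (branch : List V) (branch-! : Unique branch) (H₀ : ℕ)
    (H₀≥ : length branch + length branch * (length branch * r) * (2 * k) ≤ H₀)
    (joinable : AllPairs (Joinable (2 * k) H₀) branch) where

    p : ℕ
    p = length branch

    v : Fin p → V
    v = lookup branch

    Key : Set
    Key = Fin p × Fin p × Fin r

    _≟ᵏ_ : DecidableEquality Key
    _≟ᵏ_ = Productₚ.≡-dec Fin._≟_ (Productₚ.≡-dec Fin._≟_ Fin._≟_)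

    keys : List Key
    keys = cartesianProduct (allFin p) (cartesianProduct (allFin p) (allFin r))

    keys-∈ : ∀ κ → κ ∈ keys
    keys-∈ (i , j , c) = ∈-cartesianProduct⁺ (∈-allFin i) (∈-cartesianProduct⁺ (∈-allFin j) (∈-allFin c))

    -- Keys run over all pairs of branch indices, so that they form a plain product. When i is not
    -- below j the condition holds trivially and `one` returns the empty list.
    Inner : Key → List V → Set
    Inner (i , j , _) c = i <ᶠ j → length c ≡ 2 * k ∸ 1 × IsWalk (v i) (c ++ v j ∷ []) × Unique c

    snoc : ∀ x W {y} → end x W ≡ y → 1 ≤ length W → ∃ λ c → W ≡ c ++ y ∷ []
    snoc x (y ∷ [])    refl _ = [] , refl
    snoc x (y ∷ z ∷ W) e    _ = let (c , r) = snoc y (z ∷ W) e (s≤s z≤n) in y ∷ c , cong (y ∷_) r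

    one : ∀ κ F → (∀ {z} → z ∈ branch → z ∈ F) → length F ≤ H₀ → ∃ λ c → length c ≤ 2 * k × Inner κ c × All (_∉ F) c
    one (i , j , _) F sub |F| with i Finₚ.<? j
    ... | no ¬l = [] , z≤n , (λ l → ⊥-elim (¬l l)) , []
    ... | yes l with AllPairs-lookup joinable i j l F |F|
    ... | W , |W| , walk , e , u , av with snoc (v i) W e (≤-trans (*-mono-≤ {1} {2} (s≤s z≤n) 1≤k) (≤-reflexive (sym |W|)))
    ... | c , refl = c , ≤-trans (≤-trans (n≤1+n _) (≤-reflexive (sym sc))) (≤-reflexive |W|) ,
        (λ _ → trans (cong pred (sym sc)) (cong pred |W|) ,
               walk , Unique-++ˡ c u) ,
        All.tabulate λ {z} z∈ z∈F → avoid z∈ (All.lookup av (∈-++⁺ˡ z∈)) z∈F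
      where
      sc : length (c ++ v j ∷ []) ≡ suc (length c)
      sc = trans (length-++ c) (+-comm (length c) 1)
      avoid : ∀ {z} → z ∈ c → z ≡ v j ⊎ z ∉ F → z ∉ F
      avoid z∈ (inj₂ n)    = n
      avoid z∈ (inj₁ refl) = λ _ → last≢ c u z∈ refl
        where
        last≢ : ∀ c {y z : V} → Unique (c ++ y ∷ []) → z ∈ c → z ≢ y
        last≢ (_ ∷ c) (h ∷ _) (here refl) r = All.lookup h (∈-++⁺ʳ c (here refl)) r
        last≢ (_ ∷ c) (_ ∷ u) (there q)   r = last≢ c u q r

    open Greedy _≟ᵏ_ Inner (2 * k) H₀ branch one

    length-keys : length keys ≡ p * (p * r)
    length-keys = trans (length-cartesianProduct (allFin p) _) (cong₂ _*_ (length-tabulate {n = p} id)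
      (trans (length-cartesianProduct (allFin p) (allFin r)) (cong₂ _*_ (length-tabulate {n = p} id) (length-tabulate {n = r} id))))

    inner-paths : Family keys branch
    inner-paths = family keys branch id (≤-trans (≤-reflexive (cong (λ t → p + t * (2 * k)) length-keys)) H₀≥)

    nth : V → List V → ℕ → V
    nth x a       zero    = x
    nth x []      (suc t) = x
    nth x (y ∷ a) (suc t) = nth y a t

    nth-walk : ∀ x a t → IsWalk x a → t < length a → nth x a (suc t) ∈ nbrs (nth x a t)
    nth-walk x (y ∷ a) zero    (i , _) _       = i
    nth-walk x (y ∷ a) (suc t) (_ , w) (s≤s l) = nth-walk y a t w l

    nth-lookup : ∀ x c y (i : Fin (length c)) → lookup c i ≡ nth x (c ++ y ∷ []) (suc (toℕ i))
    nth-lookup x (z ∷ c) y fz     = refl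
    nth-lookup x (z ∷ c) y (fs i) = nth-lookup z c y i

    nth-last : ∀ x c y → y ≡ nth x (c ++ y ∷ []) (suc (length c))
    nth-last x []      y = refl
    nth-last x (z ∷ c) y = nth-last z c y

    embedding : ContainsSubdivK p k r G
    embedding with inner-paths
    ... | f , good , disjoint = φ , φ-injective , adjacent
      where
      len : ∀ {i j c} → i <ᶠ j → length (f (i , j , c)) ≡ 2 * k ∸ 1
      len l = proj₁ (proj₁ (good (keys-∈ _)) l)
      φ : HVert p k r → V
      φ (inj₁ i)                           = v i
      φ (inj₂ ((((i , j) , l) , c) , t)) = lookup (f (i , j , c)) (cast (sym (len l)) t)
      outside : ∀ κ i → v i ∉ f κ
      outside κ i j = All.lookup (proj₂ (good (keys-∈ κ))) j (∈-lookup i)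
      φ-injective : Injective _≡_ _≡_ φ
      φ-injective {inj₁ i} {inj₁ j} e = cong inj₁ (Unique-lookup branch-! i j e)
      φ-injective {inj₁ i} {inj₂ ((((a , b) , l) , c) , t)} e =
        ⊥-elim (outside (a , b , c) i (subst (_∈ f (a , b , c)) (sym e) (∈-lookup (cast (sym (len l)) t))))
      φ-injective {inj₂ ((((a , b) , l) , c) , t)} {inj₁ i} e =
        ⊥-elim (outside (a , b , c) i (subst (_∈ f (a , b , c)) e (∈-lookup (cast (sym (len l)) t))))
      φ-injective {inj₂ ((((a , b) , l) , c) , t)} {inj₂ ((((a′ , b′) , l′) , c′) , t′)} e with (a , b , c) ≟ᵏ (a′ , b′ , c′)
      ... | no ne = ⊥-elim (disjoint (keys-∈ (a , b , c)) (keys-∈ (a′ , b′ , c′)) ne (∈-lookup (cast (sym (len l)) t))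
                      (subst (_∈ f (a′ , b′ , c′)) (sym e) (∈-lookup (cast (sym (len l′)) t′))))
      -- A path index contains a proof of i < j; such proofs are unique, so equal keys give equal
      -- indices.
      ... | yes refl with ≤-irrelevant l l′
      ... | refl = cong (λ s → inj₂ ((((a , b) , l) , c) , s)) (Finₚ.toℕ-injective (begin
        toℕ t                          ≡⟨ sym (Finₚ.toℕ-cast (sym (len l)) t) ⟩
        toℕ (cast (sym (len l)) t)     ≡⟨ cong toℕ (Unique-lookup (proj₂ (proj₂ (proj₁ (good (keys-∈ (a , b , c))) l))) _ _ e) ⟩
        toℕ (cast (sym (len l)) t′)    ≡⟨ Finₚ.toℕ-cast (sym (len l)) t′ ⟩
        toℕ t′                         ∎))
        where open ≡-Reasoning
      along : ∀ (e@(((i , j) , l) , c) : PathIx p r) t → t ≤ 2 * k → φ (pathVtx k e t) ≡ nth (v i) (f (i , j , c) ++ v j ∷ []) t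
      along e zero _ = refl
      along (((i , j) , l) , c) (suc t) t<2k with t <? (2 * k ∸ 1)
      ... | yes t< = trans (nth-lookup (v i) (f (i , j , c)) (v j) (cast (sym (len l)) (fromℕ< t<)))
                       (cong (λ s → nth (v i) (f (i , j , c) ++ v j ∷ []) (suc s)) (trans (Finₚ.toℕ-cast (sym (len l)) (fromℕ< t<)) (Finₚ.toℕ-fromℕ< t<)))
      -- Here `t` equals 2k - 1, so `suc t` is the last index and the vertex is the end `v j`.
      ... | no ¬t< = trans (nth-last (v i) (f (i , j , c)) (v j))
                       (cong (λ s → nth (v i) (f (i , j , c) ++ v j ∷ []) (suc s)) (trans (len l) (≤-antisym (≮⇒≥ ¬t<) (m+n≤o⇒m≤o∸n t (≤-trans (≤-reflexive (+-comm t 1)) t<2k)))))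
      adjacent : ∀ (e : PathIx p r) t → t < 2 * k → Adj G (φ (pathVtx k e t)) (φ (pathVtx k e (suc t)))
      adjacent e@(((i , j) , l) , c) t t<2k = subst₂ (Adj G) (sym (along e t (<⇒≤ t<2k))) (sym (along e (suc t) t<2k))
        (nbrs-Adj (nth (v i) (f (i , j , c) ++ v j ∷ []) t) (nth-walk (v i) (f (i , j , c) ++ v j ∷ []) t (proj₁ (proj₂ (proj₁ (good (keys-∈ (i , j , c))) l)))
          (≤-trans t<2k (≤-reflexive (sym full)))))
        where
        full : length (f (i , j , c) ++ v j ∷ []) ≡ 2 * k
        full = trans (length-++ (f (i , j , c))) (trans (cong (_+ 1) (len l)) (m∸n+n≡m (*-mono-≤ {1} {2} (s≤s z≤n) 1≤k)))

-- Constants and assembly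

-- `H₀` bounds what the greedy embedding ever has to avoid: the p branch vertices and at most 2k
-- vertices for each of p * p * r keys. `H` adds room for the path pieces of one join and for the
-- losses in stretching. `K₄` is the Ramsey constant, and `D₁` to `D₅` are the degree requirements
-- of the two cases.
record Constants (μ k r p : ℕ) : Set where
  field
    H₀ H K K₃ K₄ E D C : ℕ
    H₀≡ : H₀ ≡ p + p * (p * r) * (2 * k)
    H≡  : H ≡ H₀ + 4 * k + 4
    K₄≡ : K₄ ≡ (4 * (k * k)) ^ (k * p)
    K₃≡ : K₃ ≡ 2 * K₄ * k
    K≥  : 4 * (2 * K₄) * ((k + k) * k * (μ ^ (k + k) * μ ^ (k + k))) ≤ K
    1≤K : 1 ≤ K
    E≡  : E ≡ 4 * (K * k)
    D₁  : E * (suc H * μ) ≤ D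
    D₂  : μ * (4 * (2 * K) * suc p) ≤ D
    D₃  : k * H₀ * μ ^ (k + k) * (2 * (2 * K) * (4 * (2 * K)) ^ p) < D
    D₄  : 4 * (2 * K₄) * ((k + k) * (k + k) * (μ ^ (k + k) * μ ^ (k + k))) ≤ D
    D₅  : K₃ * (2 * (k * H₀ * μ ^ (k + k))) < D
    C≥  : 4 * (2 * K₄) * (lightBound (E * H) H (k + k) * μ ^ (k + k)) ≤ C
    1≤C : 1 ≤ C

constants : ∀ μ k r p → Constants μ k r p
constants μ k r p = record
  { H₀ = H₀ ; H = H ; K = K ; K₃ = K₃ ; K₄ = K₄ ; E = E ; D = D ; C = suc c
  ; H₀≡ = refl ; H≡ = refl ; K₄≡ = refl ; K₃≡ = refl ; K≥ = n≤1+n _ ; 1≤K = s≤s z≤n ; E≡ = refl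
  ; D₁ = m≤m+n d₁ _
  ; D₂ = ≤-trans (m≤m+n d₂ _) (m≤n+m _ d₁)
  ; D₃ = ≤-trans (m≤m+n (suc d₃) _) (≤-trans (m≤n+m _ d₂) (m≤n+m _ d₁))
  ; D₄ = ≤-trans (m≤m+n d₄ _) (≤-trans (m≤n+m _ (suc d₃)) (≤-trans (m≤n+m _ d₂) (m≤n+m _ d₁)))
  ; D₅ = ≤-trans (m≤n+m (suc d₅) d₄) (≤-trans (m≤n+m _ (suc d₃)) (≤-trans (m≤n+m _ d₂) (m≤n+m _ d₁)))
  ; C≥ = n≤1+n c ; 1≤C = s≤s z≤n }
  where
  H₀ H K K₃ K₄ E D c d₁ d₂ d₃ d₄ d₅ : ℕ
  H₀ = p + p * (p * r) * (2 * k)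
  H  = H₀ + 4 * k + 4
  K₄ = (4 * (k * k)) ^ (k * p)
  K₃ = 2 * K₄ * k
  K  = suc (4 * (2 * K₄) * ((k + k) * k * (μ ^ (k + k) * μ ^ (k + k))))
  E  = 4 * (K * k)
  c  = 4 * (2 * K₄) * (lightBound (E * H) H (k + k) * μ ^ (k + k))
  d₁ = E * (suc H * μ)
  d₂ = μ * (4 * (2 * K) * suc p)
  d₃ = k * H₀ * μ ^ (k + k) * (2 * (2 * K) * (4 * (2 * K)) ^ p)
  d₄ = 4 * (2 * K₄) * ((k + k) * (k + k) * (μ ^ (k + k) * μ ^ (k + k)))
  d₅ = K₃ * (2 * (k * H₀ * μ ^ (k + k)))
  D  = d₁ + (d₂ + (suc d₃ + (d₄ + suc d₅)))

module Assembly {μ k r p : ℕ} (1≤μ : 1 ≤ μ) (1≤k : 1 ≤ k) (const : Constants μ k r p)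
  (Γ : BipartiteGraph) (d : Bool → ℕ)
  (deg-lo : ∀ x → d (BipartiteGraph.side Γ x) ≤ μ * length (BipartiteGraph.nbrs Γ x))
  (deg-hi : ∀ x → length (BipartiteGraph.nbrs Γ x) ≤ μ * d (BipartiteGraph.side Γ x))
  (D≤d : ∀ s → Constants.D const ≤ d s)
  (0<verts : ∀ s → 0 < length (BipartiteGraph.verts Γ s)) where

  open Constants const
  open BipartiteGraph Γ
  open Joins Γ

  1≤H : 1 ≤ H
  1≤H = ≤-trans (≤-trans (s≤s z≤n) (m≤n+m 4 (H₀ + 4 * k))) (≤-reflexive (sym H≡))

  setting : Setting
  setting = record
    { Γ = Γ ; μ = μ ; D = D ; H = H ; E = E ; 1≤μ = 1≤μ ; d = d ; deg-lo = deg-lo ; deg-hi = deg-hi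
    ; D≤d = D≤d ; 1≤H = 1≤H ; E≤D = D₁ }

  open Setting setting using (total; walkCount; clean?; π)

  Frequent : ℕ → Bool → Set
  Frequent ℓ′ s = 1 ≤ ℓ′ × total (suc ℓ′) s ≤ K * walkCount (suc ℓ′) s (clean? (suc ℓ′))

  frequent? : ∀ s → Dec (∃ λ ℓ′ → ℓ′ < k × Frequent ℓ′ s)
  frequent? s = anyUpTo? (λ ℓ′ → (1 ≤? ℓ′) ×-dec (_ ≤? _)) k

  caseA : ∀ s → (∃ λ ℓ′ → ℓ′ < k × Frequent ℓ′ s) → Hub p (2 * k) H₀
  caseA s (ℓ′ , ℓ′<k , 1≤ℓ′ , dense) =
    ShortLinks.CaseA.hub setting k p K H₀ 1≤k 1≤K E≡ (≤-reflexive (sym H≡)) D₂ D₃ ℓ′ 1≤ℓ′ ℓ′<k s (0<verts (not s)) dense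

  module _ (C-π : C * length (verts true) ≤ π (k + k) true) where

    caseB : (∀ s → ¬ ∃ λ ℓ′ → ℓ′ < k × Frequent ℓ′ s) → Hub p (2 * k) H₀
    caseB rare = from (BW.centre (0<verts (flips k true)))
      where
      module BW = LongWalks.BadWalks setting k (2 * K₄) K C 1≤k K≥ D₄ C≥ C-π
        (λ ℓ′ s 1≤ℓ′ ℓ≤k → <⇒≤ (≰⇒> λ le → rare s (ℓ′ , ℓ≤k , 1≤ℓ′ , le)))
      from : (∃ λ w → w ∈ verts (flips k true) × _) → Hub p (2 * k) H₀
      from (w , _ , few-bad) = LongLinks.CaseB.hub setting k p K₃ K₄ H₀ 1≤k K₄≡ K₃≡ (≤-reflexive (sym H≡)) D₅ w
        BW.GoodWalk BW.goodWalk? proj₁ proj₂ few-bad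

    hub : Hub p (2 * k) H₀
    hub with frequent? true | frequent? false
    ... | yes f | _     = caseA true f
    ... | no _  | yes f = caseA false f
    ... | no ¬t | no ¬f = caseB λ { true → ¬t ; false → ¬f }

  π-even : ∀ j → π (j + j) true ≡ (d true * d false) ^ j
  π-even zero    = refl
  π-even (suc j) = trans (cong (λ t → d true * π t false) (+-suc j j)) (trans (cong (λ t → d true * (d false * t)) (π-even j)) (sym (*-assoc (d true) _ _)))

contains : ∀ {m n} (G : BipGraph m n) k r p h → 1 ≤ k → p + p * (p * r) * (2 * k) ≤ h →
  Joins.Hub (Concrete.graph G) p (2 * k) h → ContainsSubdivK p k r G
contains G k r p h 1≤k h≥ record { branch = b ; |branch| = refl ; branch-! = b-! ; joinable = j } =
  Embedding.embedding G k r 1≤k b b-! h h≥ j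

-- From the number of edges to the number of walks

^-distribʳ-* : ∀ a b k → (a * b) ^ k ≡ a ^ k * b ^ k
^-distribʳ-* a b zero    = refl
^-distribʳ-* a b (suc k) = trans (cong (a * b *_) (^-distribʳ-* a b k)) (lem a b (a ^ k) (b ^ k))
  where
  lem : ∀ a b x y → a * b * (x * y) ≡ a * x * (b * y)
  lem = solve-∀

^-double : ∀ a k → a ^ (2 * k) ≡ (a * a) ^ k
^-double a k = trans (sym (^-*-assoc a 2 k)) (cong (λ t → (a * t) ^ k) (*-identityʳ a))

≤-^ : ∀ {c} k → 1 ≤ c → 1 ≤ k → c ≤ c ^ k
≤-^ {c} (suc k) 1≤c _ = ≤-trans (≤-reflexive (sym (*-identityʳ c))) (*-monoʳ-≤ c (m^n>0 c {{>-nonZero 1≤c}} k))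

-- The exponents of the theorem arise here. Multiplying the two bounds on e gives e^2 ≤ μ^2 m n x y;
-- in the k-th power the factors (μ^2)^k, m^k and n^k cancel, and C^(2k) m remains below (x y)^k.
-- The weaker factor C ≤ C^(2k) is what the count of light walks asks for.
density : ∀ μ C k m n e x y → 1 ≤ μ → 1 ≤ C → 1 ≤ k → 1 ≤ m → 1 ≤ n →
  e ≤ m * (μ * x) → e ≤ n * (μ * y) → (μ * C) ^ (2 * k) * (m ^ (k + 1) * n ^ k) < e ^ (2 * k) → C * m ≤ (x * y) ^ k
density μ C k m n e x y 1≤μ 1≤C 1≤k 1≤m 1≤n e≤M e≤N big = begin
  C * m                  ≤⟨ *-monoˡ-≤ m (≤-trans (≤-trans (≤-reflexive (sym (*-identityʳ C))) (*-monoʳ-≤ C 1≤C)) (≤-^ k (*-mono-≤ 1≤C 1≤C) 1≤k)) ⟩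
  (C * C) ^ k * m        ≤⟨ *-cancelˡ-≤ Q {{>-nonZero 1≤Q}} (<⇒≤ cancel) ⟩
  (x * y) ^ k            ∎
  where
  open ≤-Reasoning
  Q = (μ * μ) ^ k * (m ^ k * n ^ k)
  pos : ∀ {a} → 1 ≤ a → 1 ≤ a ^ k
  pos {a} 1≤a = m^n>0 a {{>-nonZero 1≤a}} k
  1≤Q : 1 ≤ Q
  1≤Q = *-mono-≤ (pos (*-mono-≤ 1≤μ 1≤μ)) (*-mono-≤ (pos 1≤m) (pos 1≤n))
  cancel : Q * ((C * C) ^ k * m) < Q * (x * y) ^ k
  cancel = begin-strict
    Q * ((C * C) ^ k * m)
      ≡⟨ lem₁ ((μ * μ) ^ k) (m ^ k) (n ^ k) ((C * C) ^ k) m ⟩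
    (μ * μ) ^ k * (C * C) ^ k * (m ^ k * (m * 1) * n ^ k)
      ≡⟨ cong₂ (λ s t → s * (t * n ^ k)) (trans (sym (^-distribʳ-* (μ * μ) (C * C) k)) (trans (cong (_^ k) (lem₂ μ C)) (sym (^-double (μ * C) k)))) (sym (^-distribˡ-+-* m k 1)) ⟩
    (μ * C) ^ (2 * k) * (m ^ (k + 1) * n ^ k)
      <⟨ big ⟩
    e ^ (2 * k)
      ≡⟨ ^-double e k ⟩
    (e * e) ^ k
      ≤⟨ ^-monoˡ-≤ k (*-mono-≤ e≤M e≤N) ⟩
    (m * (μ * x) * (n * (μ * y))) ^ k
      ≡⟨ cong (_^ k) (lem₃ m μ x n y) ⟩
    (μ * μ * (m * n) * (x * y)) ^ k
      ≡⟨ trans (^-distribʳ-* (μ * μ * (m * n)) (x * y) k) (cong (_* (x * y) ^ k) (trans (^-distribʳ-* (μ * μ) (m * n) k) (cong ((μ * μ) ^ k *_) (^-distribʳ-* m n k)))) ⟩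
    Q * (x * y) ^ k ∎
    where
    lem₁ : ∀ a b c e m → a * (b * c) * (e * m) ≡ a * e * (b * (m * 1) * c)
    lem₁ = solve-∀
    lem₂ : ∀ a b → a * a * (b * b) ≡ a * b * (a * b)
    lem₂ = solve-∀
    lem₃ : ∀ m u x n y → m * (u * x) * (n * (u * y)) ≡ u * u * (m * n) * (x * y)
    lem₃ = solve-∀

zero-^ : ∀ k → 1 ≤ k → 0 ^ (2 * k) ≡ 0
zero-^ (suc k) _ = refl

dense⇒contains : ∀ {μ k r p} → 1 ≤ μ → 1 ≤ k → (const : Constants μ k r p) →
  ∀ m n (G : BipGraph m n) → AlmostBiregular μ G → m ≤ n →
  (μ * Constants.C const) ^ (2 * k) * (m ^ (k + 1) * n ^ k) < (edges G ∸ μ * Constants.D const * n) ^ (2 * k) → ContainsSubdivK p k r G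
dense⇒contains {μ} {k} {r} {p} 1≤μ 1≤k const zero n G reg m≤n big =
  ⊥-elim (n≮0 (<-≤-trans big (≤-reflexive (trans (cong (_^ (2 * k)) (0∸n≡0 (μ * Constants.D const * n))) (zero-^ k 1≤k)))))
dense⇒contains {μ} {k} {r} {p} 1≤μ 1≤k const m@(suc _) n@(suc _) G (regM , regN) m≤n big =
  contains G k r p H₀ 1≤k (≤-reflexive (sym H₀≡)) (A.hub (≤-trans (≤-reflexive (cong (C *_) length-verts-true)) (≤-trans C≤ (≤-reflexive (sym (A.π-even k))))))
  where
  open Constants const
  open Concrete G
  e = edges G
  -- The degrees of one vertex in each part serve as `d`; almost-biregularity makes them represent
  -- all degrees of that part up to the factor μ.
  x = degM G fz
  y = degN G fz
  d : Bool → ℕ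
  d true  = x
  d false = y
  deg-lo : ∀ v → d (side v) ≤ μ * length (nbrs v)
  deg-lo (inj₁ a) = ≤-trans (regM fz a) (≤-reflexive (cong (μ *_) (sym (length-row a))))
  deg-lo (inj₂ b) = ≤-trans (regN fz b) (≤-reflexive (cong (μ *_) (sym (length-col b))))
  deg-hi : ∀ v → length (nbrs v) ≤ μ * d (side v)
  deg-hi (inj₁ a) = ≤-trans (≤-reflexive (length-row a)) (regM a fz)
  deg-hi (inj₂ b) = ≤-trans (≤-reflexive (length-col b)) (regN b fz)
  side-of : ∀ {s v} → v ∈ verts s → side v ≡ s
  side-of = BipartiteGraph.verts-side graph
  e≤M : e ≤ m * (μ * x)
  e≤M = ≤-trans (≤-reflexive edges-rows) (≤-trans (∑-bound (verts true) λ v i → ≤-trans (deg-hi v) (≤-reflexive (cong (λ s → μ * d s) (side-of {true} i)))) (≤-reflexive (cong (_* (μ * x)) length-verts-true)))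
  e≤N : e ≤ n * (μ * y)
  e≤N = ≤-trans (≤-reflexive edges-cols) (≤-trans (∑-bound (verts false) λ v i → ≤-trans (deg-hi v) (≤-reflexive (cong (λ s → μ * d s) (side-of {false} i)))) (≤-reflexive (cong (_* (μ * y)) length-verts-false)))
  -- If the truncated difference were 0, so would be its power with exponent 2k ≥ 2. From μ D n < e
  -- follows y ≥ D, and, because m ≤ n, also x ≥ D.
  Ln<e : μ * D * n < e
  Ln<e = ≰⇒> λ le → n≮0 (<-≤-trans big (≤-reflexive (trans (cong (_^ (2 * k)) (m≤n⇒m∸n≡0 le)) (zero-^ k 1≤k))))
  D≤ : ∀ s z → 1 ≤ s → μ * D * s ≤ s * (μ * z) → D ≤ z
  D≤ s z 1≤s le = *-cancelˡ-≤ (s * μ) {{>-nonZero (*-mono-≤ 1≤s 1≤μ)}} (≤-trans (≤-reflexive (lem s μ D)) (≤-trans le (≤-reflexive (sym (*-assoc s μ z)))))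
    where
    lem : ∀ s u w → s * u * w ≡ u * w * s
    lem = solve-∀
  D≤d : ∀ s → D ≤ d s
  D≤d true  = D≤ m x (s≤s z≤n) (≤-trans (*-monoʳ-≤ (μ * D) m≤n) (≤-trans (<⇒≤ Ln<e) e≤M))
  D≤d false = D≤ n y (s≤s z≤n) (≤-trans (<⇒≤ Ln<e) e≤N)
  0<verts : ∀ s → 0 < length (verts s)
  0<verts true  = ≤-trans (s≤s z≤n) (≤-reflexive (sym length-verts-true))
  0<verts false = ≤-trans (s≤s z≤n) (≤-reflexive (sym length-verts-false))
  C≤ : C * m ≤ (x * y) ^ k
  C≤ = density μ C k m n e x y 1≤μ 1≤C 1≤k (s≤s z≤n) (s≤s z≤n) e≤M e≤N
    (<-≤-trans big (^-monoˡ-≤ (2 * k) (m∸n≤m e (μ * D * n))))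
  module A = Assembly 1≤μ 1≤k const graph d deg-lo deg-hi D≤d 0<verts

theorem4p4 : (μ k r p : ℕ) → 1 ≤ μ → 1 ≤ k → 1 ≤ r → 1 ≤ p →
    Σ ℕ λ C → Σ ℕ λ L → 1 ≤ C × 1 ≤ L ×
    (∀ (m n : ℕ) (G : BipGraph m n) →
    AlmostBiregular μ G → ¬ ContainsSubdivK p k r G → m ≤ n →
    (edges G ∸ L * n) ^ (2 * k) ≤ C ^ (2 * k) * (m ^ (k + 1) * n ^ k))
theorem4p4 μ k r p 1≤μ 1≤k _ _ =
  μ * C , μ * D , *-mono-≤ 1≤μ 1≤C , *-mono-≤ 1≤μ (≤-trans (s≤s z≤n) D₃) ,
  λ m n G reg free m≤n → ≮⇒≥ λ big → free (dense⇒contains 1≤μ 1≤k const m n G reg m≤n big)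
  where
  const = constants μ k r p
  open Constants const
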